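{- Let $U'$ be a unital of order $q$ of $\mathcal{NP}$ that contains $(0,1,0)$ or $(1,0,0)$, and suppose $q$ divides $o(\mathrm{Aut}(U')\cap\mathfrak L)$. Then $U'$ is isomorphic to a unital $U$ for which the following hold. (i) $U$ is a parabolic unital of $\mathcal{NP}$ containing $(0,1,0)$. (ii) $H:=\mathrm{Aut}(U)\cap\mathfrak T=\{\phi(1,1,0,w):w\in W\}$, where $W$ is a subspace of $\mathbb{F}_{q^2}$ viewed as an $\mathbb{F}_p$-vector space, with $|W|=q$; moreover the scalar field $\mathbb{F}_{q_0}$ of $W$ (a subfield of $\mathbb{F}_{q^2}$ with $\mathbb{F}_{q_0}W=W$) is a subfield of $\mathbb{F}_q$. (iii) $U\cap[1,0,0]=\{(0,1,0)\}\cup\{(0,w,1):w\in W\}$, and $\{(0,w,1):w\in W\}$ is precisely the set of tangency points of the $q$ affine tangent lines of $U$ through $(1,0,0)$. (iv) The group $G:=\mathrm{Aut}(U)\cap\mathfrak L$ satisfies $G=HG_1$ where $G_1=G\cap\hat{\mathfrak R}_0$; furthermore $q\mid o(G)$ and $o(G)\mid q(q^2-1)$. (v) $H$ is a normal subgroup of $G$. (vi) $o(G_1)=o(G)/q$. (vii) The set $C=\{c:\ \phi(c,d,0,0)\in G_1\text{ for some }d\}$ has cardinality $o(G_1)$ and is a subgroup of $(\mathbb{F}_{q^2}^*,\star)$. (viii) The set $D=\{d:\ \phi(c,d,0,0)\in G_1\text{ for some }c\}$ is a subgroup of $\mathbb{F}_{q_0}^*$; in particular $D\le\mathbb{F}_q^*$.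 (ix) The rule $\delta(c)=d$ whenever $\phi(c,d,0,0)\in G_1$ defines a map $\delta:C\to D$ which is an onto $r$-to-$1$ homomorphism, where $r=o(C)/o(D)$; furthermore $r\mid(q+1)$.
   Context: Let $p$ be an odd prime, $q=p^e$. The regular nearfield $\mathcal N(2,q)$ has underlying set $\mathbb{F}_{q^2}$, field addition, and multiplication $x\star y=xy$ if $y$ is a nonzero square of $\mathbb{F}_{q^2}$, $x\star y=x^qy$ if $y$ is a nonsquare, $x\star0=0$. The plane $\mathcal{NP}$ has points $(x,y,1)$ ($x,y\in\mathbb{F}_{q^2}$; affine points), $(1,y,0)$ ($y\in\mathbb{F}_{q^2}$), $(0,1,0)$; lines $[s,1,t]$, $[1,0,t]$ ($s,t\in\mathbb{F}_{q^2}$), $[0,0,1]$ (line at infinity); $(x,y,z)$ lies on $[s,u,t]$ iff $x\star s+y\star u+z\star t=0$; it is a projective plane of order $q^2$. For $c,d\in\mathbb{F}_{q^2}^*$, $u,v\in\mathbb{F}_{q^2}$, $\phi(c,d,u,v)$ is the collineation acting on affine points by $(x,y,1)\mapsto(x\star c+u,y\star d+v,1)$ and $\gamma(c,d,u,v)$ the one acting by $(x,y,1)\mapsto(y\star c+u,x\star d+v,1)$. $\mathfrak T=\{\phi(1,1,u,v)\}$, $\hat{\mathfrak R}_0=\{\phi(c,d,0,0):c,d\ne0\}$, $\mathfrak L=\{\phi(c,d,u,v)\}\cup\{\gamma(c,d,u,v)\}$ (linear collineations). A unital of order $q$ in $\mathcal{NP}$ is a set of $q^3+1$ points meeting every line in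 $1$ (tangent) or $q+1$ (secant) points; parabolic means $[0,0,1]$ is a tangent. $\mathrm{Aut}(U)$ is the group of collineations of $\mathcal{NP}$ preserving $U$. Two unitals are isomorphic if one is the image of the other under a collineation of $\mathcal{NP}$. -}

module Defs where

open import Level using (0ℓ)
open import Data.Nat as ℕ using (ℕ; zero; suc)
import Data.Fin
open Data.Fin using (Fin)
open import Data.Fin.Properties using (any?)
open import Data.Nat.Divisibility using (_∣_)
open import Data.Product using (Σ; ∃; ∃-syntax; _×_; _,_; proj₁; proj₂)
open import Data.Sum using (_⊎_)
open import Data.List using (List; length)
open import Data.List.Membership.Propositional using (_∈_)
open import Data.List.Relation.Unary.Unique.Propositional using (Unique)
open import Relation.Nullary using (¬_; Dec; yes; no)
open import Relation.Binary.PropositionalEquality using (_≡_; _≢_; refl; cong; subst; sym; trans)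
open import Algebra.Structures using (IsCommutativeRing)
open import Function.Bundles using (_↔_; _⇔_; Inverse)

HasSize : {A : Set} → (A → Set) → ℕ → Set
HasSize {A} P n =
  Σ (List A) λ xs → Unique xs × length xs ≡ n × (∀ a → (a ∈ xs) ⇔ P a)

record FiniteField : Set₁ where
  infixl 7 _*_
  infixl 6 _+_
  infix  8 -_
  field
    Carrier : Set
    _+_ _*_ : Carrier → Carrier → Carrier
    -_      : Carrier → Carrier
    0# 1#   : Carrier
    isCommutativeRing : IsCommutativeRing _≡_ _+_ _*_ -_ 0# 1#
    0≢1     : 0# ≢ 1#
    inverse : ∀ x → x ≢ 0# → ∃[ y ] (x * y ≡ 1#)
    size    : ℕ
    enum    : Carrier ↔ Fin size

  infixr 9 _^_
  _^_ : Carrier → ℕ → Carrier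
  x ^ zero  = 1#
  x ^ suc n = x * (x ^ n)

  _≟_ : (x y : Carrier) → Dec (x ≡ y)
  x ≟ y with Data.Fin._≟_ (Inverse.to enum x) (Inverse.to enum y)
  ... | yes e = yes (trans (sym (Inverse.strictlyInverseʳ enum x))
                      (trans (cong (Inverse.from enum) e) (Inverse.strictlyInverseʳ enum y)))
  ... | no ne = no λ x≡y → ne (cong (Inverse.to enum) x≡y)

  IsSquare : Carrier → Set
  IsSquare x = ∃[ y ] (y * y ≡ x)

  square? : (x : Carrier) → Dec (IsSquare x)
  square? x with any? {P = λ i → Inverse.from enum i * Inverse.from enum i ≡ x}
                      (λ i → (Inverse.from enum i * Inverse.from enum i) ≟ x)
  ... | yes (i , e) = yes (Inverse.from enum i , e)
  ... | no ne = no λ { (y , e) → ne (Inverse.to enum y ,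
            subst (λ z → z * z ≡ x) (sym (Inverse.strictlyInverseʳ enum y)) e) }

-- The regular nearfield N(2,q) on a field F of order q², and the plane NP.

module NP (F : FiniteField) (q : ℕ) where
  open FiniteField F public

  infixl 7 _⋆_
  _⋆_ : Carrier → Carrier → Carrier
  x ⋆ y with y ≟ 0#
  ... | yes _ = 0#
  ... | no  _ with square? y
  ...   | yes _ = x * y
  ...   | no  _ = (x ^ q) * y

  data Point : Set where
    aff   : Carrier → Carrier → Point
    infSl : Carrier → Point
    infV  : Point

  data Line : Set where
    sl   : Carrier → Carrier → Line
    vert : Carrier → Line
    linf : Line

  record Triple : Set where
    constructor ⟨_,_,_⟩
    field c₁ c₂ c₃ : Carrier

  pcoord : Point → Triple
  pcoord (aff x y)  = ⟨ x , y , 1# ⟩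
  pcoord (infSl y)  = ⟨ 1# , y , 0# ⟩
  pcoord infV       = ⟨ 0# , 1# , 0# ⟩

  lcoord : Line → Triple
  lcoord (sl s t) = ⟨ s , 1# , t ⟩
  lcoord (vert t) = ⟨ 1# , 0# , t ⟩
  lcoord linf     = ⟨ 0# , 0# , 1# ⟩

  infix 4 _I_
  _I_ : Point → Line → Set
  P I L with pcoord P | lcoord L
  ... | ⟨ x , y , z ⟩ | ⟨ s , u , t ⟩ = x ⋆ s + y ⋆ u + z ⋆ t ≡ 0#

  record Collineation : Set where
    field
      pt  : Point ↔ Point
      ln  : Line ↔ Line
      inc : ∀ P L → (P I L) ⇔ (Inverse.to pt P I Inverse.to ln L)

  _·_ : Collineation → Point → Point
  α · P = Inverse.to (Collineation.pt α) P

  data Kind : Set where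
    φK γK : Kind

  record LPar : Set where
    constructor lpar
    field
      kind : Kind
      c d u v : Carrier

  φ : Carrier → Carrier → Carrier → Carrier → LPar
  φ = lpar φK

  γ : Carrier → Carrier → Carrier → Carrier → LPar
  γ = lpar γK

  Nonzero : LPar → Set
  Nonzero π = (LPar.c π ≢ 0#) × (LPar.d π ≢ 0#)

  affImage : LPar → Carrier → Carrier → Point
  affImage (lpar φK c d u v) x y = aff (x ⋆ c + u) (y ⋆ d + v)
  affImage (lpar γK c d u v) x y = aff (y ⋆ c + u) (x ⋆ d + v)

  ActsAs : Collineation → LPar → Set
  ActsAs α π = ∀ x y → α · aff x y ≡ affImage π x y

  InL : Collineation → Set
  InL α = ∃[ π ] (Nonzero π × ActsAs α π)

  InT : Collineation → Set
  InT α = ∃[ u ] ∃[ v ] ActsAs α (φ 1# 1# u v)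

  InR0 : Collineation → Set
  InR0 α = ∃[ c ] ∃[ d ] ((c ≢ 0#) × (d ≢ 0#) × ActsAs α (φ c d 0# 0#))

  PointSet : Set₁
  PointSet = Point → Set

  OnLine : PointSet → Line → Point → Set
  OnLine U L P = U P × P I L

  Tangent : PointSet → Line → Set
  Tangent U L = HasSize (OnLine U L) 1

  Secant : PointSet → Line → Set
  Secant U L = HasSize (OnLine U L) (suc q)

  Unital : PointSet → Set
  Unital U = HasSize U (q ℕ.^ 3 ℕ.+ 1) × (∀ L → Tangent U L ⊎ Secant U L)

  Parabolic : PointSet → Set
  Parabolic U = Tangent U linf

  InAut : PointSet → Collineation → Set
  InAut U α = ∀ P → U P ⇔ U (α · P)

  ImageOf : Collineation → PointSet → PointSet → Set
  ImageOf α U' U = ∀ P → U P ⇔ U' (Inverse.from (Collineation.pt α) P)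

  Isomorphic : PointSet → PointSet → Set
  Isomorphic U' U = ∃[ α ] ImageOf α U' U

  InG : PointSet → Collineation → Set
  InG U α = InAut U α × InL α

  InH : PointSet → Collineation → Set
  InH U α = InAut U α × InT α

  InG1 : PointSet → Collineation → Set
  InG1 U α = InG U α × InR0 α

  -- G and G₁ indexed by their (unique) parameters, used for counting orders:
  -- an element of 𝔏 is determined by its parameters and vice versa.
  GPar : PointSet → LPar → Set
  GPar U π = Nonzero π × ∃[ α ] (ActsAs α π × InAut U α)

  G1Par : PointSet → LPar → Set
  G1Par U π = ∃[ c ] ∃[ d ] (π ≡ φ c d 0# 0# × GPar U π)

  Rel : PointSet → Carrier → Carrier → Set
  Rel U c d = G1Par U (φ c d 0# 0#)

  IsSubgroup⋆ : (Carrier → Set) → Set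
  IsSubgroup⋆ S = (∀ x → S x → x ≢ 0#) × S 1#
                × (∀ x y → S x → S y → S (x ⋆ y))
                × (∀ x → S x → ∃[ y ] (S y × x ⋆ y ≡ 1#))

  -- W is an F_p-subspace of F (= additive subgroup)
  IsFpSubspace : (Carrier → Set) → Set
  IsFpSubspace W = W 0# × (∀ x y → W x → W y → W (x + y)) × (∀ x → W x → W (- x))

  InKernel : (Carrier → Set) → Carrier → Set
  InKernel W l = ∀ w → W w → W (l * w)

  InFq : Carrier → Set
  InFq x = x ^ q ≡ x

  Theorem5p2 : Set₁
  Theorem5p2 =
      (U' : PointSet) → Unital U' → (U' infV ⊎ U' (infSl 0#)) →
      (∃[ n ] (HasSize (GPar U') n × q ∣ n)) →
      ∃[ U ] (Isomorphic U' U
        × Unital U × Parabolic U × U infV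
        × (∃[ W ] (IsFpSubspace W × HasSize W q
            × (∀ α → InH U α ⇔ (∃[ w ] (W w × ActsAs α (φ 1# 1# 0# w))))
            × (∀ l → InKernel W l → InFq l)
            × (∀ P → (U P × P I vert 0#) ⇔ (P ≡ infV ⊎ ∃[ w ] (W w × P ≡ aff 0# w)))
            × HasSize (λ L → L ≢ linf × infSl 0# I L × Tangent U L) q
            × (∀ P → (∃[ L ] (L ≢ linf × infSl 0# I L × Tangent U L × U P × P I L))
                     ⇔ (∃[ w ] (W w × P ≡ aff 0# w)))
            × IsSubgroup⋆ (λ d → ∃[ c ] Rel U c d)
            × (∀ d → (∃[ c ] Rel U c d) → InKernel W d × InFq d)))
        × (∀ α → InG U α ⇔ (∃[ β ] ∃[ δ ] (InH U β × InG1 U δ × (∀ P → α · P ≡ β · (δ · P)))))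
        × (∃[ n ] (HasSize (GPar U) n × q ∣ n × n ∣ q ℕ.* (q ℕ.* q ℕ.∸ 1)))
        × (∀ α β → InG U α → InH U β →
             ∃[ β' ] (InH U β' × (∀ P → α · (β · P) ≡ β' · (α · P))))
        × (∃[ n ] ∃[ n₁ ] (HasSize (GPar U) n × HasSize (G1Par U) n₁ × n ≡ q ℕ.* n₁))
        × (∃[ n₁ ] (HasSize (G1Par U) n₁ × HasSize (λ c → ∃[ d ] Rel U c d) n₁))
        × IsSubgroup⋆ (λ c → ∃[ d ] Rel U c d)
        × (∀ c d d' → Rel U c d → Rel U c d' → d ≡ d')
        × (∀ c c' d d' → Rel U c d → Rel U c' d' → Rel U (c ⋆ c') (d ⋆ d'))
        × (∃[ nC ] ∃[ nD ] ∃[ r ]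
             (HasSize (λ c → ∃[ d ] Rel U c d) nC × HasSize (λ d → ∃[ c ] Rel U c d) nD
              × nC ≡ r ℕ.* nD × r ∣ ℕ.suc q
              × (∀ d → (∃[ c ] Rel U c d) → HasSize (λ c → Rel U c d) r))))

{-# OPTIONS --safe #-}

-- A point P at infinity lies on k q + ε affine tangents, where k is 0 if P is in U and 1 if not, and ε is 0 if
-- the line at infinity is tangent and 1 if it is secant. Modulo translations, Aut(U) ∩ 𝔏 is a subgroup
-- of a group of order 2 (q² − 1)², which is prime to p, so q divides the number of translations preserving U.
-- A nontrivial such translation fixes every line through its centre P and no affine point; hence no affine
-- tangent through P touches U in an affine point, so P is in U. If the line at infinity were secant, the unique
-- tangent at another point Q of U at infinity would be fixed, and Q would be a centre as well. So U is parabolic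
-- and, after a swap of the coordinates, all its translations are vertical; they act regularly on the q affine
-- points of U on a vertical line and on the q affine tangents through (1,0,0), whose points of contact therefore
-- form one vertical orbit, which is translated to {(0,w) : w ∈ W}. Every linear automorphism preserves this orbit,
-- which gives G = H G₁; counting orbits of free actions on nonzero field elements and on a secant y = const gives
-- the divisibilities, and products over W ∖ {0} show that the kernel of W lies in F_q and that D consists of squares.

module Submission where

-- The count k q + ε is a double count: of the q² affine lines through P, let a be tangents and b
-- secants; they carry k and k + q affine points of U respectively, so a + b = q² and a k + b (k +
-- q) = q³ - q ε, which forces a. The obstacle in the statements on D is that `_⋆ d` is
-- multiplication by `d` only for a square `d`; for a nonsquare it is x ↦ x^q d. Invariance of W
-- under `_⋆ d` therefore says nothing about scalars of W until nonsquares are excluded, and the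
-- exclusion works because the Euler exponent (q² - 1)/2 is q + 1 times half the number of nonzero
-- elements of W. That δ is a map rests on the column x = 1 of U, a coset y + W. An automorphism
-- φ(1,d,0,0) preserves it, so y ⋆ d - y lies in W; for d ≠ 1 this puts y into W and hence (1,0,1)
-- into U, although y = 0 is tangent at the origin. Orders are always sizes of sets of parameters: a
-- collineation is determined by its action on affine points, and parameters are determined by that
-- action. A point set is an arbitrary predicate; it becomes decidable through the enumeration
-- contained in `HasSize`.

open import Defs
open import Level using (0ℓ)
open import Algebra.Bundles using (CommutativeRing)
import Algebra.Properties.AbelianGroup as AbelianGroupProperties
import Algebra.Properties.CommutativeSemiring.Binomial as Binomial
import Algebra.Properties.Ring as RingProperties
import Algebra.Properties.Semiring.Exp as Exp
import Algebra.Properties.Semiring.Mult as Mult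
import Algebra.Properties.Semiring.Sum as Sum
import Algebra.Solver.CommutativeMonoid as CommutativeMonoidSolver
import Data.Fin as Fin
import Data.Fin.Properties as FinP
import Data.Nat as ℕ
open ℕ using (ℕ; zero; suc; _!)
import Data.Nat.Properties as ℕP
open import Data.Nat.Combinatorics using (nCn≡1; k![n∸k]!∣n!; nCk≡n!/k![n-k]!) renaming (_C_ to _choose_)
open import Data.Nat.DivMod using (_%_; _/_; m≡m%n+[m/n]*n; m/n*n≡m)
open import Data.Nat.Divisibility
  using (_∣_; divides; _∣0; ∣-refl; ∣-trans; ∣⇒≤; 1∣_; ∣1⇒≡1; m∣m*n; ∣m⇒∣m*n; ∣m∣n⇒∣m+n; ∣m+n∣m⇒∣n; *-monoʳ-∣; *-cancelˡ-∣)
open import Data.Nat.Primality using (Prime; euclidsLemma; prime⇒nonZero; prime⇒nonTrivial)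
open import Data.Nat.Tactic.RingSolver using (solve-∀)
open import Data.Empty using (⊥; ⊥-elim)
open import Data.Product using (∃; ∃-syntax; _×_; _,_; proj₁; proj₂)
open import Data.Product.Properties using (≡-dec)
open import Data.Sum using (_⊎_; inj₁; inj₂; [_,_]′) renaming (map to ⊎-map)
open import Data.Unit using (⊤; tt)
open import Data.List using (List; []; _∷_; _++_; length; map; filter; foldr; deduplicate; cartesianProduct; allFin)
open import Data.List.Properties using (length-map; length-++; length-tabulate)
open import Data.List.Membership.Propositional using (_∈_)
open import Data.List.Membership.Propositional.Properties
  using (∈-map⁺; ∈-map⁻; ∈-++⁺ˡ; ∈-++⁺ʳ; ∈-++⁻; ∈-filter⁺; ∈-filter⁻; ∈-deduplicate⁺; ∈-deduplicate⁻;
         ∈-cartesianProduct⁺; ∈-cartesianProduct⁻; ∈-allFin)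
open import Data.List.Membership.Propositional.Properties.WithK using (unique∧set⇒bag)
open import Data.List.Relation.Binary.BagAndSetEquality using (∼bag⇒↭)
open import Data.List.Relation.Binary.Permutation.Propositional
  using (_↭_) renaming (refl to ↭refl; prep to ↭prep; swap to ↭swap; trans to ↭trans)
open import Data.List.Relation.Binary.Permutation.Propositional.Properties using (↭-length)
open import Data.List.Relation.Unary.All as All using (All; []; _∷_)
import Data.List.Relation.Unary.All.Properties as AllP
open import Data.List.Relation.Unary.AllPairs using ([]; _∷_)
open import Data.List.Relation.Unary.Any as Any using (here; there)
open import Data.List.Relation.Unary.Unique.Propositional using (Unique)
open import Data.List.Relation.Unary.Unique.Propositional.Properties
  using (map⁺; ++⁺; filter⁺; cartesianProduct⁺; allFin⁺)
import Data.List.Relation.Unary.Unique.DecPropositional.Properties as UniqueDec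
open import Function.Base using (_∘_; id)
open import Function.Bundles using (_⇔_; mk⇔; Equivalence; Inverse; mk↔ₛ′)
open import Function.Construct.Composition using (_↔-∘_)
open import Function.Construct.Symmetry using (↔-sym)
open import Relation.Binary.Definitions using (DecidableEquality; tri<; tri≈; tri>)
open import Relation.Binary.PropositionalEquality hiding ([_])
open import Relation.Nullary using (¬_; Dec; yes; no; contradiction; ¬?)
open import Relation.Nullary.Decidable using (map′; _×-dec_; decidable-stable)
open import Relation.Unary using (Decidable)

-- Cardinalities

variable
  A B : Set
  P Q R : A → Set
  m n : ℕ

to : {X Y : Set} → X ⇔ Y → X → Y
to = Equivalence.to

from : {X Y : Set} → X ⇔ Y → Y → X
from = Equivalence.from

elements : HasSize P n → List _
elements = proj₁

-- Duplicate-free lists with the same members agree as bags. Besides the uniqueness of cardinalities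
-- this yields that products and sums over a set do not depend on the enumeration, the basis of all
-- arguments in which a map permutes a set.
size-↭ : (∀ {a} → P a → Q a) → (∀ {a} → Q a → P a) →
         (hP : HasSize P m) (hQ : HasSize Q n) → elements hP ↭ elements hQ
size-↭ f g (xs , ux , _ , ex) (ys , uy , _ , ey) =
  ∼bag⇒↭ (unique∧set⇒bag ux uy (mk⇔ (from (ey _) ∘ f ∘ to (ex _)) (from (ex _) ∘ g ∘ to (ey _))))

abstract
  size-≡ : HasSize P m → HasSize P n → m ≡ n
  size-≡ hP@(_ , _ , refl , _) hQ@(_ , _ , refl , _) = ↭-length (size-↭ id id hP hQ)

size-resp : (∀ {a} → P a → Q a) → (∀ {a} → Q a → P a) → HasSize P n → HasSize Q n
size-resp f g (xs , u , l , e) = xs , u , l , λ a → mk⇔ (f ∘ to (e a)) (from (e a) ∘ g)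

unique-map : (f : A → B) {xs : List A} →
             (∀ {x y} → x ∈ xs → y ∈ xs → f x ≡ f y → x ≡ y) → Unique xs → Unique (map f xs)
unique-map f inj [] = []
unique-map f inj (px ∷ u) =
  AllP.map⁺ (All.tabulate λ y∈ eq → All.lookup px y∈ (inj (here refl) (there y∈) eq))
  ∷ unique-map f (λ x∈ y∈ → inj (there x∈) (there y∈)) u

InjectiveOn : (A → Set) → (A → B) → Set
InjectiveOn P f = ∀ {a b} → P a → P b → f a ≡ f b → a ≡ b

Image : (A → Set) → (A → B) → B → Set
Image P f b = ∃[ a ] (P a × f a ≡ b)

size-image-inj : (f : A → B) → InjectiveOn P f → HasSize P n → HasSize (Image P f) n
size-image-inj f inj (xs , u , l , e) =
  map f xs , unique-map f (λ x∈ y∈ → inj (to (e _) x∈) (to (e _) y∈)) u , trans (length-map f xs) l ,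
  λ b → mk⇔ (λ b∈ → let a , a∈ , eq = ∈-map⁻ f b∈ in a , to (e a) a∈ , sym eq)
            (λ (a , pa , eq) → subst (_∈ map f xs) eq (∈-map⁺ f (from (e a) pa)))

size-bij : (f : A → B) → (∀ {a} → P a → Q (f a)) → (∀ {b} → Q b → Image P f b) →
           InjectiveOn P f → HasSize P n → HasSize Q n
size-bij {Q = Q} f pq qp inj h =
  size-resp (λ (_ , pa , eq) → subst Q eq (pq pa)) qp (size-image-inj f inj h)

abstract
  size-image : DecidableEquality B → (f : A → B) → HasSize P n → ∃[ k ] HasSize (Image P f) k
  size-image {B = B} _≟_ f (xs , u , _ , e) = _ , ys , UniqueDec.deduplicate-! _≟_ _ , refl ,
    λ b → mk⇔ (λ b∈ → let a , a∈ , eq = ∈-map⁻ f (∈-deduplicate⁻ _≟_ (map f xs) b∈) in a , to (e a) a∈ , sym eq)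
              (λ (a , pa , eq) → subst (_∈ ys) eq (∈-deduplicate⁺ _≟_ (∈-map⁺ f (from (e a) pa))))
    where
    ys : List B
    ys = deduplicate _≟_ (map f xs)

size-⊎ : (∀ {a} → P a → Q a → ⊥) → HasSize P m → HasSize Q n → HasSize (λ a → P a ⊎ Q a) (m ℕ.+ n)
size-⊎ disj (xs , ux , lx , ex) (ys , uy , ly , ey) =
  xs ++ ys , ++⁺ ux uy (λ (x∈ , y∈) → disj (to (ex _) x∈) (to (ey _) y∈)) , trans (length-++ xs) (cong₂ ℕ._+_ lx ly) ,
  λ a → mk⇔ (λ a∈ → split (∈-++⁻ xs a∈))
            (λ { (inj₁ p) → ∈-++⁺ˡ (from (ex a) p) ; (inj₂ q) → ∈-++⁺ʳ xs (from (ey a) q) })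
  where
  split : ∀ {a} → a ∈ xs ⊎ a ∈ ys → _ ⊎ _
  split (inj₁ x∈) = inj₁ (to (ex _) x∈)
  split (inj₂ y∈) = inj₂ (to (ey _) y∈)

length-cartesianProduct : (xs : List A) (ys : List B) → length (cartesianProduct xs ys) ≡ length xs ℕ.* length ys
length-cartesianProduct [] ys = refl
length-cartesianProduct (x ∷ xs) ys =
  trans (length-++ (map (x ,_) ys)) (cong₂ ℕ._+_ (length-map (x ,_) ys) (length-cartesianProduct xs ys))

size-× : HasSize P m → HasSize Q n → HasSize (λ (a , b) → P a × Q b) (m ℕ.* n)
size-× (xs , ux , refl , ex) (ys , uy , refl , ey) =
  cartesianProduct xs ys , cartesianProduct⁺ ux uy , length-cartesianProduct xs ys ,
  λ (a , b) → mk⇔ (λ ab∈ → let a∈ , b∈ = ∈-cartesianProduct⁻ xs ys ab∈ in to (ex a) a∈ , to (ey b) b∈)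
                  (λ (p , q) → ∈-cartesianProduct⁺ (from (ex a) p) (from (ey b) q))

abstract
  size-filter : (R? : Decidable R) → HasSize P n → ∃[ k ] HasSize (λ a → P a × R a) k
  size-filter R? (xs , u , _ , e) = _ , filter R? xs , filter⁺ R? u , refl ,
    λ a → mk⇔ (λ a∈ → let a∈xs , r = ∈-filter⁻ R? a∈ in to (e a) a∈xs , r)
              (λ (p , r) → ∈-filter⁺ R? (from (e a) p) r)

  size-split : (R? : Decidable R) → HasSize P n →
               ∃[ a ] ∃[ b ] (HasSize (λ x → P x × R x) a × HasSize (λ x → P x × ¬ R x) b × a ℕ.+ b ≡ n)
  size-split {R = R} {P = P} R? h =
    let a , hR = size-filter R? h
        b , h¬R = size-filter (λ x → ¬? (R? x)) h
    in a , b , hR , h¬R ,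
       size-≡ (size-resp (λ { (inj₁ (p , _)) → p ; (inj₂ (p , _)) → p }) decide
                         (size-⊎ (λ (_ , r) (_ , ¬r) → ¬r r) hR h¬R)) h
    where
    decide : ∀ {x} → P x → P x × R x ⊎ P x × ¬ R x
    decide {x} p with R? x
    ... | yes r = inj₁ (p , r)
    ... | no ¬r = inj₂ (p , ¬r)

  -- Searching the enumeration decides membership. In this way unitals and automorphism groups,
  -- given as bare predicates, admit case distinctions.
  size-dec : DecidableEquality A → {P : A → Set} → HasSize P n → Decidable P
  size-dec _≟_ (xs , _ , _ , e) a = map′ (to (e a)) (from (e a)) (Any.any? (a ≟_) xs)

  size-witness : HasSize P n → 0 ℕ.< n → ∃ P
  size-witness (x ∷ _ , _ , _ , e) _ = x , to (e x) (here refl)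
  size-witness ([] , _ , refl , _) ()

size-empty : HasSize P 0 → ∀ {a} → ¬ P a
size-empty ([] , _ , _ , e) p with () ← from (e _) p

size-∅ : (∀ {a} → ¬ P a) → HasSize P 0
size-∅ ¬p = [] , [] , refl , λ a → mk⇔ (λ ()) (λ p → ⊥-elim (¬p p))

size-pos : HasSize P n → ∀ {a} → P a → 0 ℕ.< n
size-pos {n = zero} h p = ⊥-elim (size-empty h p)
size-pos {n = suc _} _ _ = ℕ.s≤s ℕ.z≤n

size-singleton : (a : A) → HasSize (_≡ a) 1
size-singleton a = a ∷ [] , [] ∷ [] , refl , λ _ → mk⇔ (λ { (here eq) → eq ; (there ()) }) here

size-1-≡ : HasSize P 1 → ∀ {a b} → P a → P b → a ≡ b
size-1-≡ (x ∷ [] , _ , _ , e) p q with here refl ← from (e _) p | here refl ← from (e _) q = refl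

abstract
  size-other : {P : A → Set} → HasSize P n → 2 ℕ.≤ n → (a : A) → DecidableEquality A → ∃[ b ] (P b × b ≢ a)
  size-other (x ∷ y ∷ xs , (x≢y ∷ _) ∷ _ , _ , e) _ a _≟_ with x ≟ a
  ... | no x≢a = x , to (e x) (here refl) , x≢a
  ... | yes refl = y , to (e y) (there (here refl)) , x≢y ∘ sym
  size-other ([] , _ , refl , _) () _ _
  size-other (_ ∷ [] , _ , refl , _) (ℕ.s≤s ()) _ _

module _ {P : A → Set} {Q : B → Set} (_≟_ : DecidableEquality B) (f : A → B) (pq : ∀ {a} → P a → Q (f a)) (inj : InjectiveOn P f) where

  abstract
    -- The equation with the size `b` of the complement of the image serves twice: it gives the
    -- inequality of sizes, and for equal sizes it gives b = 0, which is surjectivity.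
    image-in : HasSize P m → HasSize Q n →
               ∃[ b ] (HasSize (λ y → Q y × ¬ Image P f y) b × m ℕ.+ b ≡ n)
    image-in hP hQ with size-split (size-dec _≟_ (size-image-inj f inj hP)) hQ
    ... | a , b , hI , hN , eq = b , hN , trans (cong (ℕ._+ b) (size-≡ (size-image-inj f inj hP) hI′)) eq
      where
      hI′ : HasSize (Image P f) a
      hI′ = size-resp proj₂ (λ { i@(a , p , refl) → pq p , i }) hI

    size-≤ : HasSize P m → HasSize Q n → m ℕ.≤ n
    size-≤ hP hQ with image-in hP hQ
    ... | b , _ , refl = ℕP.m≤m+n _ b

    size-surj : HasSize P n → HasSize Q n → ∀ {b} → Q b → Image P f b
    size-surj hP hQ {y} qy with size-dec _≟_ (size-image-inj f inj hP) y
    ... | yes i = i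
    ... | no ¬i with image-in hP hQ
    ...   | b , hN , eq = ⊥-elim (size-empty (subst (HasSize _) (ℕP.+-cancelˡ-≡ _ b 0 (trans eq (sym (ℕP.+-identityʳ _)))) hN) (qy , ¬i))

-- The double-counting principle behind the count of tangents, Lagrange's theorem for the
-- translations, and the equation between the orders of C and D.
size-fibres : (f : A → B) (r : ℕ) → (∀ {a} → P a → Q (f a)) →
              (∀ {b} → Q b → HasSize (λ a → P a × f a ≡ b) r) →
              HasSize P n → HasSize Q m → n ≡ m ℕ.* r
size-fibres {P = P} {Q = Q} f r pq fib hP (ys , u , refl , e) =
  size-≡ hP (size-resp proj₁ (λ p → p , from (e _) (pq p)) (over ys u (to (e _))))
  where
  over : ∀ ys → Unique ys → (∀ {b} → b ∈ ys → Q b) → HasSize (λ a → P a × f a ∈ ys) (length ys ℕ.* r)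
  over [] _ _ = size-∅ λ ()
  over (y ∷ ys) (y∉ ∷ u) q =
    size-resp (λ { (inj₁ (p , eq)) → p , here eq ; (inj₂ (p , i)) → p , there i })
              (λ { (p , here eq) → inj₁ (p , eq) ; (p , there i) → inj₂ (p , i) })
              (size-⊎ (λ { (_ , refl) (_ , i) → All.lookup y∉ i refl }) (fib (q (here refl))) (over ys u (q ∘ there)))

-- The orbits of a free action are removed one at a time.
module FreeAction (_≟_ : DecidableEquality A) {K : B → Set} {k : ℕ} (hK : HasSize K k) (_∙_ : B → A → A) where

  -- The group laws are required only through their effect on `M`. So `K` may be a mere set of
  -- parameters, and the axioms survive when an orbit is removed from `M`.
  record IsFreeOn (M : A → Set) : Set where
    field
      closed  : ∀ {x a} → K x → M a → M (x ∙ a)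
      free    : ∀ {x y a} → K x → K y → M a → x ∙ a ≡ y ∙ a → x ≡ y
      unit    : ∃[ e ] (K e × (∀ {a} → M a → e ∙ a ≡ a))
      inverse : ∀ {x} → K x → ∃[ y ] (K y × (∀ {a} → M a → y ∙ (x ∙ a) ≡ a))
      compose : ∀ {x y} → K x → K y → ∃[ z ] (K z × (∀ {a} → M a → z ∙ a ≡ y ∙ (x ∙ a)))

  open IsFreeOn

  orbits-∣ : {M : A → Set} → IsFreeOn M → HasSize M n → k ∣ n
  orbits-∣ {n = n} = go n ℕP.≤-refl
    where
    -- The fuel bounds the size of the part still to be partitioned, which is not a structural part
    -- of `M`.
    go : ∀ fuel {n} {M : A → Set} → n ℕ.≤ fuel → IsFreeOn M → HasSize M n → k ∣ n
    go fuel {zero} _ _ _ = k ∣0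
    go (suc fuel) {suc n} {M} (ℕ.s≤s n≤) act hM with size-witness hM (ℕ.s≤s ℕ.z≤n)
    ... | a , Ma = remove (size-split (size-dec _≟_ orbit) hM)
      where
      Orbit : A → Set
      Orbit = Image K (_∙ a)
      orbit : HasSize Orbit k
      orbit = size-image-inj (_∙ a) (λ kx ky → free act kx ky Ma) hK
      outside : IsFreeOn (λ b → M b × ¬ Orbit b)
      -- If `x ∙ b` equalled `y ∙ a`, applying the inverse of `x` would place `b` in the orbit of
      -- `a`.
      outside .closed {x} {b} kx (Mb , ∉) = closed act kx Mb , λ (y , ky , eq) →
        let x′ , kx′ , inv = inverse act kx
            z , kz , comp = compose act ky kx′
        in ∉ (z , kz , trans (comp Ma) (trans (cong (x′ ∙_) eq) (inv Mb)))
      outside .free kx ky (Mb , _) = free act kx ky Mb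
      outside .unit = let e , ke , eq = unit act in e , ke , λ (Mb , _) → eq Mb
      outside .inverse kx = let y , ky , eq = inverse act kx in y , ky , λ (Mb , _) → eq Mb
      outside .compose kx ky = let z , kz , eq = compose act kx ky in z , kz , λ (Mb , _) → eq Mb
      remove : ∃[ i ] ∃[ b ] (HasSize (λ x → M x × Orbit x) i × HasSize (λ x → M x × ¬ Orbit x) b × i ℕ.+ b ≡ suc n) → k ∣ suc n
      remove (i , b , hi , hb , eq)
        with refl ← size-≡ (size-resp proj₂ (λ { o@(x , kx , refl) → closed act kx Ma , o }) hi) orbit =
        subst (k ∣_) eq (∣m∣n⇒∣m+n ∣-refl (go fuel b≤ outside hb))
        where
        0<k : 0 ℕ.< k
        0<k = size-pos hK (proj₁ (proj₂ (unit act)))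
        b≤ : b ℕ.≤ fuel
        b≤ = ℕP.≤-trans (ℕP.≤-pred (subst (b ℕ.<_) eq (ℕP.+-monoˡ-≤ b 0<k))) n≤

-- Finite fields

module FieldProperties (F : FiniteField) where
  open FiniteField F

  commutativeRing : CommutativeRing 0ℓ 0ℓ
  commutativeRing = record { isCommutativeRing = isCommutativeRing }

  open CommutativeRing commutativeRing public
    using (+-assoc; +-comm; +-identityˡ; +-identityʳ; -‿inverseˡ; -‿inverseʳ; *-assoc; *-comm;
           *-identityˡ; *-identityʳ; distribˡ; distribʳ; zeroˡ; zeroʳ; ring; semiring;
           commutativeSemiring; +-commutativeMonoid; *-commutativeMonoid; +-abelianGroup)
  open RingProperties ring public using (-‿distribˡ-*; -‿distribʳ-*; -0#≈0#; -‿involutive; -‿injective; +-cancelˡ; +-cancelʳ)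
  open AbelianGroupProperties +-abelianGroup public using () renaming (inverseˡ-unique to +-inverseˡ-unique; ⁻¹-∙-comm to -‿+-comm)

  module +-Solver = CommutativeMonoidSolver +-commutativeMonoid
  module *-Solver = CommutativeMonoidSolver *-commutativeMonoid

  1≢0 : 1# ≢ 0#
  1≢0 = 0≢1 ∘ sym

  inv : Carrier → Carrier
  inv x with x ≟ 0#
  ... | yes _ = 0#
  ... | no x≢0 = proj₁ (inverse x x≢0)

  *-invʳ : ∀ {x} → x ≢ 0# → x * inv x ≡ 1#
  *-invʳ {x} x≢0 with x ≟ 0#
  ... | yes x≡0 = contradiction x≡0 x≢0
  ... | no x≢0′ = proj₂ (inverse x x≢0′)

  *-cancelˡ : ∀ {x y z} → x ≢ 0# → x * y ≡ x * z → y ≡ z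
  *-cancelˡ {x} {y} {z} x≢0 eq = trans (sym (undo y)) (trans (cong (inv x *_) eq) (undo z))
    where
    undo : ∀ w → inv x * (x * w) ≡ w
    undo w = trans (sym (*-assoc _ _ _)) (trans (cong (_* w) (trans (*-comm _ _) (*-invʳ x≢0))) (*-identityˡ w))

  *-nonzero : ∀ {x y} → x ≢ 0# → y ≢ 0# → x * y ≢ 0#
  *-nonzero x≢0 y≢0 xy≡0 = y≢0 (*-cancelˡ x≢0 (trans xy≡0 (sym (zeroʳ _))))

  inv-nonzero : ∀ {x} → x ≢ 0# → inv x ≢ 0#
  inv-nonzero {x} x≢0 eq = 1≢0 (trans (sym (*-invʳ x≢0)) (trans (cong (x *_) eq) (zeroʳ x)))

  inv-involutive : ∀ {x} → x ≢ 0# → inv (inv x) ≡ x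
  inv-involutive {x} x≢0 = *-cancelˡ (inv-nonzero x≢0)
    (trans (*-invʳ (inv-nonzero x≢0)) (sym (trans (*-comm _ _) (*-invʳ x≢0))))

  x+y≡0⇒x≡-y : ∀ {x y} → x + y ≡ 0# → x ≡ - y
  x+y≡0⇒x≡-y = +-inverseˡ-unique _ _

  +-undoʳ : ∀ x y → (x + y) + - y ≡ x
  +-undoʳ x y = trans (+-assoc _ _ _) (trans (cong (x +_) (-‿inverseʳ y)) (+-identityʳ x))

  +-undoˡ : ∀ x y → (x + - y) + y ≡ x
  +-undoˡ x y = trans (+-assoc _ _ _) (trans (cong (x +_) (-‿inverseˡ y)) (+-identityʳ x))

  x+y≡x⇒y≡0 : ∀ {x y} → x + y ≡ x → y ≡ 0#
  x+y≡x⇒y≡0 {x} {y} eq = +-cancelˡ x y 0# (trans eq (sym (+-identityʳ x)))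

  interchange : ∀ a b c d → (a * b) * (c * d) ≡ (a * c) * (b * d)
  interchange = solve 4 (λ a b c d → (a ⊕ b) ⊕ (c ⊕ d) ⊜ (a ⊕ c) ⊕ (b ⊕ d)) refl
    where open *-Solver

  ^-homo-+ : ∀ x m n → x ^ (m ℕ.+ n) ≡ x ^ m * x ^ n
  ^-homo-+ x zero n = sym (*-identityˡ _)
  ^-homo-+ x (suc m) n = trans (cong (x *_) (^-homo-+ x m n)) (sym (*-assoc _ _ _))

  ^-distrib-* : ∀ x y n → (x * y) ^ n ≡ x ^ n * y ^ n
  ^-distrib-* x y zero = sym (*-identityˡ _)
  ^-distrib-* x y (suc n) = trans (cong (x * y *_) (^-distrib-* x y n)) (interchange x y (x ^ n) (y ^ n))

  1^n≡1 : ∀ n → 1# ^ n ≡ 1#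
  1^n≡1 zero = refl
  1^n≡1 (suc n) = trans (*-identityˡ _) (1^n≡1 n)

  ^-assoc : ∀ x m n → (x ^ m) ^ n ≡ x ^ (m ℕ.* n)
  ^-assoc x zero n = 1^n≡1 n
  ^-assoc x (suc m) n = trans (^-distrib-* x (x ^ m) n)
    (trans (cong (x ^ n *_) (^-assoc x m n)) (sym (^-homo-+ x n (m ℕ.* n))))

  ^-nonzero : ∀ {x} n → x ≢ 0# → x ^ n ≢ 0#
  ^-nonzero zero _ = 1≢0
  ^-nonzero (suc n) x≢0 = *-nonzero x≢0 (^-nonzero n x≢0)

  ^-reflects-0 : ∀ {x} n → x ^ n ≡ 0# → x ≡ 0#
  ^-reflects-0 {x} n eq with x ≟ 0#
  ... | yes x≡0 = x≡0
  ... | no x≢0 = contradiction eq (^-nonzero n x≢0)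

  Π : List Carrier → Carrier
  Π = foldr _*_ 1#

  Π-↭ : ∀ {xs ys} → xs ↭ ys → Π xs ≡ Π ys
  Π-↭ ↭refl = refl
  Π-↭ (↭prep x r) = cong (x *_) (Π-↭ r)
  Π-↭ (↭swap {ys = ys} x y r) = trans (cong (λ z → x * (y * z)) (Π-↭ r))
    (trans (sym (*-assoc _ _ _)) (trans (cong (_* Π ys) (*-comm x y)) (*-assoc _ _ _)))
  Π-↭ (↭trans r s) = trans (Π-↭ r) (Π-↭ s)

  Π-++ : ∀ xs ys → Π (xs ++ ys) ≡ Π xs * Π ys
  Π-++ [] ys = sym (*-identityˡ _)
  Π-++ (x ∷ xs) ys = trans (cong (x *_) (Π-++ xs ys)) (sym (*-assoc _ _ _))

  Π-nonzero : ∀ xs → (∀ {x} → x ∈ xs → x ≢ 0#) → Π xs ≢ 0#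
  Π-nonzero [] _ = 1≢0
  Π-nonzero (x ∷ xs) h = *-nonzero (h (here refl)) (Π-nonzero xs (h ∘ there))

  Π-map-* : ∀ x ys → Π (map (x *_) ys) ≡ x ^ length ys * Π ys
  Π-map-* x [] = sym (*-identityˡ _)
  Π-map-* x (y ∷ ys) = trans (cong (x * y *_) (Π-map-* x ys)) (interchange x y _ _)

  -- Multiplication by x permutes P.
  x^|P|≡1 : {P : Carrier → Set} → HasSize P n → (∀ {a} → P a → a ≢ 0#) →
            ∀ {x} → x ≢ 0# → (∀ {a} → P a → P (x * a)) → x ^ n ≡ 1#
  x^|P|≡1 {P = P} h@(xs , _ , refl , e) ≢0 {x} x≢0 closed =
    *-cancelˡ Π≢0 (trans (*-comm _ _) (trans (trans (sym (Π-map-* x xs)) (Π-↭ (size-↭ id id image h))) (sym (*-identityʳ _))))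
    where
    Π≢0 : Π xs ≢ 0#
    Π≢0 = Π-nonzero xs (≢0 ∘ to (e _))
    image : HasSize P (length xs)
    image = size-bij (x *_) closed (size-surj _≟_ (x *_) closed (λ _ _ → *-cancelˡ x≢0) h h)
                     (λ _ _ → *-cancelˡ x≢0) h

  index : Carrier → ℕ
  index x = Fin.toℕ (Inverse.to enum x)

  index-injective : ∀ {x y} → index x ≡ index y → x ≡ y
  index-injective {x} {y} eq = trans (sym (Inverse.strictlyInverseʳ enum x))
    (trans (cong (Inverse.from enum) (FinP.toℕ-injective eq)) (Inverse.strictlyInverseʳ enum y))

  -- From each pair {y, ι y} the member with the smaller index is selected.
  Π-involution : {P : Carrier → Set} (h : HasSize P n) (ι : Carrier → Carrier) → ∀ {x} →
                 (∀ {y} → P y → P (ι y)) → (∀ {y} → P y → ι (ι y) ≡ y) →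
                 (∀ {y} → P y → ι y ≢ y) → (∀ {y} → P y → y * ι y ≡ x) →
                 ∀ k → n ≡ k ℕ.+ k → Π (elements h) ≡ x ^ k
  Π-involution {P = P} h ι {x} closed invol fixfree product k n≡2k
    with size-filter (λ y → index y ℕ.<? index (ι y)) h
  ... | l , hS@(ys , _ , refl , e) =
    trans (Π-↭ (size-↭ id id h pairs)) (trans (Π-++ ys (map ι ys))
      (trans (Π-pairs ys (proj₁ ∘ to (e _))) (cong (x ^_) (double-injective (length ys) k (trans (sym (size-≡ h pairs)) n≡2k)))))
    where
    S : Carrier → Set
    S y = P y × index y ℕ.< index (ι y)
    ι-injective : InjectiveOn S ι
    ι-injective (p , _) (p′ , _) eq = trans (sym (invol p)) (trans (cong ι eq) (invol p′))
    join : ∀ {y} → S y ⊎ Image S ι y → P y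
    join (inj₁ (p , _)) = p
    join (inj₂ (z , (p , _) , refl)) = closed p
    split : ∀ {y} → P y → S y ⊎ Image S ι y
    split {y} p with ℕP.<-cmp (index y) (index (ι y))
    ... | tri< lt _ _ = inj₁ (p , lt)
    ... | tri≈ _ eq _ = contradiction (sym (index-injective eq)) (fixfree p)
    ... | tri> _ _ gt = inj₂ (ι y , (closed p , subst (λ z → index (ι y) ℕ.< index z) (sym (invol p)) gt) , invol p)
    disjoint : ∀ {y} → S y → Image S ι y → ⊥
    disjoint (_ , lt) (z , (p , lt′) , refl) = ℕP.<-asym lt (subst (λ w → index w ℕ.< index (ι z)) (sym (invol p)) lt′)
    pairs : HasSize P (length ys ℕ.+ length ys)
    pairs = size-resp join split (size-⊎ disjoint hS (size-image-inj ι ι-injective hS))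
    Π-pairs : ∀ zs → (∀ {z} → z ∈ zs → P z) → Π zs * Π (map ι zs) ≡ x ^ length zs
    Π-pairs [] _ = *-identityˡ _
    Π-pairs (z ∷ zs) all = trans (interchange z _ _ _) (cong₂ _*_ (product (all (here refl))) (Π-pairs zs (all ∘ there)))
    double-injective : ∀ a b → a ℕ.+ a ≡ b ℕ.+ b → a ≡ b
    double-injective a b eq = ℕP.*-cancelˡ-≡ a b 2 (trans (cong (a ℕ.+_) (ℕP.+-identityʳ a)) (trans eq (sym (cong (b ℕ.+_) (ℕP.+-identityʳ b)))))

  size-carrier : HasSize (λ (_ : Carrier) → ⊤) size
  size-carrier = map (Inverse.from enum) (allFin size) , map⁺ from-injective (allFin⁺ size) ,
    trans (length-map _ (allFin size)) (length-tabulate id) ,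
    λ a → mk⇔ _ (λ _ → subst (_∈ _) (Inverse.strictlyInverseʳ enum a) (∈-map⁺ (Inverse.from enum) (∈-allFin _)))
    where
    from-injective : ∀ {i k} → Inverse.from enum i ≡ Inverse.from enum k → i ≡ k
    from-injective {i} {k} eq = trans (sym (Inverse.strictlyInverseˡ enum i))
      (trans (cong (Inverse.to enum) eq) (Inverse.strictlyInverseˡ enum k))

  size-nonzero : ∀ {k} → size ≡ suc k → HasSize (_≢ 0#) k
  size-nonzero {k} eq with size-split (_≟ 0#) size-carrier
  ... | a , b , hz , hn , a+b≡n = subst (HasSize _) b≡k (size-resp proj₂ (tt ,_) hn)
    where
    b≡k : b ≡ k
    b≡k = ℕP.suc-injective (trans (cong (ℕ._+ b) (size-≡ (size-singleton 0#) (size-resp proj₂ (tt ,_) hz))) (trans a+b≡n eq))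

  open Mult semiring public using (×-homo-+; ×-homo-1; ×-assocˡ; ×-assoc-*) renaming (_×_ to _·ℕ_)

  -- Adding x permutes the field.
  size·x≡0 : ∀ x → size ·ℕ x ≡ 0#
  size·x≡0 x = +-cancelʳ (Σ′ xs) _ _ (trans (trans (cong (λ k → k ·ℕ x + Σ′ xs) (sym l)) (sym (Σ-map xs)))
                 (trans (Σ-↭ (size-↭ id id shifted size-carrier)) (sym (+-identityˡ _))))
    where
    xs : List Carrier
    xs = elements size-carrier
    l : length xs ≡ size
    l = proj₁ (proj₂ (proj₂ size-carrier))
    Σ′ : List Carrier → Carrier
    Σ′ = foldr _+_ 0#
    shifted : HasSize (λ (_ : Carrier) → ⊤) size
    shifted = size-bij (x +_) _ (λ {b} _ → - x + b , tt , trans (sym (+-assoc _ _ _)) (trans (cong (_+ b) (-‿inverseʳ x)) (+-identityˡ b)))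
                       (λ _ _ → +-cancelˡ x _ _) size-carrier
    Σ-map : ∀ ys → Σ′ (map (x +_) ys) ≡ length ys ·ℕ x + Σ′ ys
    Σ-map [] = sym (+-identityˡ _)
    Σ-map (y ∷ ys) = trans (cong (x + y +_) (Σ-map ys))
      (solve 4 (λ a b c d → (a ⊕ b) ⊕ (c ⊕ d) ⊜ (a ⊕ c) ⊕ (b ⊕ d)) refl x y (length ys ·ℕ x) (Σ′ ys))
      where open +-Solver
    Σ-↭ : ∀ {us vs} → us ↭ vs → Σ′ us ≡ Σ′ vs
    Σ-↭ ↭refl = refl
    Σ-↭ (↭prep u r) = cong (u +_) (Σ-↭ r)
    Σ-↭ (↭swap {ys = ys} u v r) = trans (cong (λ z → u + (v + z)) (Σ-↭ r))
      (trans (sym (+-assoc _ _ _)) (trans (cong (_+ Σ′ ys) (+-comm u v)) (+-assoc _ _ _)))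
    Σ-↭ (↭trans r s) = trans (Σ-↭ r) (Σ-↭ s)

-- Frobenius and the quadratic character

-- The half (q - 1)/2 is needed as an explicit number: it occurs in an exponent and as the number of
-- squares in a set.
odd-^ : ∀ {p} e → p % 2 ≡ 1 → ∃[ j ] p ℕ.^ e ≡ suc (j ℕ.+ j)
odd-^ zero _ = 0 , refl
odd-^ {p} (suc e) odd =
  let j , eq = odd-^ {p} e odd
  in p / 2 ℕ.+ j ℕ.+ 2 ℕ.* (p / 2) ℕ.* j , trans (cong₂ ℕ._*_ (trans (m≡m%n+[m/n]*n p 2) (cong (ℕ._+ p / 2 ℕ.* 2) odd)) eq) (product (p / 2) j)
  where
  product : ∀ i j → suc (i ℕ.* 2) ℕ.* suc (j ℕ.+ j) ≡ suc ((i ℕ.+ j ℕ.+ 2 ℕ.* i ℕ.* j) ℕ.+ (i ℕ.+ j ℕ.+ 2 ℕ.* i ℕ.* j))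
  product = solve-∀

prime∤! : ∀ {p} → Prime p → ∀ {k} → k ℕ.< p → ¬ p ∣ k !
prime∤! p-prime {zero} 0<p p∣1 with refl ← ∣1⇒≡1 p∣1 = ℕ.nonTrivial⇒≢1 {{prime⇒nonTrivial p-prime}} refl
prime∤! p-prime {suc k} k<p p∣k! with euclidsLemma (suc k) (k !) p-prime p∣k!
... | inj₁ p∣k = ℕP.<⇒≱ k<p (∣⇒≤ p∣k)
... | inj₂ p∣k!′ = prime∤! p-prime (ℕP.<-trans (ℕP.n<1+n k) k<p) p∣k!′

-- The prime divides p!, which is the coefficient times k! (p - k)!, and it divides neither of these
-- factorials.
prime∣choose : ∀ {p} → Prime p → ∀ {k} → 0 ℕ.< k → k ℕ.< p → p ∣ p choose k
prime∣choose {p@(suc p′)} p-prime {k} 0<k k<p with euclidsLemma (p choose k) (k ! ℕ.* (p ℕ.∸ k) !) p-prime p∣product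
  where
  instance _ = ℕP.m*n≢0 (k !) ((p ℕ.∸ k) !) {{ℕP._!≢0 k}} {{ℕP._!≢0 (p ℕ.∸ k)}}
  p∣product : p ∣ (p choose k) ℕ.* (k ! ℕ.* (p ℕ.∸ k) !)
  p∣product = subst (p ∣_) (sym (trans (cong (ℕ._* (k ! ℕ.* (p ℕ.∸ k) !)) (nCk≡n!/k![n-k]! (ℕP.<⇒≤ k<p))) (m/n*n≡m (k![n∸k]!∣n! (ℕP.<⇒≤ k<p))))) (m∣m*n (p′ !))
... | inj₁ p∣choose = p∣choose
... | inj₂ p∣! with euclidsLemma (k !) ((p ℕ.∸ k) !) p-prime p∣!
...   | inj₁ p∣k! = contradiction p∣k! (prime∤! p-prime k<p)
...   | inj₂ p∣[p-k]! = contradiction p∣[p-k]! (prime∤! p-prime (ℕP.∸-monoʳ-< 0<k (ℕP.<⇒≤ k<p)))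

module Frobenius (F : FiniteField) where
  open FiniteField F
  open FieldProperties F
  open Sum semiring using (sum; sum-cong-≗; sum-replicate-zero; sum-init-last)
  module ^′ = Exp semiring

  exp≡^ : ∀ x n → x ^′.^ n ≡ x ^ n
  exp≡^ x zero = refl
  exp≡^ x (suc n) = cong (x *_) (exp≡^ x n)

  sum-ends : ∀ {n} (t : Fin.Fin (suc (suc n)) → Carrier) →
             (∀ i → 0 ℕ.< Fin.toℕ i → Fin.toℕ i ℕ.< suc n → t i ≡ 0#) →
             sum t ≡ t Fin.zero + t (Fin.fromℕ (suc n))
  sum-ends {n} t middle = cong (t Fin.zero +_) (trans (sum-init-last (t ∘ Fin.suc))
    (trans (cong (_+ t (Fin.fromℕ (suc n))) (trans (sum-cong-≗ vanish) (sum-replicate-zero n))) (+-identityˡ _)))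
    where
    vanish : ∀ i → t (Fin.suc (Fin.inject₁ i)) ≡ 0#
    vanish i = middle _ (ℕ.s≤s ℕ.z≤n) (ℕ.s≤s (subst (ℕ._< n) (sym (FinP.toℕ-inject₁ i)) (FinP.toℕ<n i)))

  char-multiple : ∀ {p k} x → p ·ℕ 1# ≡ 0# → p ∣ k → k ·ℕ x ≡ 0#
  char-multiple {p} x p·1≡0 (divides c refl) =
    trans (sym (trans (×-assoc-* (c ℕ.* p) 1# x) (cong ((c ℕ.* p) ·ℕ_) (*-identityˡ x))))
      (trans (cong (_* x) (trans (sym (×-assocˡ 1# c p)) (trans (cong (c ·ℕ_) p·1≡0) (c·0≡0 c)))) (zeroˡ x))
    where
    c·0≡0 : ∀ c → c ·ℕ 0# ≡ 0#
    c·0≡0 zero = refl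
    c·0≡0 (suc c) = trans (+-identityˡ _) (c·0≡0 c)

  -- All inner terms of the binomial expansion vanish in characteristic p. Splitting off 0 and 1
  -- exhibits `p` as a double successor, so that the sum has two distinct end terms.
  ^p-distrib-+ : ∀ {p} → Prime p → p ·ℕ 1# ≡ 0# → ∀ x y → (x + y) ^ p ≡ x ^ p + y ^ p
  ^p-distrib-+ {zero} p-prime _ _ _ = ⊥-elim (ℕ.≢-nonZero⁻¹ 0 {{prime⇒nonZero p-prime}} refl)
  ^p-distrib-+ {suc zero} p-prime _ _ _ = ⊥-elim (ℕ.nonTrivial⇒≢1 {{prime⇒nonTrivial p-prime}} refl)
  ^p-distrib-+ {p@(suc (suc p″))} p-prime p·1≡0 x y =
    trans (sym (exp≡^ (x + y) p)) (trans (Binomial.theorem commutativeSemiring p x y)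
      (trans (sum-ends (binomialTerm p) (λ i 0<i i<p → char-multiple _ p·1≡0 (prime∣choose p-prime 0<i i<p)))
        (trans (+-comm _ _) (cong₂ _+_ top bottom))))
    where
    open Binomial commutativeSemiring using () renaming (binomialTerm to term)
    binomialTerm = term x y
    bottom : binomialTerm p Fin.zero ≡ y ^ p
    bottom = trans (+-identityʳ _) (trans (*-identityˡ _) (exp≡^ y p))
    last-term : ∀ n → (n choose n) ·ℕ (x ^′.^ n * y ^′.^ (n ℕ.∸ n)) ≡ x ^ n
    last-term n = trans (cong₂ (λ c d → c ·ℕ (x ^′.^ n * y ^′.^ d)) (nCn≡1 n) (ℕP.n∸n≡0 n))
      (trans (+-identityʳ _) (trans (*-identityʳ _) (exp≡^ x n)))
    top : binomialTerm p (Fin.fromℕ p) ≡ x ^ p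
    top = trans (cong (λ k → (p choose k) ·ℕ (x ^′.^ k * y ^′.^ (p ℕ.∸ k))) (FinP.toℕ-fromℕ p)) (last-term p)

module SquareOrderField (p e : ℕ) (p-prime : Prime p) (p-odd : p % 2 ≡ 1) (1≤e : 1 ℕ.≤ e)
                        (F : FiniteField) (|F|≡q² : FiniteField.size F ≡ (p ℕ.^ e) ℕ.* (p ℕ.^ e)) where
  open FiniteField F
  open FieldProperties F
  open Frobenius F

  q : ℕ
  q = p ℕ.^ e

  j : ℕ
  j = proj₁ (odd-^ {p} e p-odd)

  q≡1+2j : q ≡ suc (j ℕ.+ j)
  q≡1+2j = proj₂ (odd-^ {p} e p-odd)

  -- This is (q² - 1)/2, the exponent of Euler's criterion in the field of order q². It is kept in
  -- the factored form (q + 1)(q - 1)/2, which `stabiliser-square` relies on.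
  h : ℕ
  h = suc q ℕ.* j

  q²≡1+2h : q ℕ.* q ≡ suc (h ℕ.+ h)
  q²≡1+2h = subst (λ k → k ℕ.* k ≡ suc (suc k ℕ.* j ℕ.+ suc k ℕ.* j)) (sym q≡1+2j) (square j)
    where
    square : ∀ j → suc (j ℕ.+ j) ℕ.* suc (j ℕ.+ j) ≡ suc (suc (suc (j ℕ.+ j)) ℕ.* j ℕ.+ suc (suc (j ℕ.+ j)) ℕ.* j)
    square = solve-∀

  1<q : 1 ℕ.< q
  1<q = ℕP.≤-trans (ℕP.≤-reflexive (sym (ℕP.^-identityʳ 2)))
    (ℕP.≤-trans (ℕP.^-monoˡ-≤ 1 (ℕ.nonTrivial⇒n>1 p {{prime⇒nonTrivial p-prime}})) (ℕP.^-monoʳ-≤ p {{prime⇒nonZero p-prime}} 1≤e))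

  instance
    q-nonZero : ℕ.NonZero q
    q-nonZero = ℕ.>-nonZero (ℕP.<-trans (ℕ.s≤s ℕ.z≤n) 1<q)

  size-F* : HasSize (_≢ 0#) (h ℕ.+ h)
  size-F* = size-nonzero (trans |F|≡q² q²≡1+2h)

  x^2h≡1 : ∀ {x} → x ≢ 0# → x ^ (h ℕ.+ h) ≡ 1#
  x^2h≡1 x≢0 = x^|P|≡1 size-F* id x≢0 (*-nonzero x≢0)

  ·ℕ1-* : ∀ m n → (m ℕ.* n) ·ℕ 1# ≡ (m ·ℕ 1#) * (n ·ℕ 1#)
  ·ℕ1-* m n = trans (sym (×-assocˡ 1# m n)) (sym (trans (×-assoc-* m 1# (n ·ℕ 1#)) (cong (m ·ℕ_) (*-identityˡ _))))

  ·ℕ1-^ : ∀ m n → (m ℕ.^ n) ·ℕ 1# ≡ (m ·ℕ 1#) ^ n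
  ·ℕ1-^ m zero = ×-homo-1 1#
  ·ℕ1-^ m (suc n) = trans (·ℕ1-* m (m ℕ.^ n)) (cong (m ·ℕ 1# *_) (·ℕ1-^ m n))

  -- The order q² of the additive group annihilates 1, and q² · 1 is the square of q · 1; a field
  -- has no nilpotents. The same argument descends from q = p^e to p.
  q·1≡0 : q ·ℕ 1# ≡ 0#
  q·1≡0 = ^-reflects-0 2 (trans (cong (q ·ℕ 1# *_) (*-identityʳ _))
    (trans (sym (·ℕ1-* q q)) (trans (cong (_·ℕ 1#) (sym |F|≡q²)) (size·x≡0 1#))))

  p·1≡0 : p ·ℕ 1# ≡ 0#
  p·1≡0 = ^-reflects-0 e (trans (sym (·ℕ1-^ p e)) q·1≡0)

  -- If 1 + 1 were 0, the odd multiple q · 1 would be 1, but it is 0.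
  1≢-1 : 1# ≢ - 1#
  1≢-1 1≡-1 = 1≢0 (trans (sym (trans (cong (1# +_) (doubles j)) (+-identityʳ 1#))) (trans (cong (_·ℕ 1#) (sym q≡1+2j)) q·1≡0))
    where
    doubles : ∀ k → (k ℕ.+ k) ·ℕ 1# ≡ 0#
    doubles k = trans (×-homo-+ 1# k k) (trans (sym (*-distribute k)) (trans (cong (k ·ℕ 1# *_) (trans (cong (1# +_) 1≡-1) (-‿inverseʳ 1#))) (zeroʳ _)))
      where
      *-distribute : ∀ k → k ·ℕ 1# * (1# + 1#) ≡ k ·ℕ 1# + k ·ℕ 1#
      *-distribute k = trans (distribˡ _ _ _) (cong₂ _+_ (*-identityʳ _) (*-identityʳ _))

  y*y≡1⇒ : ∀ {y} → y * y ≡ 1# → y ≡ 1# ⊎ y ≡ - 1#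
  y*y≡1⇒ {y} yy≡1 with (y + 1#) ≟ 0#
  ... | yes eq = inj₂ (x+y≡0⇒x≡-y eq)
  ... | no ≢0 = inj₁ (trans (x+y≡0⇒x≡-y (*-cancelˡ ≢0 (trans factor (sym (zeroʳ _))))) (-‿involutive 1#))
    where
    factor : (y + 1#) * (y + - 1#) ≡ 0#
    factor = trans (distribʳ _ _ _) (trans (cong₂ _+_
      (trans (distribˡ _ _ _) (cong₂ _+_ yy≡1 (trans (sym (-‿distribʳ-* y 1#)) (cong -_ (*-identityʳ y)))))
      (trans (*-identityˡ _) refl))
      (trans (solve 4 (λ a b c d → (a ⊕ b) ⊕ (c ⊕ d) ⊜ (a ⊕ d) ⊕ (b ⊕ c)) refl 1# (- y) y (- 1#))
             (trans (cong₂ _+_ (-‿inverseʳ 1#) (-‿inverseˡ y)) (+-identityˡ 0#))))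
      where open +-Solver

  1≤h : 1 ℕ.≤ h
  1≤h = ℕP.*-mono-≤ {1} {suc q} {1} {j} (ℕ.s≤s ℕ.z≤n) 1≤j
    where
    1≤j : 1 ℕ.≤ j
    1≤j with j | q≡1+2j
    ... | zero | q≡1 = contradiction q≡1 (ℕP.>⇒≢ 1<q)
    ... | suc _ | _ = ℕ.s≤s ℕ.z≤n

  -1≢0 : - 1# ≢ 0#
  -1≢0 eq = 1≢0 (trans (sym (-‿involutive 1#)) (trans (cong -_ eq) -0#≈0#))

  inv-unique : ∀ {x y} → x * y ≡ 1# → y ≡ inv x
  inv-unique {x} {y} xy≡1 = *-cancelˡ x≢0 (trans xy≡1 (sym (*-invʳ x≢0)))
    where
    x≢0 : x ≢ 0#
    x≢0 refl = 1≢0 (trans (sym xy≡1) (zeroˡ y))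

  -- Pairing y with its inverse leaves only 1 and -1 unpaired.
  wilson : Π (elements size-F*) ≡ - 1#
  wilson = trans (Π-↭ (size-↭ id id size-F* decomposition))
    (trans (*-identityˡ _) (trans (cong (- 1# *_) (trans (Π-involution rest inv closed (inv-involutive ∘ proj₁) fixfree (*-invʳ ∘ proj₁)
      (ℕ.pred h) (count h 1≤h (size-≡ decomposition size-F*))) (1^n≡1 (ℕ.pred h)))) (*-identityʳ _)))
    where
    Rest : Carrier → Set
    Rest y = y ≢ 0# × (y ≢ 1# × y ≢ - 1#)
    r : ℕ
    r = proj₁ (size-filter (λ y → ¬? (y ≟ 1#) ×-dec ¬? (y ≟ (- 1#))) size-F*)
    rest : HasSize Rest r
    rest = proj₂ (size-filter (λ y → ¬? (y ≟ 1#) ×-dec ¬? (y ≟ (- 1#))) size-F*)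
    all : ∀ {y} → y ≡ 1# ⊎ (y ≡ - 1# ⊎ Rest y) → y ≢ 0#
    all (inj₁ refl) = 1≢0
    all (inj₂ (inj₁ refl)) = -1≢0
    all (inj₂ (inj₂ (y≢0 , _))) = y≢0
    cases : ∀ {y} → y ≢ 0# → y ≡ 1# ⊎ (y ≡ - 1# ⊎ Rest y)
    cases {y} y≢0 with y ≟ 1# | y ≟ (- 1#)
    ... | yes eq | _ = inj₁ eq
    ... | no _ | yes eq = inj₂ (inj₁ eq)
    ... | no ≢1 | no ≢-1 = inj₂ (inj₂ (y≢0 , ≢1 , ≢-1))
    decomposition : HasSize (_≢ 0#) (1 ℕ.+ (1 ℕ.+ r))
    decomposition = size-resp all cases
      (size-⊎ (λ { refl (inj₁ eq) → 1≢-1 eq ; refl (inj₂ (_ , ≢1 , _)) → ≢1 refl }) (size-singleton 1#)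
        (size-⊎ (λ { refl (_ , _ , ≢-1) → ≢-1 refl }) (size-singleton (- 1#)) rest))
    closed : ∀ {y} → Rest y → Rest (inv y)
    closed {y} (y≢0 , ≢1 , ≢-1) = inv-nonzero y≢0 ,
      (λ eq → ≢1 (trans (sym (*-identityʳ y)) (trans (cong (y *_) (sym eq)) (*-invʳ y≢0)))) ,
      (λ eq → ≢-1 (trans (sym (inv-involutive y≢0)) (trans (cong inv eq) (sym (inv-unique -1*-1≡1)))))
      where
      -1*-1≡1 : - 1# * - 1# ≡ 1#
      -1*-1≡1 = trans (sym (-‿distribˡ-* _ _)) (trans (cong -_ (*-identityˡ _)) (-‿involutive 1#))
    fixfree : ∀ {y} → Rest y → inv y ≢ y
    fixfree {y} (y≢0 , ≢1 , ≢-1) eq with y*y≡1⇒ (trans (cong (y *_) (sym eq)) (*-invʳ y≢0))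
    ... | inj₁ y≡1 = ≢1 y≡1
    ... | inj₂ y≡-1 = ≢-1 y≡-1
    count : ∀ h → 1 ℕ.≤ h → 2 ℕ.+ r ≡ h ℕ.+ h → r ≡ ℕ.pred h ℕ.+ ℕ.pred h
    count (suc h) _ eq = ℕP.suc-injective (ℕP.suc-injective (trans eq (cong suc (ℕP.+-suc h h))))

  -- Pairing y with x/y leaves no fixed point, so x^h is the product in Wilson's theorem.
  nonsquare^h : ∀ {x} → ¬ IsSquare x → x ^ h ≡ - 1#
  nonsquare^h {x} ¬sq = trans (sym (Π-involution size-F* (λ y → x * inv y) (λ y≢0 → *-nonzero x≢0 (inv-nonzero y≢0))
    involutive fixfree (λ {y} y≢0 → x*y/y y≢0) h refl)) wilson
    where
    x≢0 : x ≢ 0#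
    x≢0 refl = ¬sq (0# , zeroˡ 0#)
    x*y/y : ∀ {y} → y ≢ 0# → y * (x * inv y) ≡ x
    x*y/y {y} y≢0 = trans (solve 3 (λ a b c → a ⊕ (b ⊕ c) ⊜ b ⊕ (a ⊕ c)) refl y x (inv y))
      (trans (cong (x *_) (*-invʳ y≢0)) (*-identityʳ x))
      where open *-Solver
    involutive : ∀ {y} → y ≢ 0# → x * inv (x * inv y) ≡ y
    involutive {y} y≢0 = *-cancelˡ (*-nonzero x≢0 (inv-nonzero y≢0))
      (trans (x*y/y (*-nonzero x≢0 (inv-nonzero y≢0))) (sym (trans (*-comm _ _) (x*y/y y≢0))))
    fixfree : ∀ {y} → y ≢ 0# → x * inv y ≢ y
    fixfree {y} y≢0 eq = ¬sq (y , trans (cong (y *_) (sym eq)) (x*y/y y≢0))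

  x^h≡1⇒square : ∀ {x} → x ^ h ≡ 1# → IsSquare x
  x^h≡1⇒square {x} eq with square? x
  ... | yes sq = sq
  ... | no ¬sq = contradiction (trans (sym eq) (nonsquare^h ¬sq)) 1≢-1

  nonsquare*nonsquare : ∀ {x y} → ¬ IsSquare x → ¬ IsSquare y → IsSquare (x * y)
  nonsquare*nonsquare {x} {y} ¬x ¬y = x^h≡1⇒square
    (trans (^-distrib-* x y h) (trans (cong₂ _*_ (nonsquare^h ¬x) (nonsquare^h ¬y))
      (trans (sym (-‿distribˡ-* _ _)) (trans (cong -_ (*-identityˡ _)) (-‿involutive 1#)))))

  square*square : ∀ {x y} → IsSquare x → IsSquare y → IsSquare (x * y)
  square*square (a , refl) (b , refl) = a * b , interchange a b a b

  -- With x = a² and x y = b² the root of y is b/a. Together with the products of squares and of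
  -- nonsquares this makes squareness a character, as the associativity of the nearfield requires.
  square*⇒square : ∀ {x y} → x ≢ 0# → IsSquare x → IsSquare (x * y) → IsSquare y
  square*⇒square {x} {y} x≢0 (a , refl) (b , bb≡xy) = b * inv a ,
    *-cancelˡ x≢0 (trans (solve 3 (λ a b c → (a ⊕ a) ⊕ ((b ⊕ c) ⊕ (b ⊕ c)) ⊜ (b ⊕ b) ⊕ ((a ⊕ c) ⊕ (a ⊕ c))) refl a b (inv a))
      (trans (cong₂ _*_ bb≡xy (trans (cong₂ _*_ (*-invʳ a≢0) (*-invʳ a≢0)) (*-identityʳ 1#))) (*-identityʳ _)))
    where
    open *-Solver
    a≢0 : a ≢ 0#
    a≢0 refl = x≢0 (zeroˡ 0#)

  x^q²≡x : ∀ x → (x ^ q) ^ q ≡ x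
  x^q²≡x x with x ≟ 0#
  ... | yes refl = trans (cong (_^ q) (0^ q 1<q)) (0^ q 1<q)
    where
    0^ : ∀ n → 1 ℕ.< n → 0# ^ n ≡ 0#
    0^ (suc n) _ = zeroˡ _
  ... | no x≢0 = trans (^-assoc x q q) (trans (cong (x ^_) q²≡1+2h) (trans (cong (x *_) (x^2h≡1 x≢0)) (*-identityʳ x)))

  ^q-distrib-+ : ∀ x y → (x + y) ^ q ≡ x ^ q + y ^ q
  ^q-distrib-+ = go e
    where
    go : ∀ e x y → (x + y) ^ (p ℕ.^ e) ≡ x ^ (p ℕ.^ e) + y ^ (p ℕ.^ e)
    go zero x y = trans (*-identityʳ _) (cong₂ _+_ (sym (*-identityʳ x)) (sym (*-identityʳ y)))
    go (suc e) x y = trans (sym (^-assoc _ p (p ℕ.^ e))) (trans (cong (_^ (p ℕ.^ e)) (^p-distrib-+ p-prime p·1≡0 x y))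
      (trans (go e _ _) (cong₂ _+_ (^-assoc x p (p ℕ.^ e)) (^-assoc y p (p ℕ.^ e)))))

  0^q≡0 : 0# ^ q ≡ 0#
  0^q≡0 = x+y≡x⇒y≡0 (trans (sym (^q-distrib-+ 0# 0#)) (cong (_^ q) (+-identityˡ 0#)))

  ^q-square : ∀ {x} → IsSquare x → IsSquare (x ^ q)
  ^q-square (a , refl) = a ^ q , sym (^-distrib-* a a q)

  ^q-square⁻ : ∀ {x} → IsSquare (x ^ q) → IsSquare x
  ^q-square⁻ {x} sq = subst IsSquare (x^q²≡x x) (^q-square sq)

-- Here `N` and `m` count the affine points of U and those at infinity, and `a` and `b` the affine
-- tangents and secants through a point at infinity, with `k` and `k + q` affine points each.
-- Substituting a + b = q² in the total and cancelling q leaves k q + ε + b = a + b.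
tangent-arithmetic : ∀ q → 0 ℕ.< q → ∀ {N m ε k a b} → N ℕ.+ m ≡ q ℕ.^ 3 ℕ.+ 1 → m ≡ 1 ℕ.+ q ℕ.* ε →
                     N ≡ a ℕ.* k ℕ.+ b ℕ.* (k ℕ.+ q) → a ℕ.+ b ≡ q ℕ.* q → a ≡ k ℕ.* q ℕ.+ ε
tangent-arithmetic q 0<q {N} {m} {ε} {k} {a} {b} total m≡ N≡ a+b≡ =
  sym (ℕP.+-cancelʳ-≡ b (k ℕ.* q ℕ.+ ε) a (ℕP.*-cancelˡ-≡ _ _ q {{ℕ.>-nonZero 0<q}} (ℕP.+-cancelʳ-≡ 1 _ _ scaled)))
  where
  expand : ∀ q k b ε a → q ℕ.* (k ℕ.* q ℕ.+ ε ℕ.+ b) ℕ.+ 1 ≡ (q ℕ.* q) ℕ.* k ℕ.+ b ℕ.* q ℕ.+ (1 ℕ.+ q ℕ.* ε)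
  expand = solve-∀
  regroup : ∀ q k b ε a → (a ℕ.+ b) ℕ.* k ℕ.+ b ℕ.* q ℕ.+ (1 ℕ.+ q ℕ.* ε) ≡ a ℕ.* k ℕ.+ b ℕ.* (k ℕ.+ q) ℕ.+ (1 ℕ.+ q ℕ.* ε)
  regroup = solve-∀
  cube : ∀ q → q ℕ.* (q ℕ.* (q ℕ.* 1)) ℕ.+ 1 ≡ q ℕ.* (q ℕ.* q) ℕ.+ 1
  cube = solve-∀
  scaled : q ℕ.* (k ℕ.* q ℕ.+ ε ℕ.+ b) ℕ.+ 1 ≡ q ℕ.* (a ℕ.+ b) ℕ.+ 1
  scaled = trans (expand q k b ε a) (trans (cong (λ z → z ℕ.* k ℕ.+ b ℕ.* q ℕ.+ (1 ℕ.+ q ℕ.* ε)) (sym a+b≡))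
    (trans (regroup q k b ε a) (trans (cong₂ ℕ._+_ (sym N≡) (sym m≡)) (trans total (trans (cube q) (cong (λ z → q ℕ.* z ℕ.+ 1) (sym a+b≡)))))))

-- Factors p are taken out of `t` one at a time: each time p divides the product but not `k`, hence
-- it divides the rest of `t`.
^∣*⇒^∣ : ∀ {p} → Prime p → ∀ e {k t} → ¬ p ∣ k → p ℕ.^ e ∣ k ℕ.* t → p ℕ.^ e ∣ t
^∣*⇒^∣ p-prime zero _ _ = 1∣ _
^∣*⇒^∣ {p} p-prime (suc e) {k} {t} p∤k pp^e∣kt with euclidsLemma k t p-prime (∣-trans (m∣m*n (p ℕ.^ e)) pp^e∣kt)
... | inj₁ p∣k = contradiction p∣k p∤k
... | inj₂ (divides t′ refl) = subst (p ℕ.* p ℕ.^ e ∣_) (ℕP.*-comm p t′)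
  (*-monoʳ-∣ p (^∣*⇒^∣ p-prime e p∤k (*-cancelˡ-∣ p {{prime⇒nonZero p-prime}} (subst (p ℕ.* p ℕ.^ e ∣_) (rearrange k t′ p) pp^e∣kt))))
  where
  rearrange : ∀ k t p → k ℕ.* (t ℕ.* p) ≡ p ℕ.* (k ℕ.* t)
  rearrange = solve-∀

odd-prime∤2 : ∀ {p} → Prime p → p % 2 ≡ 1 → ¬ p ∣ 2
odd-prime∤2 {p} p-prime odd p∣2 with ℕP.≤-antisym (∣⇒≤ p∣2) (ℕ.nonTrivial⇒n>1 p {{prime⇒nonTrivial p-prime}})
odd-prime∤2 p-prime () p∣2 | refl

module NearfieldPlane (p e : ℕ) (p-prime : Prime p) (p-odd : p % 2 ≡ 1) (1≤e : 1 ℕ.≤ e)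
                      (F : FiniteField) (|F|≡q² : FiniteField.size F ≡ (p ℕ.^ e) ℕ.* (p ℕ.^ e)) where
  open FieldProperties F public
  open SquareOrderField p e p-prime p-odd 1≤e F |F|≡q² public
  open NP F q public

  -- The nearfield and its plane

  -- Zero is a square and `x * 0#` is zero, so the three clauses of `_⋆_` reduce to two,
  -- distinguished by the squareness of the right factor alone.
  ⋆-□ : ∀ x {y} → IsSquare y → x ⋆ y ≡ x * y
  ⋆-□ x {y} sq with y ≟ 0#
  ... | yes refl = sym (zeroʳ x)
  ... | no _ with square? y
  ...   | yes _ = refl
  ...   | no ¬sq = contradiction sq ¬sq

  ⋆-■ : ∀ x {y} → ¬ IsSquare y → x ⋆ y ≡ x ^ q * y
  ⋆-■ x {y} ¬sq with y ≟ 0#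
  ... | yes refl = sym (zeroʳ _)
  ... | no _ with square? y
  ...   | yes sq = contradiction sq ¬sq
  ...   | no _ = refl

  0-square : IsSquare 0#
  0-square = 0# , zeroˡ 0#

  1-square : IsSquare 1#
  1-square = 1# , *-identityˡ 1#

  ⋆-zeroʳ : ∀ x → x ⋆ 0# ≡ 0#
  ⋆-zeroʳ x = trans (⋆-□ x 0-square) (zeroʳ x)

  ⋆-identityʳ : ∀ x → x ⋆ 1# ≡ x
  ⋆-identityʳ x = trans (⋆-□ x 1-square) (*-identityʳ x)

  ⋆-identityˡ : ∀ y → 1# ⋆ y ≡ y
  ⋆-identityˡ y with square? y
  ... | yes sq = trans (⋆-□ 1# sq) (*-identityˡ y)
  ... | no ¬sq = trans (⋆-■ 1# ¬sq) (trans (cong (_* y) (1^n≡1 q)) (*-identityˡ y))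

  ⋆-distribʳ : ∀ z x y → (x + y) ⋆ z ≡ x ⋆ z + y ⋆ z
  ⋆-distribʳ z x y with square? z
  ... | yes sq = trans (⋆-□ _ sq) (trans (distribʳ z x y) (sym (cong₂ _+_ (⋆-□ x sq) (⋆-□ y sq))))
  ... | no ¬sq = trans (⋆-■ _ ¬sq) (trans (cong (_* z) (^q-distrib-+ x y))
                   (trans (distribʳ z _ _) (sym (cong₂ _+_ (⋆-■ x ¬sq) (⋆-■ y ¬sq)))))

  ⋆-zeroˡ : ∀ y → 0# ⋆ y ≡ 0#
  ⋆-zeroˡ y = x+y≡x⇒y≡0 (trans (sym (⋆-distribʳ y 0# 0#)) (cong (_⋆ y) (+-identityˡ 0#)))

  -‿⋆ : ∀ x y → (- x) ⋆ y ≡ - (x ⋆ y)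
  -‿⋆ x y = x+y≡0⇒x≡-y (trans (sym (⋆-distribʳ y (- x) x)) (trans (cong (_⋆ y) (-‿inverseˡ x)) (⋆-zeroˡ y)))

  -- For nonzero factors `y ⋆ z` is a square exactly when both or neither of `y` and `z` are, since
  -- the q-th power preserves squareness. So both sides apply the q-th power to `x` equally often
  -- modulo 2, and its second iterate is the identity.
  ⋆-assoc : ∀ x y z → (x ⋆ y) ⋆ z ≡ x ⋆ (y ⋆ z)
  ⋆-assoc x y z = go (y ≟ 0#) (z ≟ 0#) (square? y) (square? z)
    where
    go : Dec (y ≡ 0#) → Dec (z ≡ 0#) → Dec (IsSquare y) → Dec (IsSquare z) → (x ⋆ y) ⋆ z ≡ x ⋆ (y ⋆ z)
    go (yes refl) _ _ _ = trans (cong (_⋆ z) (⋆-zeroʳ x)) (trans (⋆-zeroˡ z) (sym (trans (cong (x ⋆_) (⋆-zeroˡ z)) (⋆-zeroʳ x))))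
    go _ (yes refl) _ _ = trans (⋆-zeroʳ _) (sym (trans (cong (x ⋆_) (⋆-zeroʳ y)) (⋆-zeroʳ x)))
    go (no y≢0) (no z≢0) (yes sy) (yes sz) = trans (⋆-□ _ sz) (trans (cong (_* z) (⋆-□ x sy)) (trans (*-assoc x y z)
              (sym (trans (cong (x ⋆_) (⋆-□ y sz)) (⋆-□ x (square*square sy sz))))))
    go (no y≢0) (no z≢0) (yes sy) (no ¬sz) = trans (⋆-■ _ ¬sz) (trans (cong (λ w → w ^ q * z) (⋆-□ x sy))
              (trans (cong (_* z) (^-distrib-* x y q)) (trans (*-assoc _ _ z)
              (sym (trans (cong (x ⋆_) (⋆-■ y ¬sz)) (⋆-■ x (¬sz ∘ square*⇒square (^-nonzero q y≢0) (^q-square sy))))))))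
    go (no y≢0) (no z≢0) (no ¬sy) (yes sz) = trans (⋆-□ _ sz) (trans (cong (_* z) (⋆-■ x ¬sy)) (trans (*-assoc _ y z)
              (sym (trans (cong (x ⋆_) (⋆-□ y sz)) (⋆-■ x (¬sy ∘ square*⇒square z≢0 sz ∘ subst IsSquare (*-comm y z)))))))
    go (no y≢0) (no z≢0) (no ¬sy) (no ¬sz) = trans (⋆-■ _ ¬sz) (trans (cong (λ w → w ^ q * z) (⋆-■ x ¬sy))
              (trans (cong (_* z) (trans (^-distrib-* (x ^ q) y q) (cong (_* y ^ q) (x^q²≡x x)))) (trans (*-assoc x _ z)
              (sym (trans (cong (x ⋆_) (⋆-■ y ¬sz)) (⋆-□ x (nonsquare*nonsquare (¬sy ∘ ^q-square⁻) ¬sz)))))))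

  abstract
    -- The inverse of a nonsquare y must itself be a nonsquare z, so y ⋆ z = y^q z = 1 determines
    -- it.
    ninv : Carrier → Carrier
    ninv y with square? y
    ... | yes _ = inv y
    ... | no _ = inv (y ^ q)

    ⋆-ninvʳ : ∀ {y} → y ≢ 0# → y ⋆ ninv y ≡ 1#
    ⋆-ninvʳ {y} y≢0 with square? y
    ... | yes sq = trans (⋆-□ y (square*⇒square y≢0 sq (subst IsSquare (sym (*-invʳ y≢0)) 1-square))) (*-invʳ y≢0)
    ... | no ¬sq = trans (⋆-■ y nsq) (*-invʳ y^q≢0)
      where
      y^q≢0 : y ^ q ≢ 0#
      y^q≢0 = ^-nonzero q y≢0
      nsq : ¬ IsSquare (inv (y ^ q))
      nsq sq = ¬sq (^q-square⁻ (square*⇒square (inv-nonzero y^q≢0) sq (subst IsSquare (sym (trans (*-comm _ _) (*-invʳ y^q≢0))) 1-square)))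

  ninv-nonzero : ∀ {y} → y ≢ 0# → ninv y ≢ 0#
  ninv-nonzero {y} y≢0 eq = 1≢0 (trans (sym (⋆-ninvʳ y≢0)) (trans (cong (y ⋆_) eq) (⋆-zeroʳ y)))

  ⋆-ninvˡ : ∀ {y} → y ≢ 0# → ninv y ⋆ y ≡ 1#
  ⋆-ninvˡ {y} y≢0 = trans (sym (⋆-identityʳ _)) (trans (cong (z ⋆ y ⋆_) (sym (⋆-ninvʳ z≢0)))
    (trans (⋆-assoc z y (z ⋆ ninv z)) (trans (cong (z ⋆_) (trans (sym (⋆-assoc y z (ninv z)))
      (trans (cong (_⋆ ninv z) (⋆-ninvʳ y≢0)) (⋆-identityˡ _)))) (⋆-ninvʳ z≢0))))
    where
    z = ninv y
    z≢0 = ninv-nonzero y≢0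

  ⋆-ninv-cancelʳ : ∀ x {y} → y ≢ 0# → x ⋆ y ⋆ ninv y ≡ x
  ⋆-ninv-cancelʳ x y≢0 = trans (⋆-assoc _ _ _) (trans (cong (x ⋆_) (⋆-ninvʳ y≢0)) (⋆-identityʳ x))

  ninv-⋆-cancelʳ : ∀ x {y} → y ≢ 0# → x ⋆ ninv y ⋆ y ≡ x
  ninv-⋆-cancelʳ x y≢0 = trans (⋆-assoc _ _ _) (trans (cong (x ⋆_) (⋆-ninvˡ y≢0)) (⋆-identityʳ x))

  ⋆-cancelˡ : ∀ {x y z} → x ≢ 0# → x ⋆ y ≡ x ⋆ z → y ≡ z
  ⋆-cancelˡ {x} {y} {z} x≢0 eq = trans (sym (undo y)) (trans (cong (ninv x ⋆_) eq) (undo z))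
    where
    undo : ∀ w → ninv x ⋆ (x ⋆ w) ≡ w
    undo w = trans (sym (⋆-assoc _ _ _)) (trans (cong (_⋆ w) (⋆-ninvˡ x≢0)) (⋆-identityˡ w))

  ⋆-cancelʳ : ∀ {x y z} → z ≢ 0# → x ⋆ z ≡ y ⋆ z → x ≡ y
  ⋆-cancelʳ {x} {y} {z} z≢0 eq = trans (sym (⋆-ninv-cancelʳ x z≢0)) (trans (cong (_⋆ ninv z) eq) (⋆-ninv-cancelʳ y z≢0))

  ⋆-nonzero : ∀ {x y} → x ≢ 0# → y ≢ 0# → x ⋆ y ≢ 0#
  ⋆-nonzero {x} x≢0 y≢0 eq = y≢0 (⋆-cancelˡ x≢0 (trans eq (sym (⋆-zeroʳ x))))

  ninv-involutive : ∀ {y} → y ≢ 0# → ninv (ninv y) ≡ y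
  ninv-involutive y≢0 = ⋆-cancelˡ (ninv-nonzero y≢0) (trans (⋆-ninvʳ (ninv-nonzero y≢0)) (sym (⋆-ninvˡ y≢0)))

  -- The incidence form evaluated for each kind of point and line. The impossible and the automatic
  -- incidences become `⊥` and `⊤`, so that case analysis on points and lines discards them.
  Inc : Point → Line → Set
  Inc (aff x y) (sl s t) = x ⋆ s + y + t ≡ 0#
  Inc (aff x y) (vert t) = x + t ≡ 0#
  Inc (aff x y) linf     = ⊥
  Inc (infSl m) (sl s t) = s + m ≡ 0#
  Inc (infSl m) (vert t) = ⊥
  Inc (infSl m) linf     = ⊤
  Inc infV      (sl s t) = ⊥
  Inc infV      (vert t) = ⊤
  Inc infV      linf     = ⊤

  form : Point → Line → Carrier
  form P L = let x = Triple.c₁ (pcoord P) ; y = Triple.c₂ (pcoord P) ; z = Triple.c₃ (pcoord P)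
                 s = Triple.c₁ (lcoord L) ; u = Triple.c₂ (lcoord L) ; t = Triple.c₃ (lcoord L)
             in x ⋆ s + y ⋆ u + z ⋆ t

  +-cong₃ : ∀ {a a′ b b′ c c′} → a ≡ a′ → b ≡ b′ → c ≡ c′ → a + b + c ≡ a′ + b′ + c′
  +-cong₃ refl refl refl = refl

  0+0+x : ∀ x → 0# + 0# + x ≡ x
  0+0+x x = trans (cong (_+ x) (+-identityˡ 0#)) (+-identityˡ x)

  x+0+0 : ∀ x → x + 0# + 0# ≡ x
  x+0+0 x = trans (+-identityʳ _) (+-identityʳ x)

  value : Point → Line → Carrier
  value (aff x y) (sl s t) = x ⋆ s + y + t
  value (aff x y) (vert t) = x + t
  value (aff x y) linf     = 1#
  value (infSl m) (sl s t) = s + m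
  value (infSl m) (vert t) = 1#
  value (infSl m) linf     = 0#
  value infV      (sl s t) = 1#
  value infV      (vert t) = 0#
  value infV      linf     = 0#

  form≡value : ∀ P L → form P L ≡ value P L
  form≡value (aff x y) (sl s t) = +-cong₃ refl (⋆-identityʳ y) (⋆-identityˡ t)
  form≡value (aff x y) (vert t) = trans (+-cong₃ (⋆-identityʳ x) (⋆-zeroʳ y) (⋆-identityˡ t)) (cong (_+ t) (+-identityʳ x))
  form≡value (aff x y) linf     = trans (+-cong₃ (⋆-zeroʳ x) (⋆-zeroʳ y) (⋆-identityˡ 1#)) (0+0+x 1#)
  form≡value (infSl m) (sl s t) = trans (+-cong₃ (⋆-identityˡ s) (⋆-identityʳ m) (⋆-zeroˡ t)) (+-identityʳ _)
  form≡value (infSl m) (vert t) = trans (+-cong₃ (⋆-identityˡ 1#) (⋆-zeroʳ m) (⋆-zeroˡ t)) (x+0+0 1#)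
  form≡value (infSl m) linf     = trans (+-cong₃ (⋆-zeroʳ 1#) (⋆-zeroʳ m) (⋆-zeroˡ 1#)) (x+0+0 0#)
  form≡value infV      (sl s t) = trans (+-cong₃ (⋆-zeroˡ s) (⋆-identityʳ 1#) (⋆-zeroˡ t)) (trans (+-identityʳ _) (+-identityˡ 1#))
  form≡value infV      (vert t) = trans (+-cong₃ (⋆-zeroˡ 1#) (⋆-zeroʳ 1#) (⋆-zeroˡ t)) (x+0+0 0#)
  form≡value infV      linf     = trans (+-cong₃ (⋆-zeroʳ 0#) (⋆-zeroʳ 1#) (⋆-zeroˡ 1#)) (x+0+0 0#)

  value≡0⇒Inc : ∀ P L → value P L ≡ 0# → Inc P L
  value≡0⇒Inc (aff x y) (sl s t) eq = eq
  value≡0⇒Inc (aff x y) (vert t) eq = eq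
  value≡0⇒Inc (aff x y) linf     eq = 1≢0 eq
  value≡0⇒Inc (infSl m) (sl s t) eq = eq
  value≡0⇒Inc (infSl m) (vert t) eq = 1≢0 eq
  value≡0⇒Inc (infSl m) linf     eq = tt
  value≡0⇒Inc infV      (sl s t) eq = 1≢0 eq
  value≡0⇒Inc infV      (vert t) eq = tt
  value≡0⇒Inc infV      linf     eq = tt

  Inc⇒value≡0 : ∀ P L → Inc P L → value P L ≡ 0#
  Inc⇒value≡0 (aff x y) (sl s t) i = i
  Inc⇒value≡0 (aff x y) (vert t) i = i
  Inc⇒value≡0 (infSl m) (sl s t) i = i
  Inc⇒value≡0 (infSl m) linf     i = refl
  Inc⇒value≡0 infV      (vert t) i = refl
  Inc⇒value≡0 infV      linf     i = refl

  I⇒Inc : ∀ {P L} → P I L → Inc P L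
  I⇒Inc {P} {L} i = value≡0⇒Inc P L (trans (sym (form≡value P L)) (form≡0 P L i))
    where
    form≡0 : ∀ P L → P I L → form P L ≡ 0#
    form≡0 P L i = i

  Inc⇒I : ∀ {P L} → Inc P L → P I L
  Inc⇒I {P} {L} i = trans (form≡value P L) (Inc⇒value≡0 P L i)

  -- Preservation is asked of the map and of its inverse. For explicit families both are instances
  -- of one lemma, and together they give the equivalence demanded of a `Collineation`.
  record Automorphism : Set where
    field
      pt pt⁻¹ : Point → Point
      ln ln⁻¹ : Line → Line
      pt-pt⁻¹ : ∀ P → pt (pt⁻¹ P) ≡ P
      pt⁻¹-pt : ∀ P → pt⁻¹ (pt P) ≡ P
      ln-ln⁻¹ : ∀ L → ln (ln⁻¹ L) ≡ L
      ln⁻¹-ln : ∀ L → ln⁻¹ (ln L) ≡ L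
      inc   : ∀ P L → Inc P L → Inc (pt P) (ln L)
      inc⁻¹ : ∀ P L → Inc P L → Inc (pt⁻¹ P) (ln⁻¹ L)

  collineation : Automorphism → Collineation
  collineation α = record
    { pt = mk↔ₛ′ pt pt⁻¹ pt-pt⁻¹ pt⁻¹-pt
    ; ln = mk↔ₛ′ ln ln⁻¹ ln-ln⁻¹ ln⁻¹-ln
    ; inc = λ P L → mk⇔ (λ i → Inc⇒I {pt P} {ln L} (inc P L (I⇒Inc {P} {L} i)))
        (λ i → Inc⇒I {P} {L} (subst₂ Inc (pt⁻¹-pt P) (ln⁻¹-ln L) (inc⁻¹ (pt P) (ln L) (I⇒Inc {pt P} {ln L} i))))
    }
    where open Automorphism α

  _∘ᶜ_ : Collineation → Collineation → Collineation
  α ∘ᶜ β = record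
    { pt = Collineation.pt α ↔-∘ Collineation.pt β
    ; ln = Collineation.ln α ↔-∘ Collineation.ln β
    ; inc = λ P L → mk⇔ (to (Collineation.inc α _ _) ∘ to (Collineation.inc β P L))
                        (from (Collineation.inc β P L) ∘ from (Collineation.inc α _ _))
    }

  _⁻¹ᶜ : Collineation → Collineation
  α ⁻¹ᶜ = record
    { pt = ↔-sym pt
    ; ln = ↔-sym ln
    ; inc = λ P L → mk⇔
        (λ i → from (inc _ _) (subst₂ _I_ (sym (Inverse.strictlyInverseˡ pt P)) (sym (Inverse.strictlyInverseˡ ln L)) i))
        (λ i → subst₂ _I_ (Inverse.strictlyInverseˡ pt P) (Inverse.strictlyInverseˡ ln L) (to (inc _ _) i))
    }
    where open Collineation α

  -- Linear collineations

  -- The affine lines through infSl m are those with s = - m, so it is - m that is transformed like s.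
  diagPt : (c d c⁻¹ : Carrier) → Point → Point
  diagPt c d c⁻¹ (aff x y) = aff (x ⋆ c) (y ⋆ d)
  diagPt c d c⁻¹ (infSl m) = infSl (- (c⁻¹ ⋆ (- m) ⋆ d))
  diagPt c d c⁻¹ infV      = infV

  diagLn : (c d c⁻¹ : Carrier) → Line → Line
  diagLn c d c⁻¹ (sl s t) = sl (c⁻¹ ⋆ s ⋆ d) (t ⋆ d)
  diagLn c d c⁻¹ (vert t) = vert (t ⋆ c)
  diagLn c d c⁻¹ linf     = linf

  diag-inc : ∀ {c d c⁻¹} → c ⋆ c⁻¹ ≡ 1# → ∀ P L → Inc P L → Inc (diagPt c d c⁻¹ P) (diagLn c d c⁻¹ L)
  diag-inc {c} {d} {c⁻¹} cc⁻¹≡1 (aff x y) (sl s t) i =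
    trans (cong (λ z → z + y ⋆ d + t ⋆ d) slope)
      (trans (cong (_+ t ⋆ d) (sym (⋆-distribʳ d _ _))) (trans (sym (⋆-distribʳ d _ _)) (trans (cong (_⋆ d) i) (⋆-zeroˡ d))))
    where
    -- The factor `c⁻¹` stands on the left of `s` so that it meets the `c` of the scaled abscissa;
    -- the remaining common factor `d` on the right can then be taken out by right distributivity.
    slope : x ⋆ c ⋆ (c⁻¹ ⋆ s ⋆ d) ≡ x ⋆ s ⋆ d
    slope = trans (sym (⋆-assoc _ _ d)) (cong (_⋆ d) (trans (sym (⋆-assoc _ c⁻¹ s))
      (cong (_⋆ s) (trans (⋆-assoc x c c⁻¹) (trans (cong (x ⋆_) cc⁻¹≡1) (⋆-identityʳ x))))))
  diag-inc {c} _ (aff x y) (vert t) i = trans (sym (⋆-distribʳ c x t)) (trans (cong (_⋆ c) i) (⋆-zeroˡ c))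
  diag-inc _ (infSl m) (sl s t) i with refl ← x+y≡0⇒x≡-y i = -‿inverseʳ _
  diag-inc _ (infSl m) linf i = tt
  diag-inc _ infV (vert t) i = tt
  diag-inc _ infV linf i = tt

  diag-slope : ∀ {c d c⁻¹ d⁻¹} → c ⋆ c⁻¹ ≡ 1# → d ⋆ d⁻¹ ≡ 1# → ∀ s → c ⋆ (c⁻¹ ⋆ s ⋆ d) ⋆ d⁻¹ ≡ s
  diag-slope {c} {d} {c⁻¹} {d⁻¹} cc⁻¹ dd⁻¹ s = trans (cong (_⋆ d⁻¹) (sym (⋆-assoc c _ d)))
    (trans (⋆-assoc _ d d⁻¹) (trans (cong (c ⋆ (c⁻¹ ⋆ s) ⋆_) dd⁻¹) (trans (⋆-identityʳ _)
      (trans (sym (⋆-assoc c c⁻¹ s)) (trans (cong (_⋆ s) cc⁻¹) (⋆-identityˡ s))))))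

  ⋆-undo : ∀ {c c⁻¹} → c ⋆ c⁻¹ ≡ 1# → ∀ x → x ⋆ c ⋆ c⁻¹ ≡ x
  ⋆-undo cc⁻¹ x = trans (⋆-assoc x _ _) (trans (cong (x ⋆_) cc⁻¹) (⋆-identityʳ x))

  diagPt-inverse : ∀ {c d c⁻¹ d⁻¹} → c ⋆ c⁻¹ ≡ 1# → d ⋆ d⁻¹ ≡ 1# → ∀ P → diagPt c⁻¹ d⁻¹ c (diagPt c d c⁻¹ P) ≡ P
  diagPt-inverse cc dd (aff x y) = cong₂ aff (⋆-undo cc x) (⋆-undo dd y)
  diagPt-inverse {c} {d} {c⁻¹} {d⁻¹} cc dd (infSl m) = cong infSl
    (trans (cong (λ z → - (c ⋆ z ⋆ d⁻¹)) (-‿involutive _)) (trans (cong -_ (diag-slope cc dd (- m))) (-‿involutive m)))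
  diagPt-inverse _ _ infV = refl

  diagLn-inverse : ∀ {c d c⁻¹ d⁻¹} → c ⋆ c⁻¹ ≡ 1# → d ⋆ d⁻¹ ≡ 1# → ∀ L → diagLn c⁻¹ d⁻¹ c (diagLn c d c⁻¹ L) ≡ L
  diagLn-inverse cc dd (sl s t) = cong₂ sl (diag-slope cc dd s) (⋆-undo dd t)
  diagLn-inverse cc dd (vert t) = cong vert (⋆-undo cc t)
  diagLn-inverse _ _ linf = refl

  diagonal : ∀ {c d} → c ≢ 0# → d ≢ 0# → Automorphism
  diagonal {c} {d} c≢0 d≢0 = record
    { pt = diagPt c d (ninv c)
    ; pt⁻¹ = diagPt (ninv c) (ninv d) c
    ; ln = diagLn c d (ninv c)
    ; ln⁻¹ = diagLn (ninv c) (ninv d) c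
    ; pt-pt⁻¹ = diagPt-inverse (⋆-ninvˡ c≢0) (⋆-ninvˡ d≢0)
    ; pt⁻¹-pt = diagPt-inverse (⋆-ninvʳ c≢0) (⋆-ninvʳ d≢0)
    ; ln-ln⁻¹ = diagLn-inverse (⋆-ninvˡ c≢0) (⋆-ninvˡ d≢0)
    ; ln⁻¹-ln = diagLn-inverse (⋆-ninvʳ c≢0) (⋆-ninvʳ d≢0)
    ; inc = diag-inc (⋆-ninvʳ c≢0)
    ; inc⁻¹ = diag-inc (⋆-ninvˡ c≢0)
    }

  transPt : (u v : Carrier) → Point → Point
  transPt u v (aff x y) = aff (x + u) (y + v)
  transPt u v (infSl m) = infSl m
  transPt u v infV      = infV

  transLn : (u v : Carrier) → Line → Line
  transLn u v (sl s t) = sl s (t + - (u ⋆ s + v))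
  transLn u v (vert t) = vert (t + - u)
  transLn u v linf     = linf

  trans-inc : ∀ u v P L → Inc P L → Inc (transPt u v P) (transLn u v L)
  trans-inc u v (aff x y) (sl s t) i =
    trans (cong (λ z → z + (y + v) + (t + - (u ⋆ s + v))) (⋆-distribʳ s x u))
      (trans (solve 6 (λ a b c d e f → ((a ⊕ b) ⊕ (c ⊕ d)) ⊕ (e ⊕ f) ⊜ ((a ⊕ c) ⊕ e) ⊕ ((b ⊕ d) ⊕ f)) refl (x ⋆ s) (u ⋆ s) y v t (- (u ⋆ s + v)))
        (trans (cong₂ _+_ i (-‿inverseʳ _)) (+-identityʳ 0#)))
    where open +-Solver
  trans-inc u v (aff x y) (vert t) i =
    trans (solve 4 (λ a b c d → (a ⊕ b) ⊕ (c ⊕ d) ⊜ (a ⊕ c) ⊕ (b ⊕ d)) refl x u t (- u))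
      (trans (cong₂ _+_ i (-‿inverseʳ u)) (+-identityʳ 0#))
    where open +-Solver
  trans-inc u v (infSl m) (sl s t) i = i
  trans-inc u v (infSl m) linf i = tt
  trans-inc u v infV (vert t) i = tt
  trans-inc u v infV linf i = tt

  transPt-inverse : ∀ {u v u′ v′} → u + u′ ≡ 0# → v + v′ ≡ 0# → ∀ P → transPt u′ v′ (transPt u v P) ≡ P
  transPt-inverse uu vv (aff x y) =
    cong₂ aff (trans (+-assoc _ _ _) (trans (cong (x +_) uu) (+-identityʳ x)))
              (trans (+-assoc _ _ _) (trans (cong (y +_) vv) (+-identityʳ y)))
  transPt-inverse _ _ (infSl m) = refl
  transPt-inverse _ _ infV = refl

  transLn-inverse : ∀ {u v u′ v′} → u + u′ ≡ 0# → v + v′ ≡ 0# → ∀ L → transLn u′ v′ (transLn u v L) ≡ L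
  transLn-inverse {u} {v} {u′} {v′} uu vv (sl s t) = cong (sl s) (trans (+-assoc _ _ _) (trans (cong (t +_) cancel) (+-identityʳ t)))
    where
    cancel : - (u ⋆ s + v) + - (u′ ⋆ s + v′) ≡ 0#
    cancel = trans (-‿+-comm _ _) (trans (cong -_
      (trans (solve 4 (λ a b c d → (a ⊕ b) ⊕ (c ⊕ d) ⊜ (a ⊕ c) ⊕ (b ⊕ d)) refl (u ⋆ s) v (u′ ⋆ s) v′)
        (trans (cong₂ _+_ (trans (sym (⋆-distribʳ s u u′)) (trans (cong (_⋆ s) uu) (⋆-zeroˡ s))) vv) (+-identityʳ 0#)))) -0#≈0#)
      where open +-Solver
  transLn-inverse {u} {v} {u′} uu _ (vert t) = cong vert (trans (+-assoc _ _ _)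
    (trans (cong (t +_) (trans (-‿+-comm _ _) (trans (cong -_ uu) -0#≈0#))) (+-identityʳ t)))
  transLn-inverse _ _ linf = refl

  translation : Carrier → Carrier → Automorphism
  translation u v = record
    { pt = transPt u v
    ; pt⁻¹ = transPt (- u) (- v)
    ; ln = transLn u v
    ; ln⁻¹ = transLn (- u) (- v)
    ; pt-pt⁻¹ = transPt-inverse (-‿inverseˡ u) (-‿inverseˡ v)
    ; pt⁻¹-pt = transPt-inverse (-‿inverseʳ u) (-‿inverseʳ v)
    ; ln-ln⁻¹ = transLn-inverse (-‿inverseˡ u) (-‿inverseˡ v)
    ; ln⁻¹-ln = transLn-inverse (-‿inverseʳ u) (-‿inverseʳ v)
    ; inc = trans-inc u v
    ; inc⁻¹ = trans-inc (- u) (- v)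
    }

  swapInf : ∀ m → Dec (m ≡ 0#) → Point
  swapInf m (yes _) = infV
  swapInf m (no _)  = infSl (- ninv (- m))

  swapPt : Point → Point
  swapPt (aff x y) = aff y x
  swapPt (infSl m) = swapInf m (m ≟ 0#)
  swapPt infV      = infSl 0#

  -- For s ≠ 0 the equation x ⋆ s + y + t = 0 is multiplied on the right by `ninv s`, giving y ⋆
  -- ninv s + x + t ⋆ ninv s = 0, which is again in sloped form with the coordinates exchanged. For
  -- s = 0 the line y = - t becomes vertical.
  swapSl : ∀ s → Dec (s ≡ 0#) → Carrier → Line
  swapSl s (yes _) t = vert t
  swapSl s (no _)  t = sl (ninv s) (t ⋆ ninv s)

  swapLn : Line → Line
  swapLn (sl s t) = swapSl s (s ≟ 0#) t
  swapLn (vert t) = sl 0# t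
  swapLn linf     = linf

  -‿≢0 : ∀ {x} → x ≢ 0# → - x ≢ 0#
  -‿≢0 x≢0 eq = x≢0 (trans (sym (-‿involutive _)) (trans (cong -_ eq) -0#≈0#))

  swapPt-≢0 : ∀ {m} → m ≢ 0# → swapPt (infSl m) ≡ infSl (- ninv (- m))
  swapPt-≢0 {m} m≢0 = go (m ≟ 0#)
    where
    go : (d : Dec (m ≡ 0#)) → swapInf m d ≡ infSl (- ninv (- m))
    go (yes m≡0) = contradiction m≡0 m≢0
    go (no _) = refl

  swapPt-0 : swapPt (infSl 0#) ≡ infV
  swapPt-0 = go (0# ≟ 0#)
    where
    go : (d : Dec (0# ≡ 0#)) → swapInf 0# d ≡ infV
    go (yes _) = refl
    go (no ≢0) = contradiction refl ≢0

  swapLn-≢0 : ∀ {s} → s ≢ 0# → ∀ t → swapLn (sl s t) ≡ sl (ninv s) (t ⋆ ninv s)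
  swapLn-≢0 {s} s≢0 t = go (s ≟ 0#)
    where
    go : (d : Dec (s ≡ 0#)) → swapSl s d t ≡ sl (ninv s) (t ⋆ ninv s)
    go (yes s≡0) = contradiction s≡0 s≢0
    go (no _) = refl

  swapLn-0 : ∀ t → swapLn (sl 0# t) ≡ vert t
  swapLn-0 t = go (0# ≟ 0#)
    where
    go : (d : Dec (0# ≡ 0#)) → swapSl 0# d t ≡ vert t
    go (yes _) = refl
    go (no ≢0) = contradiction refl ≢0

  swapPt-involutive : ∀ P → swapPt (swapPt P) ≡ P
  swapPt-involutive (aff x y) = refl
  swapPt-involutive (infSl m) = go (m ≟ 0#)
    where
    go : Dec (m ≡ 0#) → swapPt (swapPt (infSl m)) ≡ infSl m
    go (yes refl) = cong swapPt swapPt-0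
    go (no m≢0) = trans (cong swapPt (swapPt-≢0 m≢0)) (trans (swapPt-≢0 (-‿≢0 (ninv-nonzero (-‿≢0 m≢0))))
      (cong infSl (trans (cong (λ z → - ninv z) (-‿involutive _)) (trans (cong -_ (ninv-involutive (-‿≢0 m≢0))) (-‿involutive m)))))
  swapPt-involutive infV = swapPt-0

  swapLn-involutive : ∀ L → swapLn (swapLn L) ≡ L
  swapLn-involutive (sl s t) = go (s ≟ 0#)
    where
    go : Dec (s ≡ 0#) → swapLn (swapLn (sl s t)) ≡ sl s t
    go (yes refl) = cong swapLn (swapLn-0 t)
    go (no s≢0) = trans (cong swapLn (swapLn-≢0 s≢0 t)) (trans (swapLn-≢0 (ninv-nonzero s≢0) _)
      (cong₂ sl (ninv-involutive s≢0) (⋆-ninv-cancelʳ t (ninv-nonzero s≢0))))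
  swapLn-involutive (vert t) = swapLn-0 t
  swapLn-involutive linf = refl

  swap-inc : ∀ P L → Inc P L → Inc (swapPt P) (swapLn L)
  swap-inc (aff x y) (sl s t) i = go (s ≟ 0#)
    where
    go : Dec (s ≡ 0#) → Inc (aff y x) (swapLn (sl s t))
    go (yes refl) = subst (Inc (aff y x)) (sym (swapLn-0 t))
      (trans (cong (_+ t) (trans (sym (+-identityˡ y)) (cong (_+ y) (sym (⋆-zeroʳ x))))) i)
    go (no s≢0) = subst (Inc (aff y x)) (sym (swapLn-≢0 s≢0 t))
      (trans (cong (_+ t ⋆ ninv s) (trans (+-comm _ x) (cong (_+ y ⋆ ninv s) (sym (⋆-ninv-cancelʳ x s≢0)))))
          (trans (cong (_+ t ⋆ ninv s) (sym (⋆-distribʳ (ninv s) _ _))) (trans (sym (⋆-distribʳ (ninv s) _ _))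
            (trans (cong (_⋆ ninv s) i) (⋆-zeroˡ (ninv s))))))
  swap-inc (aff x y) (vert t) i = trans (cong (_+ t) (trans (cong (_+ x) (⋆-zeroʳ y)) (+-identityˡ x))) i
  swap-inc (infSl m) (sl s t) i with refl ← x+y≡0⇒x≡-y i = go (m ≟ 0#)
    where
    go : Dec (m ≡ 0#) → Inc (swapPt (infSl m)) (swapLn (sl (- m) t))
    go (yes refl) = subst₂ Inc (sym swapPt-0) (sym (trans (cong (λ z → swapLn (sl z t)) -0#≈0#) (swapLn-0 t))) tt
    go (no m≢0) = subst₂ Inc (sym (swapPt-≢0 m≢0)) (sym (swapLn-≢0 (-‿≢0 m≢0) t)) (-‿inverseʳ _)
  swap-inc (infSl m) linf i = go (m ≟ 0#)
    where
    go : (d : Dec (m ≡ 0#)) → Inc (swapInf m d) linf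
    go (yes _) = tt
    go (no _) = tt
  swap-inc infV (vert t) i = +-identityˡ 0#
  swap-inc infV linf i = tt

  swapping : Automorphism
  swapping = record
    { pt = swapPt ; pt⁻¹ = swapPt ; ln = swapLn ; ln⁻¹ = swapLn
    ; pt-pt⁻¹ = swapPt-involutive ; pt⁻¹-pt = swapPt-involutive
    ; ln-ln⁻¹ = swapLn-involutive ; ln⁻¹-ln = swapLn-involutive
    ; inc = swap-inc ; inc⁻¹ = swap-inc
    }

  linear : ∀ π → Nonzero π → Collineation
  linear (lpar φK c d u v) (c≢0 , d≢0) = collineation (translation u v) ∘ᶜ collineation (diagonal c≢0 d≢0)
  linear (lpar γK c d u v) (c≢0 , d≢0) = collineation (translation u v) ∘ᶜ (collineation (diagonal c≢0 d≢0) ∘ᶜ collineation swapping)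

  linear-acts : ∀ π (nz : Nonzero π) → ActsAs (linear π nz) π
  linear-acts (lpar φK c d u v) _ x y = refl
  linear-acts (lpar γK c d u v) _ x y = refl


  -- Collineations are determined by their action on the affine points

  FixesAffine : Collineation → Set
  FixesAffine α = ∀ x y → α · aff x y ≡ aff x y

  module _ (α : Collineation) (fixes : FixesAffine α) where
    private
      img : Line → Line
      img L = Inverse.to (Collineation.ln α) L

      transport : ∀ {P L} → Inc P L → Inc (α · P) (img L)
      transport {P} {L} i = I⇒Inc {α · P} {img L} (to (Collineation.inc α P L) (Inc⇒I {P} {L} i))

      on-img : ∀ {x y} L → Inc (aff x y) L → Inc (aff x y) (img L)
      on-img {x} {y} L i = subst (λ P → Inc P (img L)) (fixes x y) (transport {aff x y} {L} i)

    -- The image contains the points of the line with abscissas 0 and 1. Their abscissas differ, so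
    -- the image is not vertical, and the two equations determine its slope and intercept.
    fixes-sl : ∀ s t → img (sl s t) ≡ sl s t
    fixes-sl s t with img (sl s t) | on-img {0#} {(- t)} (sl s t) at0 | on-img {1#} {(- (s + t))} (sl s t) at1
      where
      at0 : 0# ⋆ s + - t + t ≡ 0#
      at0 = trans (+-assoc _ _ _) (trans (cong₂ _+_ (⋆-zeroˡ s) (-‿inverseˡ t)) (+-identityˡ 0#))
      at1 : 1# ⋆ s + - (s + t) + t ≡ 0#
      at1 = trans (cong (λ z → z + - (s + t) + t) (⋆-identityˡ s))
        (trans (solve 3 (λ a b c → (a ⊕ b) ⊕ c ⊜ (a ⊕ c) ⊕ b) refl s (- (s + t)) t) (-‿inverseʳ _))
        where open +-Solver
    ... | vert t′ | i | k = contradiction (+-cancelʳ t′ 0# 1# (trans i (sym k))) 0≢1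
    ... | sl s′ t′ | i | k = cong₂ sl s′≡s t′≡t
      where
      t′≡t : t′ ≡ t
      t′≡t = trans (sym (+-identityˡ t′)) (trans (cong (_+ t′) (sym (-‿inverseʳ t)))
        (trans (+-assoc _ _ _) (trans (cong (t +_) (trans (sym (trans (cong (λ z → z + - t + t′) (⋆-zeroˡ s′)) (cong (_+ t′) (+-identityˡ (- t))))) i)) (+-identityʳ t))))
      s′≡s : s′ ≡ s
      s′≡s = +-cancelʳ (- (s + t) + t) s′ s (trans (trans (sym (+-assoc _ _ _)) (trans (cong₂ (λ a b → a + - (s + t) + b) (sym (⋆-identityˡ s′)) (sym t′≡t)) k))
        (sym (trans (solve 3 (λ a b c → a ⊕ (b ⊕ c) ⊜ (a ⊕ c) ⊕ b) refl s (- (s + t)) t) (-‿inverseʳ _))))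
        where open +-Solver

    fixes-vert : ∀ t → img (vert t) ≡ vert t
    fixes-vert t with img (vert t) | on-img {(- t)} {0#} (vert t) (-‿inverseˡ t) | on-img {(- t)} {1#} (vert t) (-‿inverseˡ t)
    ... | vert t′ | i | _ = cong vert (sym (trans (x+y≡0⇒x≡-y (trans (+-comm t (- t′)) (trans (cong (_+ t) (sym (x+y≡0⇒x≡-y i))) (-‿inverseˡ t)))) (-‿involutive t′)))
    ... | sl s′ t′ | i | k = contradiction (+-cancelˡ ((- t) ⋆ s′) 0# 1# (+-cancelʳ t′ _ _ (trans i (sym k)))) 0≢1

    -- A point at infinity is the meet of two parallel affine lines, which are fixed; parameters 0
    -- and 1 provide such a pair in every direction.
    fixes-all : ∀ P → α · P ≡ P
    fixes-all (aff x y) = fixes x y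
    fixes-all (infSl m) with α · infSl m | transport {infSl m} {sl (- m) 0#} (-‿inverseˡ m) | transport {infSl m} {sl (- m) 1#} (-‿inverseˡ m)
    ... | R | i | k rewrite fixes-sl (- m) 0# | fixes-sl (- m) 1# = on-both R i k
      where
      on-both : ∀ R → Inc R (sl (- m) 0#) → Inc R (sl (- m) 1#) → R ≡ infSl m
      on-both (aff x y) i k = contradiction (+-cancelˡ _ 0# 1# (trans i (sym k))) 0≢1
      on-both (infSl m′) i _ = cong infSl (+-cancelˡ (- m) m′ m (trans i (sym (-‿inverseˡ m))))
    fixes-all infV with α · infV | transport {infV} {vert 0#} tt | transport {infV} {vert 1#} tt
    ... | R | i | k rewrite fixes-vert 0# | fixes-vert 1# = on-both R i k
      where
      on-both : ∀ R → Inc R (vert 0#) → Inc R (vert 1#) → R ≡ infV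
      on-both (aff x y) i k = contradiction (+-cancelˡ x 0# 1# (trans i (sym k))) 0≢1
      on-both infV _ _ = refl

  agree : ∀ α β → (∀ x y → α · aff x y ≡ β · aff x y) → ∀ P → α · P ≡ β · P
  agree α β eq P = trans (sym (Inverse.strictlyInverseˡ (Collineation.pt β) (α · P)))
    (cong (β ·_) (fixes-all ((β ⁻¹ᶜ) ∘ᶜ α) (λ x y → trans (cong ((β ⁻¹ᶜ) ·_) (eq x y)) (Inverse.strictlyInverseʳ (Collineation.pt β) (aff x y))) P))

  acts-agree : ∀ α β {π} → ActsAs α π → ActsAs β π → ∀ P → α · P ≡ β · P
  acts-agree α β hα hβ = agree α β (λ x y → trans (hα x y) (sym (hβ x y)))

  -- Composition, inversion and uniqueness of the parameters of linear collineations

  _∘ᴸ_ : LPar → LPar → LPar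
  lpar φK c d u v ∘ᴸ lpar k c₁ d₁ u₁ v₁ = lpar k (c₁ ⋆ c) (d₁ ⋆ d) (u₁ ⋆ c + u) (v₁ ⋆ d + v)
  lpar γK c d u v ∘ᴸ lpar φK c₁ d₁ u₁ v₁ = γ (d₁ ⋆ c) (c₁ ⋆ d) (v₁ ⋆ c + u) (u₁ ⋆ d + v)
  lpar γK c d u v ∘ᴸ lpar γK c₁ d₁ u₁ v₁ = φ (d₁ ⋆ c) (c₁ ⋆ d) (v₁ ⋆ c + u) (u₁ ⋆ d + v)

  _⁻¹ᴸ : LPar → LPar
  lpar φK c d u v ⁻¹ᴸ = φ (ninv c) (ninv d) (- (u ⋆ ninv c)) (- (v ⋆ ninv d))
  lpar γK c d u v ⁻¹ᴸ = γ (ninv d) (ninv c) (- (v ⋆ ninv d)) (- (u ⋆ ninv c))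

  ∘ᴸ-nonzero : ∀ π ρ → Nonzero π → Nonzero ρ → Nonzero (π ∘ᴸ ρ)
  ∘ᴸ-nonzero (lpar φK _ _ _ _) (lpar k _ _ _ _) (c , d) (c₁ , d₁) = ⋆-nonzero c₁ c , ⋆-nonzero d₁ d
  ∘ᴸ-nonzero (lpar γK _ _ _ _) (lpar φK _ _ _ _) (c , d) (c₁ , d₁) = ⋆-nonzero d₁ c , ⋆-nonzero c₁ d
  ∘ᴸ-nonzero (lpar γK _ _ _ _) (lpar γK _ _ _ _) (c , d) (c₁ , d₁) = ⋆-nonzero d₁ c , ⋆-nonzero c₁ d

  ⁻¹ᴸ-nonzero : ∀ π → Nonzero π → Nonzero (π ⁻¹ᴸ)
  ⁻¹ᴸ-nonzero (lpar φK _ _ _ _) (c , d) = ninv-nonzero c , ninv-nonzero d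
  ⁻¹ᴸ-nonzero (lpar γK _ _ _ _) (c , d) = ninv-nonzero d , ninv-nonzero c

  compose-affine : ∀ x c₁ u₁ c u → (x ⋆ c₁ + u₁) ⋆ c + u ≡ x ⋆ (c₁ ⋆ c) + (u₁ ⋆ c + u)
  compose-affine x c₁ u₁ c u = trans (cong (_+ u) (trans (⋆-distribʳ c _ u₁) (cong (_+ u₁ ⋆ c) (⋆-assoc x c₁ c)))) (+-assoc _ _ _)

  acts-∘ : ∀ α β π ρ → ActsAs α π → ActsAs β ρ → ActsAs (α ∘ᶜ β) (π ∘ᴸ ρ)
  acts-∘ α β (lpar φK c d u v) (lpar φK c₁ d₁ u₁ v₁) hα hβ x y =
    trans (cong (α ·_) (hβ x y)) (trans (hα _ _) (cong₂ aff (compose-affine x c₁ u₁ c u) (compose-affine y d₁ v₁ d v)))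
  acts-∘ α β (lpar φK c d u v) (lpar γK c₁ d₁ u₁ v₁) hα hβ x y =
    trans (cong (α ·_) (hβ x y)) (trans (hα _ _) (cong₂ aff (compose-affine y c₁ u₁ c u) (compose-affine x d₁ v₁ d v)))
  acts-∘ α β (lpar γK c d u v) (lpar φK c₁ d₁ u₁ v₁) hα hβ x y =
    trans (cong (α ·_) (hβ x y)) (trans (hα _ _) (cong₂ aff (compose-affine y d₁ v₁ c u) (compose-affine x c₁ u₁ d v)))
  acts-∘ α β (lpar γK c d u v) (lpar γK c₁ d₁ u₁ v₁) hα hβ x y =
    trans (cong (α ·_) (hβ x y)) (trans (hα _ _) (cong₂ aff (compose-affine x d₁ v₁ c u) (compose-affine y c₁ u₁ d v)))

  undo-affine : ∀ {c} → c ≢ 0# → ∀ x u → (x ⋆ ninv c + - (u ⋆ ninv c)) ⋆ c + u ≡ x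
  undo-affine {c} c≢0 x u = trans (cong (_+ u) (trans (⋆-distribʳ c _ _) (cong₂ _+_ (ninv-⋆-cancelʳ x c≢0)
    (trans (-‿⋆ _ c) (cong -_ (ninv-⋆-cancelʳ u c≢0)))))) (+-undoˡ x u)

  acts-⁻¹ : ∀ α π → Nonzero π → ActsAs α π → ActsAs (α ⁻¹ᶜ) (π ⁻¹ᴸ)
  acts-⁻¹ α π nz hα x y = trans (cong ((α ⁻¹ᶜ) ·_) (sym (forward π nz hα))) (Inverse.strictlyInverseʳ (Collineation.pt α) _)
    where
    forward : ∀ π → Nonzero π → ActsAs α π → α · affImage (π ⁻¹ᴸ) x y ≡ aff x y
    forward (lpar φK c d u v) (c≢0 , d≢0) hα = trans (hα _ _) (cong₂ aff (undo-affine c≢0 x u) (undo-affine d≢0 y v))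
    forward (lpar γK c d u v) (c≢0 , d≢0) hα = trans (hα _ _) (cong₂ aff (undo-affine c≢0 x u) (undo-affine d≢0 y v))

  aff-injective : ∀ {x y x′ y′} → aff x y ≡ aff x′ y′ → x ≡ x′ × y ≡ y′
  aff-injective refl = refl , refl

  private
    0⋆+ : ∀ c u → 0# ⋆ c + u ≡ u
    0⋆+ c u = trans (cong (_+ u) (⋆-zeroˡ c)) (+-identityˡ u)
    1⋆+ : ∀ c u → 1# ⋆ c + u ≡ c + u
    1⋆+ c u = cong (_+ u) (⋆-identityˡ c)

    origin : ∀ {c d u v c′ d′ u′ v′} → aff (0# ⋆ c + u) (0# ⋆ d + v) ≡ aff (0# ⋆ c′ + u′) (0# ⋆ d′ + v′) → u ≡ u′ × v ≡ v′
    origin {c} {d} {u} {v} {c′} {d′} {u′} {v′} eq = let a , b = aff-injective eq in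
      trans (sym (0⋆+ c u)) (trans a (0⋆+ c′ u′)) , trans (sym (0⋆+ d v)) (trans b (0⋆+ d′ v′))

    slope : ∀ {c c′ u} → 1# ⋆ c + u ≡ 1# ⋆ c′ + u → c ≡ c′
    slope {c} {c′} {u} eq = +-cancelʳ u c c′ (trans (sym (1⋆+ c u)) (trans eq (1⋆+ c′ u)))

    mixed : ∀ {c c′ u} → 1# ⋆ c + u ≡ 0# ⋆ c′ + u → c ≡ 0#
    mixed {c} {c′} {u} eq = +-cancelʳ u c 0# (trans (sym (1⋆+ c u)) (trans eq (trans (0⋆+ c′ u) (sym (+-identityˡ u)))))

  -- The image of the origin gives `u` and `v`, and the images of (1,0) and (0,1) give `c` and `d`.
  -- The kinds are told apart at the points (1,0) and (0,1): where one kind moves the first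
  -- coordinate of the image away from `u`, the other leaves it at `u`.
  params-unique : ∀ π ρ → Nonzero π → Nonzero ρ → (∀ x y → affImage π x y ≡ affImage ρ x y) → π ≡ ρ
  params-unique (lpar φK c d u v) (lpar φK c′ d′ u′ v′) _ _ eq
    with refl , refl ← origin (eq 0# 0#)
    with refl ← slope (proj₁ (aff-injective (eq 1# 0#))) | refl ← slope (proj₂ (aff-injective (eq 0# 1#))) = refl
  params-unique (lpar γK c d u v) (lpar γK c′ d′ u′ v′) _ _ eq
    with refl , refl ← origin (eq 0# 0#)
    with refl ← slope (proj₁ (aff-injective (eq 0# 1#))) | refl ← slope (proj₂ (aff-injective (eq 1# 0#))) = refl
  params-unique (lpar φK c d u v) (lpar γK c′ d′ u′ v′) (c≢0 , _) _ eq
    with refl , refl ← origin (eq 0# 0#) = contradiction (mixed (proj₁ (aff-injective (eq 1# 0#)))) c≢0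
  params-unique (lpar γK c d u v) (lpar φK c′ d′ u′ v′) (c≢0 , _) _ eq
    with refl , refl ← origin (eq 0# 0#) = contradiction (mixed (proj₁ (aff-injective (eq 0# 1#)))) c≢0

  acts-unique : ∀ {α π ρ} → Nonzero π → Nonzero ρ → ActsAs α π → ActsAs α ρ → π ≡ ρ
  acts-unique {π = π} {ρ} nzπ nzρ hπ hρ = params-unique π ρ nzπ nzρ (λ x y → trans (sym (hπ x y)) (hρ x y))

  inAut-∘ : ∀ {U : PointSet} {α β} → InAut U α → InAut U β → InAut U (α ∘ᶜ β)
  inAut-∘ {β = β} a b P = mk⇔ (to (a (β · P)) ∘ to (b P)) (from (b P) ∘ from (a (β · P)))

  inAut-⁻¹ : ∀ {U : PointSet} {α} → InAut U α → InAut U (α ⁻¹ᶜ)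
  inAut-⁻¹ {U} {α} a P = mk⇔
    (λ p → from (a _) (subst U (sym (Inverse.strictlyInverseˡ (Collineation.pt α) P)) p))
    (λ p → subst U (Inverse.strictlyInverseˡ (Collineation.pt α) P) (to (a _) p))

  inAut-agree : ∀ {U : PointSet} {α β} → (∀ P → α · P ≡ β · P) → InAut U α → InAut U β
  inAut-agree {U} eq a P = mk⇔ (subst U (eq P) ∘ to (a P)) (from (a P) ∘ subst U (sym (eq P)))

  GPar-∘ : ∀ {U : PointSet} {π ρ} → GPar U π → GPar U ρ → GPar U (π ∘ᴸ ρ)
  GPar-∘ {U} {π} {ρ} (nz , α , hα , a) (nz′ , β , hβ , b) =
    ∘ᴸ-nonzero π ρ nz nz′ , α ∘ᶜ β , acts-∘ α β π ρ hα hβ , inAut-∘ {U} {α} {β} a b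

  GPar-⁻¹ : ∀ {U : PointSet} {π} → GPar U π → GPar U (π ⁻¹ᴸ)
  GPar-⁻¹ {U} {π} (nz , α , hα , a) = ⁻¹ᴸ-nonzero π nz , α ⁻¹ᶜ , acts-⁻¹ α π nz hα , inAut-⁻¹ {U} {α} a

  -- This allows the unspecified collineation in `GPar` to be replaced by the explicit one with the
  -- same parameters, whose action on lines and on points at infinity is known.
  inAut-GPar : ∀ {U : PointSet} {π α} → GPar U π → ActsAs α π → InAut U α
  inAut-GPar {U} {π} {α} (_ , β , hβ , b) hα = inAut-agree {U} {β} {α} (acts-agree β α hβ hα) b

  -- Transport of unitals and of their automorphism groups along a collineation

  move : Collineation → PointSet → PointSet
  move σ U P = U (Inverse.from (Collineation.pt σ) P)

  module _ {U : PointSet} (σ : Collineation) where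
    private
      σP = Collineation.pt σ
      σL = Collineation.ln σ

    move-size : ∀ {X Y : PointSet} → (∀ {P} → X P → Y (σ · P)) → (∀ {P} → Y P → X (Inverse.from σP P)) →
                ∀ {n} → HasSize X n → HasSize Y n
    move-size {X} {Y} f g = size-bij (σ ·_) f (λ {P} y → _ , g y , Inverse.strictlyInverseˡ σP P)
      (λ {P} {Q} _ _ eq → trans (sym (Inverse.strictlyInverseʳ σP P)) (trans (cong (Inverse.from σP) eq) (Inverse.strictlyInverseʳ σP Q)))

    move-∈ : ∀ {P} → U P → move σ U (σ · P)
    move-∈ {P} = subst U (sym (Inverse.strictlyInverseʳ σP P))

    move-line : ∀ L {n} → HasSize (OnLine U (Inverse.from σL L)) n → HasSize (OnLine (move σ U) L) n
    move-line L = move-size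
      (λ {P} (u , i) → move-∈ u , subst (σ · P I_) (Inverse.strictlyInverseˡ σL L) (to (Collineation.inc σ P (Inverse.from σL L)) i))
      (λ {P} (u , i) → u , from (Collineation.inc σ (Inverse.from σP P) (Inverse.from σL L)) (subst₂ _I_ (sym (Inverse.strictlyInverseˡ σP P)) (sym (Inverse.strictlyInverseˡ σL L)) i))

    move-unital : Unital U → Unital (move σ U)
    move-unital (size , lines) = move-size move-∈ id size , λ L → ⊎-map (move-line L) (move-line L) (lines (Inverse.from σL L))

    move-aut : ∀ {α} → InAut U α → InAut (move σ U) ((σ ∘ᶜ α) ∘ᶜ (σ ⁻¹ᶜ))
    move-aut {α} a P = mk⇔ (λ u → subst U (sym (Inverse.strictlyInverseʳ σP _)) (to (a _) u))
                           (λ u → from (a _) (subst U (Inverse.strictlyInverseʳ σP _) u))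

    move-aut⁻¹ : ∀ {α} → InAut (move σ U) α → InAut U (((σ ⁻¹ᶜ) ∘ᶜ α) ∘ᶜ σ)
    move-aut⁻¹ {α} a P = mk⇔ (λ u → to (a _) (move-∈ u))
                             (λ u → subst U (Inverse.strictlyInverseʳ σP P) (from (a _) u))

    -- Conjugation by `ρ` carries one group to the other. That it is bijective is verified for the
    -- collineations pointwise and brought back to parameters by `acts-unique`, which avoids
    -- calculating with triple products of parameters.
    move-GPar : ∀ {ρ} → Nonzero ρ → ActsAs σ ρ → ∀ {n} → HasSize (GPar U) n → HasSize (GPar (move σ U)) n
    move-GPar {ρ} nz hσ = size-bij conj forward backward injective
      where
      conj conj⁻¹ : LPar → LPar
      conj π = (ρ ∘ᴸ π) ∘ᴸ (ρ ⁻¹ᴸ)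
      conj⁻¹ π = ((ρ ⁻¹ᴸ) ∘ᴸ π) ∘ᴸ ρ
      nz⁻¹ = ⁻¹ᴸ-nonzero ρ nz
      hσ⁻¹ = acts-⁻¹ σ ρ nz hσ
      conj-acts : ∀ α π → ActsAs α π → ActsAs ((σ ∘ᶜ α) ∘ᶜ (σ ⁻¹ᶜ)) (conj π)
      conj-acts α π hα = acts-∘ (σ ∘ᶜ α) (σ ⁻¹ᶜ) (ρ ∘ᴸ π) (ρ ⁻¹ᴸ) (acts-∘ σ α ρ π hσ hα) hσ⁻¹
      conj⁻¹-acts : ∀ α π → ActsAs α π → ActsAs (((σ ⁻¹ᶜ) ∘ᶜ α) ∘ᶜ σ) (conj⁻¹ π)
      conj⁻¹-acts α π hα = acts-∘ ((σ ⁻¹ᶜ) ∘ᶜ α) σ ((ρ ⁻¹ᴸ) ∘ᴸ π) ρ (acts-∘ (σ ⁻¹ᶜ) α (ρ ⁻¹ᴸ) π hσ⁻¹ hα) hσ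
      conj-nonzero : ∀ {π} → Nonzero π → Nonzero (conj π)
      conj-nonzero {π} nzπ = ∘ᴸ-nonzero (ρ ∘ᴸ π) (ρ ⁻¹ᴸ) (∘ᴸ-nonzero ρ π nz nzπ) nz⁻¹
      conj⁻¹-nonzero : ∀ {π} → Nonzero π → Nonzero (conj⁻¹ π)
      conj⁻¹-nonzero {π} nzπ = ∘ᴸ-nonzero ((ρ ⁻¹ᴸ) ∘ᴸ π) ρ (∘ᴸ-nonzero (ρ ⁻¹ᴸ) π nz⁻¹ nzπ) nz
      forward : ∀ {π} → GPar U π → GPar (move σ U) (conj π)
      forward {π} (nzπ , α , hα , a) = conj-nonzero nzπ , (σ ∘ᶜ α) ∘ᶜ (σ ⁻¹ᶜ) , conj-acts α π hα , move-aut {α} a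
      conj-conj⁻¹ : ∀ {α π} → Nonzero π → ActsAs α π → conj (conj⁻¹ π) ≡ π
      conj-conj⁻¹ {α} {π} nzπ hα = acts-unique {α = α} (conj-nonzero (conj⁻¹-nonzero nzπ)) nzπ
        (λ x y → trans (sym (cancel (aff x y))) (conj-acts (((σ ⁻¹ᶜ) ∘ᶜ α) ∘ᶜ σ) (conj⁻¹ π) (conj⁻¹-acts α π hα) x y)) hα
        where
        cancel : ∀ P → σ · ((σ ⁻¹ᶜ) · (α · (σ · ((σ ⁻¹ᶜ) · P)))) ≡ α · P
        cancel P = trans (Inverse.strictlyInverseˡ σP _) (cong (α ·_) (Inverse.strictlyInverseˡ σP P))
      backward : ∀ {π} → GPar (move σ U) π → Image (GPar U) conj π
      backward {π} (nzπ , α , hα , a) = conj⁻¹ π ,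
        (conj⁻¹-nonzero nzπ , ((σ ⁻¹ᶜ) ∘ᶜ α) ∘ᶜ σ , conj⁻¹-acts α π hα , move-aut⁻¹ {α} a) , conj-conj⁻¹ {α} nzπ hα
      injective : InjectiveOn (GPar U) conj
      injective {π} {π′} (nzπ , α , hα , _) (nzπ′ , α′ , hα′ , _) eq =
        acts-unique {α = α} nzπ nzπ′ hα (λ x y → trans (same (aff x y)) (hα′ x y))
        where
        hconj′ : ActsAs ((σ ∘ᶜ α′) ∘ᶜ (σ ⁻¹ᶜ)) (conj π)
        hconj′ = subst (ActsAs ((σ ∘ᶜ α′) ∘ᶜ (σ ⁻¹ᶜ))) (sym eq) (conj-acts α′ π′ hα′)
        same : ∀ P → α · P ≡ α′ · P
        same P = trans (sym (reduce α)) (trans (cong (Inverse.from σP) (acts-agree ((σ ∘ᶜ α) ∘ᶜ (σ ⁻¹ᶜ)) ((σ ∘ᶜ α′) ∘ᶜ (σ ⁻¹ᶜ)) (conj-acts α π hα) hconj′ (σ · P))) (reduce α′))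
          where
          reduce : ∀ β → Inverse.from σP (σ · (β · (Inverse.from σP (σ · P)))) ≡ β · P
          reduce β = trans (Inverse.strictlyInverseʳ σP _) (cong (β ·_) (Inverse.strictlyInverseʳ σP P))

  -- Tangents through a point at infinity

  data Inf : Set where
    V : Inf
    S : Carrier → Inf

  pt : Inf → Point
  pt V     = infV
  pt (S m) = infSl m

  _≟∞_ : DecidableEquality Inf
  V ≟∞ V = yes refl
  V ≟∞ S _ = no λ ()
  S _ ≟∞ V = no λ ()
  S m ≟∞ S m′ = map′ (cong S) (λ { refl → refl }) (m ≟ m′)

  _≟ᴾ_ : DecidableEquality Point
  aff x y ≟ᴾ aff x′ y′ = map′ (λ { (refl , refl) → refl }) aff-injective ((x ≟ x′) ×-dec (y ≟ y′))
  aff _ _ ≟ᴾ infSl _ = no λ ()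
  aff _ _ ≟ᴾ infV = no λ ()
  infSl _ ≟ᴾ aff _ _ = no λ ()
  infSl m ≟ᴾ infSl m′ = map′ (cong infSl) (λ { refl → refl }) (m ≟ m′)
  infSl _ ≟ᴾ infV = no λ ()
  infV ≟ᴾ aff _ _ = no λ ()
  infV ≟ᴾ infSl _ = no λ ()
  infV ≟ᴾ infV = yes refl

  -- The affine lines through pt P are the lines ℓ P t, and ℓ P t consists of the affine points of level t.
  level : Inf → Carrier → Carrier → Carrier
  level V     x y = x
  level (S m) x y = x ⋆ (- m) + y

  ℓ : Inf → Carrier → Line
  ℓ V     t = vert (- t)
  ℓ (S m) t = sl (- m) (- t)

  x-y≡0⇒x≡y : ∀ {x y} → x + - y ≡ 0# → x ≡ y
  x-y≡0⇒x≡y eq = trans (x+y≡0⇒x≡-y eq) (-‿involutive _)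

  aff∈ℓ⇒ : ∀ P {x y t} → Inc (aff x y) (ℓ P t) → level P x y ≡ t
  aff∈ℓ⇒ V i = x-y≡0⇒x≡y i
  aff∈ℓ⇒ (S m) i = x-y≡0⇒x≡y i

  aff∈ℓ⇐ : ∀ P {x y t} → level P x y ≡ t → Inc (aff x y) (ℓ P t)
  aff∈ℓ⇐ V refl = -‿inverseʳ _
  aff∈ℓ⇐ (S m) refl = -‿inverseʳ _

  pt∈ℓ : ∀ P {t} → Inc (pt P) (ℓ P t)
  pt∈ℓ V = tt
  pt∈ℓ (S m) = -‿inverseˡ m

  inf∈ℓ : ∀ P {Q t} → Inc (pt Q) (ℓ P t) → Q ≡ P
  inf∈ℓ V {V} _ = refl
  inf∈ℓ (S m) {S m′} i = cong S (+-cancelˡ (- m) m′ m (trans i (sym (-‿inverseˡ m))))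

  inf∈linf : ∀ P → Inc (pt P) linf
  inf∈linf V = tt
  inf∈linf (S _) = tt

  -- Each `level P` is additive, so a translation shifts the parallel class of P by the constant
  -- `level P u v`, and P is a centre exactly when this constant is 0.
  level-+ : ∀ P x y u v → level P (x + u) (y + v) ≡ level P x y + level P u v
  level-+ V _ _ _ _ = refl
  level-+ (S m) x y u v = trans (cong (_+ (y + v)) (⋆-distribʳ (- m) x u))
    (solve 4 (λ a b c d → (a ⊕ b) ⊕ (c ⊕ d) ⊜ (a ⊕ c) ⊕ (b ⊕ d)) refl (x ⋆ (- m)) (u ⋆ (- m)) y v)
    where open +-Solver

  transLn-ℓ : ∀ P u v t → transLn u v (ℓ P t) ≡ ℓ P (t + level P u v)
  transLn-ℓ V u v t = cong vert (-‿+-comm t u)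
  transLn-ℓ (S m) u v t = cong (sl (- m)) (-‿+-comm t _)

  -- The groups of translations with different centres meet trivially: two sloped directions give u
  -- ⋆ (- m) = u ⋆ (- m′), and a nonzero `u` can be cancelled on the left.
  level-0-unique : ∀ P Q {u v} → P ≢ Q → level P u v ≡ 0# → level Q u v ≡ 0# → u ≡ 0# × v ≡ 0#
  level-0-unique V V P≢Q _ _ = contradiction refl P≢Q
  level-0-unique V (S m) {v = v} _ refl eq = refl , trans (sym (+-identityˡ v)) (trans (cong (_+ v) (sym (⋆-zeroˡ (- m)))) eq)
  level-0-unique (S m) V {v = v} _ eq refl = refl , trans (sym (+-identityˡ v)) (trans (cong (_+ v) (sym (⋆-zeroˡ (- m)))) eq)
  level-0-unique (S m) (S m′) {u} {v} P≢Q eq eq′ with u ≟ 0#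
  ... | yes refl = level-0-unique V (S m) (λ ()) refl eq
  ... | no u≢0 = contradiction (cong S (-‿injective (⋆-cancelˡ u≢0 (+-cancelʳ v _ _ (trans eq (sym eq′)))))) P≢Q

  centre : ∀ u v → ∃[ P ] level P u v ≡ 0#
  centre u v with u ≟ 0#
  ... | yes u≡0 = V , u≡0
  -- The slope solves u ⋆ (- m) + v = 0 for `m`.
  ... | no u≢0 = S (- (ninv u ⋆ (- v))) , trans (cong (λ z → u ⋆ z + v) (-‿involutive _))
    (trans (cong (_+ v) (trans (sym (⋆-assoc u _ _)) (trans (cong (_⋆ (- v)) (⋆-ninvʳ u≢0)) (⋆-identityˡ _)))) (-‿inverseˡ v))

  points-split : ∀ {X : PointSet} {n} → HasSize X n →
    ∃[ a ] ∃[ b ] (HasSize (λ (x , y) → X (aff x y)) a × HasSize (X ∘ pt) b × a ℕ.+ b ≡ n)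
  points-split {X} hX with size-split affine? hX
    where
    affine? : Decidable (λ P → ∃[ z ] P ≡ aff (proj₁ z) (proj₂ z))
    affine? (aff x y) = yes ((x , y) , refl)
    affine? (infSl _) = no λ ()
    affine? infV = no λ ()
  ... | a , b , hA , hI , eq = a , b ,
    size-bij coords (λ { (x , _ , refl) → x }) (λ {z} x → aff (proj₁ z) (proj₂ z) , (x , z , refl) , refl)
      (λ { (_ , _ , refl) (_ , _ , refl) refl → refl }) hA ,
    size-bij toInf (λ {P} (x , ¬a) → toInf-∈ P x ¬a) (λ {Q} x → pt Q , (x , pt-¬affine Q) , toInf-pt Q)
      (λ {P} {Q} (_ , ¬a) (_ , ¬b) eq → trans (sym (pt-toInf P ¬a)) (trans (cong pt eq) (pt-toInf Q ¬b))) hI , eq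
    where
    Affine : Point → Set
    Affine P = ∃[ z ] P ≡ aff (proj₁ z) (proj₂ z)
    coords : Point → Carrier × Carrier
    coords (aff x y) = x , y
    coords _ = 0# , 0#
    toInf : Point → Inf
    toInf (infSl m) = S m
    toInf _ = V
    toInf-pt : ∀ Q → toInf (pt Q) ≡ Q
    toInf-pt V = refl
    toInf-pt (S _) = refl
    pt-toInf : ∀ P → ¬ Affine P → pt (toInf P) ≡ P
    pt-toInf (aff x y) ¬a = contradiction ((x , y) , refl) ¬a
    pt-toInf (infSl _) _ = refl
    pt-toInf infV _ = refl
    toInf-∈ : ∀ P → X P → ¬ Affine P → X (pt (toInf P))
    toInf-∈ P x ¬a = subst X (sym (pt-toInf P ¬a)) x
    pt-¬affine : ∀ Q → ¬ Affine (pt Q)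
    pt-¬affine V ()
    pt-¬affine (S _) ()

  onLine-image : ∀ {U : PointSet} α → InAut U α → ∀ L {n} → HasSize (OnLine U L) n → HasSize (OnLine U (Inverse.to (Collineation.ln α) L)) n
  onLine-image {U} α a L = move-size {U} α (λ {P} (u , i) → to (a P) u , to (Collineation.inc α P L) i)
    (λ {P} (u , i) → from (a _) (subst U (sym (Inverse.strictlyInverseˡ (Collineation.pt α) P)) u) ,
      from (Collineation.inc α _ L) (subst (_I Inverse.to (Collineation.ln α) L) (sym (Inverse.strictlyInverseˡ (Collineation.pt α) P)) i))

  translationᶜ : Carrier → Carrier → Collineation
  translationᶜ u v = collineation (translation u v)

  module OfUnital (U : PointSet) (unital : Unital U) where

    U? : Decidable U
    U? = size-dec _≟ᴾ_ (proj₁ unital)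

    Affine : Carrier × Carrier → Set
    Affine (x , y) = U (aff x y)

    affine-count inf-count : ℕ
    affine-count = proj₁ (points-split (proj₁ unital))
    inf-count = proj₁ (proj₂ (points-split (proj₁ unital)))

    size-affine : HasSize Affine affine-count
    size-affine = proj₁ (proj₂ (proj₂ (points-split (proj₁ unital))))

    size-inf : HasSize (U ∘ pt) inf-count
    size-inf = proj₁ (proj₂ (proj₂ (proj₂ (points-split (proj₁ unital)))))

    total-count : affine-count ℕ.+ inf-count ≡ q ℕ.^ 3 ℕ.+ 1
    total-count = proj₂ (proj₂ (proj₂ (proj₂ (points-split (proj₁ unital)))))

    linf-count : ∀ {n} → HasSize (OnLine U linf) n → inf-count ≡ n
    linf-count h = let a , b , ha , hb , a+b≡n = points-split h in
      trans (size-≡ size-inf (size-resp proj₁ (λ {Q} u → u , Inc⇒I {pt Q} {linf} (inf∈linf Q)) hb))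
        (trans (cong (ℕ._+ b) (size-≡ (size-∅ λ {z} (_ , i) → I⇒Inc {aff (proj₁ z) (proj₂ z)} {linf} i) ha)) a+b≡n)

    ¬both : ∀ L → Tangent U L → Secant U L → ⊥
    ¬both L t s = ℕP.<⇒≢ (ℕP.<-trans (ℕ.s≤s ℕ.z≤n) 1<q) (ℕP.suc-injective (size-≡ t s))

    tangent? : Decidable (Tangent U)
    tangent? L with proj₂ unital L
    ... | inj₁ t = yes t
    ... | inj₂ s = no λ t → ¬both L t s

    ¬tangent⇒secant : ∀ {L} → ¬ Tangent U L → Secant U L
    ¬tangent⇒secant {L} ¬t with proj₂ unital L
    ... | inj₁ t = contradiction t ¬t
    ... | inj₂ s = s

    Fibre : Inf → Carrier → Carrier × Carrier → Set
    Fibre P t (x , y) = Affine (x , y) × level P x y ≡ t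

    line-fibre : ∀ P t {n} → HasSize (OnLine U (ℓ P t)) n → ∀ {κ} → HasSize (λ Q → U (pt Q) × Q ≡ P) κ →
                 ∃[ a ] (HasSize (Fibre P t) a × a ℕ.+ κ ≡ n)
    line-fibre P t h hκ = let a , b , ha , hb , eq = points-split h in a ,
      size-resp (λ {z} (u , i) → u , aff∈ℓ⇒ P (I⇒Inc {aff (proj₁ z) (proj₂ z)} {ℓ P t} i))
                (λ {z} (u , l) → u , Inc⇒I {aff (proj₁ z) (proj₂ z)} {ℓ P t} (aff∈ℓ⇐ P l)) ha ,
      trans (cong (a ℕ.+_) (size-≡ hκ (size-resp (λ {Q} (u , i) → u , inf∈ℓ P (I⇒Inc {pt Q} {ℓ P t} i))
                                                 (λ { (u , refl) → u , Inc⇒I {pt P} {ℓ P t} (pt∈ℓ P) }) hb))) eq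

    Tangents : Inf → Carrier → Set
    Tangents P t = Tangent U (ℓ P t)

    -- The number `κ` is 1 or 0 according to whether P lies in U. Deleting P from a tangent leaves
    -- `k` = 1 - κ points of U, and deleting it from a secant leaves q + 1 - κ = k + q.
    module _ (P : Inf) {κ k : ℕ} (hκ : HasSize (λ Q → U (pt Q) × Q ≡ P) κ) (k+κ≡1 : k ℕ.+ κ ≡ 1) where

      tangent-fibre : ∀ {t} → Tangents P t → HasSize (Fibre P t) k
      tangent-fibre {t} tan = let a , ha , eq = line-fibre P t tan hκ in subst (HasSize _) (ℕP.+-cancelʳ-≡ κ a k (trans eq (sym k+κ≡1))) ha

      secant-fibre : ∀ {t} → Secant U (ℓ P t) → HasSize (Fibre P t) (k ℕ.+ q)
      secant-fibre {t} sec = let a , ha , eq = line-fibre P t sec hκ in subst (HasSize _) (ℕP.+-cancelʳ-≡ κ a (k ℕ.+ q) (trans eq (trans (cong (ℕ._+ q) (sym k+κ≡1)) (rearrange k κ q)))) ha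
        where
        rearrange : ∀ k κ q → k ℕ.+ κ ℕ.+ q ≡ k ℕ.+ q ℕ.+ κ
        rearrange = solve-∀

      -- Every affine point lies on exactly one affine line through P, namely that of its level. So
      -- the affine points of U are counted as fibres over the tangents and over the secants, and
      -- `tangent-arithmetic` solves for the number of tangents.
      tangents-count : ∀ {ε} → inf-count ≡ 1 ℕ.+ q ℕ.* ε → HasSize (Tangents P) (k ℕ.* q ℕ.+ ε)
      tangents-count inf≡ =
        let a , b , ha , hb , a+b≡ = size-split (λ t → tangent? (ℓ P t)) size-carrier
            N₁ , N₂ , h₁ , h₂ , N₁+N₂≡ = size-split (λ z → tangent? (ℓ P (lev z))) size-affine
            hT = size-resp proj₂ (tt ,_) ha
        in subst (HasSize (Tangents P)) (tangent-arithmetic q (ℕP.<-trans (ℕ.s≤s ℕ.z≤n) 1<q) total-count inf≡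
             (trans (sym N₁+N₂≡) (cong₂ ℕ._+_ (on-tangents h₁ hT) (on-secants h₂ (size-resp proj₂ (tt ,_) hb)))) (trans a+b≡ |F|≡q²)) hT
        where
        lev : Carrier × Carrier → Carrier
        lev (x , y) = level P x y
        on-tangents : ∀ {N a} → HasSize (λ z → Affine z × Tangents P (lev z)) N → HasSize (Tangents P) a → N ≡ a ℕ.* k
        on-tangents = size-fibres lev k proj₂
          (λ tan → size-resp (λ { (u , refl) → (u , tan) , refl }) (λ ((u , _) , l) → u , l) (tangent-fibre tan))
        on-secants : ∀ {N b} → HasSize (λ z → Affine z × ¬ Tangents P (lev z)) N → HasSize (¬_ ∘ Tangents P) b → N ≡ b ℕ.* (k ℕ.+ q)
        on-secants = size-fibres lev (k ℕ.+ q) proj₂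
          (λ {t} ¬tan → size-resp (λ { (u , refl) → (u , ¬tan) , refl }) (λ ((u , _) , l) → u , l) (secant-fibre (¬tangent⇒secant {ℓ P t} ¬tan)))

    outside : ∀ P → ¬ U (pt P) → HasSize (λ Q → U (pt Q) × Q ≡ P) 0
    outside P ¬u = size-∅ λ { (u , refl) → ¬u u }

    inside : ∀ P → U (pt P) → HasSize (λ Q → U (pt Q) × Q ≡ P) 1
    inside P u = size-resp (λ { refl → u , refl }) proj₂ (size-singleton P)

    tangents-shift : ∀ {u v} → InAut U (translationᶜ u v) → ∀ P {t} → Tangents P t → Tangents P (t + level P u v)
    tangents-shift {u} {v} a P {t} tan = subst (Tangent U) (transLn-ℓ P u v t) (onLine-image {U} (translationᶜ u v) a (ℓ P t) tan)

    two≤ : Secant U linf → 2 ℕ.≤ inf-count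
    two≤ s = subst (2 ℕ.≤_) (sym (linf-count s)) (ℕP.<-trans 1<q (ℕP.n<1+n q))

    another : Secant U linf → ∀ P → ∃[ Q ] (U (pt Q) × Q ≢ P)
    another s P = size-other size-inf (two≤ s) P _≟∞_

    unique-tangent : Secant U linf → ∀ {Q} → U (pt Q) → HasSize (Tangents Q) 1
    unique-tangent s {Q} uQ = tangents-count Q {k = 0} (inside Q uQ) refl {ε = 1} (trans (linf-count s) (cong suc (sym (ℕP.*-identityʳ q))))

    module _ {u v : Carrier} (a : InAut U (translationᶜ u v)) (nontrivial : ¬ (u ≡ 0# × v ≡ 0#)) where

      centre∈U : ∀ P → level P u v ≡ 0# → ∀ {ε} → inf-count ≡ 1 ℕ.+ q ℕ.* ε → U (pt P)
      centre∈U P l≡0 {ε} inf≡ = decidable-stable (U? (pt P)) λ u∉ →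
        let t , tan = size-witness (tangents-count P {k = 1} (outside P u∉) refl inf≡)
                        (ℕP.m≤n⇒m≤n+o ε (ℕP.m≤n⇒m≤n+o 0 (ℕP.<-trans (ℕ.s≤s ℕ.z≤n) 1<q)))
            h = tangent-fibre P {k = 1} (outside P u∉) refl tan
            (x , y) , w , l = size-witness h (ℕ.s≤s ℕ.z≤n)
            fixed = size-1-≡ h {x + u , y + v} {x , y}
                      (to (a (aff x y)) w , trans (level-+ P x y u v) (trans (cong₂ _+_ l l≡0) (+-identityʳ t))) (w , l)
        in nontrivial (x+y≡x⇒y≡0 (cong proj₁ fixed) , x+y≡x⇒y≡0 (cong proj₂ fixed))

      level-fixed : ∀ {Q} → HasSize (Tangents Q) 1 → level Q u v ≡ 0#
      level-fixed {Q} count = let t , tan = size-witness count (ℕ.s≤s ℕ.z≤n) in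
        x+y≡x⇒y≡0 (size-1-≡ count {t + level Q u v} {t} (tangents-shift a Q {t} tan) tan)

      linf-tangent : Tangent U linf
      linf-tangent = [ id , (λ s →
        let P , lP = centre u v
            Q , uQ , Q≢P = another s P
        in contradiction (level-0-unique P Q (Q≢P ∘ sym) lP (level-fixed {Q} (unique-tangent s {Q} uQ))) nontrivial) ]′ (proj₂ unital linf)

  -- The subgroup of translations

  _≟ᴷ_ : DecidableEquality Kind
  φK ≟ᴷ φK = yes refl
  φK ≟ᴷ γK = no λ ()
  γK ≟ᴷ φK = no λ ()
  γK ≟ᴷ γK = yes refl

  lpar-injective : ∀ {k c d u v k′ c′ d′ u′ v′} → lpar k c d u v ≡ lpar k′ c′ d′ u′ v′ →
                   k ≡ k′ × c ≡ c′ × d ≡ d′ × u ≡ u′ × v ≡ v′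
  lpar-injective refl = refl , refl , refl , refl , refl

  _≟ᴸ_ : DecidableEquality LPar
  lpar k c d u v ≟ᴸ lpar k′ c′ d′ u′ v′ = map′ (λ { (refl , refl , refl , refl , refl) → refl }) lpar-injective
    ((k ≟ᴷ k′) ×-dec ((c ≟ c′) ×-dec ((d ≟ d′) ×-dec ((u ≟ u′) ×-dec (v ≟ v′)))))

  -- The canonical representative of a coset modulo translations. The quotient by the translations
  -- is thus realised inside `LPar`, with `linear-part (π ∘ᴸ ρ)` as product.
  linear-part : LPar → LPar
  linear-part (lpar k c d _ _) = lpar k c d 0# 0#

  linear-part-∘ : ∀ π ρ → linear-part (linear-part π ∘ᴸ linear-part ρ) ≡ linear-part (π ∘ᴸ ρ)
  linear-part-∘ (lpar φK _ _ _ _) (lpar _ _ _ _ _) = refl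
  linear-part-∘ (lpar γK _ _ _ _) (lpar φK _ _ _ _) = refl
  linear-part-∘ (lpar γK _ _ _ _) (lpar γK _ _ _ _) = refl

  linear-part-assoc : ∀ π ρ σ → linear-part ((π ∘ᴸ ρ) ∘ᴸ σ) ≡ linear-part (π ∘ᴸ (ρ ∘ᴸ σ))
  linear-part-assoc (lpar φK _ _ _ _) (lpar φK _ _ _ _) (lpar _ _ _ _ _) =
    sym (cong₂ (λ c d → lpar _ c d 0# 0#) (⋆-assoc _ _ _) (⋆-assoc _ _ _))
  linear-part-assoc (lpar φK _ _ _ _) (lpar γK _ _ _ _) (lpar φK _ _ _ _) =
    sym (cong₂ (λ c d → lpar _ c d 0# 0#) (⋆-assoc _ _ _) (⋆-assoc _ _ _))
  linear-part-assoc (lpar φK _ _ _ _) (lpar γK _ _ _ _) (lpar γK _ _ _ _) =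
    sym (cong₂ (λ c d → lpar _ c d 0# 0#) (⋆-assoc _ _ _) (⋆-assoc _ _ _))
  linear-part-assoc (lpar γK _ _ _ _) (lpar φK _ _ _ _) (lpar φK _ _ _ _) =
    sym (cong₂ (λ c d → lpar _ c d 0# 0#) (⋆-assoc _ _ _) (⋆-assoc _ _ _))
  linear-part-assoc (lpar γK _ _ _ _) (lpar φK _ _ _ _) (lpar γK _ _ _ _) =
    sym (cong₂ (λ c d → lpar _ c d 0# 0#) (⋆-assoc _ _ _) (⋆-assoc _ _ _))
  linear-part-assoc (lpar γK _ _ _ _) (lpar γK _ _ _ _) (lpar φK _ _ _ _) =
    sym (cong₂ (λ c d → lpar _ c d 0# 0#) (⋆-assoc _ _ _) (⋆-assoc _ _ _))
  linear-part-assoc (lpar γK _ _ _ _) (lpar γK _ _ _ _) (lpar γK _ _ _ _) =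
    sym (cong₂ (λ c d → lpar _ c d 0# 0#) (⋆-assoc _ _ _) (⋆-assoc _ _ _))

  linear-part-cancel : ∀ π ρ → Nonzero π → linear-part ((π ⁻¹ᴸ) ∘ᴸ (π ∘ᴸ ρ)) ≡ linear-part ρ
  linear-part-cancel (lpar φK _ _ _ _) (lpar _ _ _ _ _) (c≢0 , d≢0) =
    cong₂ (λ c d → lpar _ c d 0# 0#) (⋆-ninv-cancelʳ _ c≢0) (⋆-ninv-cancelʳ _ d≢0)
  linear-part-cancel (lpar γK _ _ _ _) (lpar φK _ _ _ _) (c≢0 , d≢0) =
    cong₂ (λ c d → lpar _ c d 0# 0#) (⋆-ninv-cancelʳ _ d≢0) (⋆-ninv-cancelʳ _ c≢0)
  linear-part-cancel (lpar γK _ _ _ _) (lpar γK _ _ _ _) (c≢0 , d≢0) =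
    cong₂ (λ c d → lpar _ c d 0# 0#) (⋆-ninv-cancelʳ _ d≢0) (⋆-ninv-cancelʳ _ c≢0)

  linear-part-free : ∀ π π′ ρ → Nonzero ρ → linear-part (π ∘ᴸ ρ) ≡ linear-part (π′ ∘ᴸ ρ) → linear-part π ≡ linear-part π′
  linear-part-free (lpar φK _ _ _ _) (lpar φK _ _ _ _) (lpar _ _ _ _ _) (c , d) eq with _ , ec , ed , _ ← lpar-injective eq =
    cong₂ (λ c d → lpar _ c d 0# 0#) (⋆-cancelˡ c ec) (⋆-cancelˡ d ed)
  linear-part-free (lpar γK _ _ _ _) (lpar γK _ _ _ _) (lpar φK _ _ _ _) (c , d) eq with _ , ec , ed , _ ← lpar-injective eq =
    cong₂ (λ c d → lpar _ c d 0# 0#) (⋆-cancelˡ d ec) (⋆-cancelˡ c ed)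
  linear-part-free (lpar γK _ _ _ _) (lpar γK _ _ _ _) (lpar γK _ _ _ _) (c , d) eq with _ , ec , ed , _ ← lpar-injective eq =
    cong₂ (λ c d → lpar _ c d 0# 0#) (⋆-cancelˡ d ec) (⋆-cancelˡ c ed)
  linear-part-free (lpar φK _ _ _ _) (lpar γK _ _ _ _) (lpar φK _ _ _ _) _ ()
  linear-part-free (lpar φK _ _ _ _) (lpar γK _ _ _ _) (lpar γK _ _ _ _) _ ()
  linear-part-free (lpar γK _ _ _ _) (lpar φK _ _ _ _) (lpar φK _ _ _ _) _ ()
  linear-part-free (lpar γK _ _ _ _) (lpar φK _ _ _ _) (lpar γK _ _ _ _) _ ()

  IsLinear : LPar → Set
  IsLinear π = Nonzero π × linear-part π ≡ π

  -- The number `h + h` is q² - 1, and the two summands count the kinds `φK` and `γK`.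
  size-linear : HasSize IsLinear ((h ℕ.+ h) ℕ.* (h ℕ.+ h) ℕ.+ (h ℕ.+ h) ℕ.* (h ℕ.+ h))
  size-linear = size-resp (λ { (inj₁ (_ , nz , refl)) → nz , refl ; (inj₂ (_ , nz , refl)) → nz , refl })
    (λ { {lpar φK c d _ _} (nz , refl) → inj₁ ((c , d) , nz , refl) ; {lpar γK c d _ _} (nz , refl) → inj₂ ((c , d) , nz , refl) })
    (size-⊎ (λ { (_ , _ , refl) (_ , _ , ()) })
      (size-image-inj (λ (c , d) → φ c d 0# 0#) (λ { _ _ refl → refl }) (size-× size-F* size-F*))
      (size-image-inj (λ (c , d) → γ c d 0# 0#) (λ { _ _ refl → refl }) (size-× size-F* size-F*)))

  shift : Carrier → Carrier → LPar
  shift u v = φ 1# 1# u v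

  -- Two elements with the same linear part differ by a translation. This identifies the fibres of
  -- `linear-part` as cosets and also shows that a conjugate of a translation is a translation.
  ∘-⁻¹-shift : ∀ {k c d u v u₀ v₀} → c ≢ 0# → d ≢ 0# → lpar k c d u v ∘ᴸ (lpar k c d u₀ v₀ ⁻¹ᴸ) ≡ shift (- u₀ + u) (- v₀ + v)
  ∘-⁻¹-shift {k} {c} {d} {u} {v} {u₀} {v₀} c≢0 d≢0 = by-kind k
    where
    undo : ∀ {c u₀} u → c ≢ 0# → (- (u₀ ⋆ ninv c)) ⋆ c + u ≡ - u₀ + u
    undo {c} {u₀} u c≢0 = cong (_+ u) (trans (-‿⋆ _ c) (cong -_ (ninv-⋆-cancelʳ u₀ c≢0)))
    congφ : ∀ {c d u v c′ d′ u′ v′} → c ≡ c′ → d ≡ d′ → u ≡ u′ → v ≡ v′ → φ c d u v ≡ φ c′ d′ u′ v′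
    congφ refl refl refl refl = refl
    by-kind : ∀ k → lpar k c d u v ∘ᴸ (lpar k c d u₀ v₀ ⁻¹ᴸ) ≡ shift (- u₀ + u) (- v₀ + v)
    by-kind φK = congφ (⋆-ninvˡ c≢0) (⋆-ninvˡ d≢0) (undo u c≢0) (undo v d≢0)
    by-kind γK = congφ (⋆-ninvˡ c≢0) (⋆-ninvˡ d≢0) (undo u c≢0) (undo v d≢0)

  shift-∘ : ∀ k c d u v u₀ v₀ → shift u v ∘ᴸ lpar k c d u₀ v₀ ≡ lpar k c d (u₀ + u) (v₀ + v)
  shift-∘ k c d u v u₀ v₀ rewrite ⋆-identityʳ c | ⋆-identityʳ d | ⋆-identityʳ u₀ | ⋆-identityʳ v₀ = refl

  TPar : PointSet → Carrier × Carrier → Set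
  TPar U (u , v) = GPar U (shift u v)

  translation-acts : ∀ u v → ActsAs (translationᶜ u v) (shift u v)
  translation-acts u v x y = cong₂ aff (cong (_+ u) (sym (⋆-identityʳ x))) (cong (_+ v) (sym (⋆-identityʳ y)))

  TPar⇒inAut : ∀ {U u v} → TPar U (u , v) → InAut U (translationᶜ u v)
  TPar⇒inAut {U} {u} {v} g = inAut-GPar {U} {shift u v} {translationᶜ u v} g (translation-acts u v)

  shift-nonzero : ∀ u v → Nonzero (shift u v)
  shift-nonzero u v = 1≢0 , 1≢0

  TPar-+ : ∀ {U u v u′ v′} → TPar U (u , v) → TPar U (u′ , v′) → TPar U (u + u′ , v + v′)
  TPar-+ {U} {u} {v} {u′} {v′} g g′ = subst (GPar U) (shift-∘ φK 1# 1# u′ v′ u v) (GPar-∘ {U} {shift u′ v′} {shift u v} g′ g)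

  TPar-0 : ∀ {U} → TPar U (0# , 0#)
  TPar-0 {U} = shift-nonzero 0# 0# , translationᶜ 0# 0# , translation-acts 0# 0# ,
    λ P → mk⇔ (subst U (sym (fixed P))) (subst U (fixed P))
    where
    fixed : ∀ P → transPt 0# 0# P ≡ P
    fixed (aff x y) = cong₂ aff (+-identityʳ x) (+-identityʳ y)
    fixed (infSl _) = refl
    fixed infV = refl

  TPar-neg : ∀ {U u v} → TPar U (u , v) → TPar U (- u , - v)
  TPar-neg {U} {u} {v} g = subst (GPar U) (trans (∘-⁻¹-shift {φK} {1#} {1#} {0#} {0#} {u} {v} 1≢0 1≢0) (cong₂ shift (+-identityʳ _) (+-identityʳ _)))
    (GPar-∘ {U} {shift 0# 0#} {shift u v ⁻¹ᴸ} (TPar-0 {U}) (GPar-⁻¹ {U} {shift u v} g))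

  module _ {U : PointSet} {n : ℕ} (hG : HasSize (GPar U) n) where

    GPar? : Decidable (GPar U)
    GPar? = size-dec _≟ᴸ_ hG

    translations-size : ∃[ t ] HasSize (TPar U) t
    translations-size = let t , hT = size-filter (λ π → π ≟ᴸ shift (LPar.u π) (LPar.v π)) hG in
      t , size-bij (λ π → LPar.u π , LPar.v π) (λ (g , eq) → subst (GPar U) eq g)
                   (λ {z} g → shift (proj₁ z) (proj₂ z) , (g , refl) , refl)
                   (λ (_ , eq) (_ , eq′) uv → trans eq (trans (cong₂ shift (cong proj₁ uv) (cong proj₂ uv)) (sym eq′))) hT

    module _ {t : ℕ} (hT : HasSize (TPar U) t) where

      K : LPar → Set
      K = Image (GPar U) linear-part

      k : ℕ
      k = proj₁ (size-image _≟ᴸ_ linear-part hG)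

      hK : HasSize K k
      hK = proj₂ (size-image _≟ᴸ_ linear-part hG)

      -- The fibre is the coset of `π₀` under the `t` translations in G. Hence the order of G is `k`
      -- times `t`, where `k` counts the linear parts.
      coset : ∀ {ρ} → K ρ → HasSize (λ π → GPar U π × linear-part π ≡ ρ) t
      coset (lpar k c d u₀ v₀ , g₀ , refl) = size-bij (λ (u , v) → shift u v ∘ᴸ π₀)
        (λ {z} g → GPar-∘ {U} {shift (proj₁ z) (proj₂ z)} {π₀} g g₀ , cong linear-part (shift-∘ k c d (proj₁ z) (proj₂ z) u₀ v₀))
        (λ { {lpar k c d u v} (g , refl) → (- u₀ + u , - v₀ + v) ,
             subst (GPar U) (∘-⁻¹-shift (proj₁ (proj₁ g)) (proj₂ (proj₁ g))) (GPar-∘ {U} {lpar k c d u v} {π₀ ⁻¹ᴸ} g (GPar-⁻¹ {U} {π₀} g₀)) ,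
             trans (shift-∘ k c d (- u₀ + u) (- v₀ + v) u₀ v₀) (cong₂ (lpar k c d) (back u₀ u) (back v₀ v)) })
        (λ {z} {z′} _ _ eq → let _ , _ , _ , eu , ev = lpar-injective (trans (sym (shift-∘ k c d (proj₁ z) (proj₂ z) u₀ v₀))
                                                         (trans eq (shift-∘ k c d (proj₁ z′) (proj₂ z′) u₀ v₀)))
                    in cong₂ _,_ (+-cancelˡ u₀ _ _ eu) (+-cancelˡ v₀ _ _ ev)) hT
        where
        π₀ = lpar k c d u₀ v₀
        back : ∀ a b → a + (- a + b) ≡ b
        back a b = trans (sym (+-assoc _ _ _)) (trans (cong (_+ b) (-‿inverseʳ a)) (+-identityˡ b))

      |G|≡k*t : n ≡ k ℕ.* t
      |G|≡k*t = size-fibres linear-part t (λ {π} g → π , g , refl) coset hG hK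

      open FreeAction _≟ᴸ_ hK (λ π ρ → linear-part (π ∘ᴸ ρ)) public

      -- The linear parts of G act by left multiplication on the full group of linear parts, freely
      -- because of cancellation. Counting orbits is then Lagrange's theorem: `k` divides 2 (q² -
      -- 1)².
      linear-action : IsFreeOn IsLinear
      linear-action = record
        { closed = λ { {_} {a} (π , (nz , _) , refl) (nz′ , _) → linear-nonzero (linear-part π ∘ᴸ a) (∘ᴸ-nonzero (linear-part π) a (linear-nonzero π nz) nz′) , idem (linear-part π ∘ᴸ a) }
        ; free = λ { {_} {_} {a} (π , _ , refl) (π′ , _ , refl) (nz , _) eq → trans (sym (idem π)) (trans (linear-part-free (linear-part π) (linear-part π′) a nz eq) (idem π′)) }
        ; unit = linear-part (shift 0# 0#) , (shift 0# 0# , TPar-0 {U} , refl) ,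
            λ { {lpar k c d u v} (_ , eq) → trans (cong linear-part (shift-∘ k c d 0# 0# u v)) eq }
        ; inverse = λ { (π , g , refl) → linear-part (π ⁻¹ᴸ) , (π ⁻¹ᴸ , GPar-⁻¹ {U} {π} g , refl) ,
            λ {a} (_ , eq) → trans (step (π ⁻¹ᴸ) (linear-part π) a) (trans (cancel π a (proj₁ g)) eq) }
        ; compose = λ { (π , g , refl) (ρ , g′ , refl) → linear-part (ρ ∘ᴸ π) , (ρ ∘ᴸ π , GPar-∘ {U} {ρ} {π} g′ g , refl) ,
            λ {a} _ → trans (trans (sym (linear-part-∘ (linear-part (ρ ∘ᴸ π)) a)) (trans (cong (λ x → linear-part (x ∘ᴸ linear-part a)) (idem (ρ ∘ᴸ π)))
                        (trans (linear-part-∘ (ρ ∘ᴸ π) a) (linear-part-assoc ρ π a))))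
                      (sym (trans (step ρ (linear-part π) a) (trans (sym (linear-part-∘ ρ (linear-part π ∘ᴸ a)))
                        (trans (cong (λ x → linear-part (linear-part ρ ∘ᴸ x)) (inner π a)) (linear-part-∘ ρ (π ∘ᴸ a)))))) }
        }
        where
        idem : ∀ π → linear-part (linear-part π) ≡ linear-part π
        idem (lpar _ _ _ _ _) = refl
        linear-nonzero : ∀ π → Nonzero π → Nonzero (linear-part π)
        linear-nonzero (lpar _ _ _ _ _) nz = nz
        inner : ∀ π a → linear-part (linear-part π ∘ᴸ a) ≡ linear-part (π ∘ᴸ a)
        inner π a = trans (sym (linear-part-∘ (linear-part π) a))
          (trans (cong (λ x → linear-part (x ∘ᴸ linear-part a)) (idem π)) (linear-part-∘ π a))
        step : ∀ ρ π a → linear-part (linear-part ρ ∘ᴸ linear-part (π ∘ᴸ a)) ≡ linear-part (ρ ∘ᴸ (π ∘ᴸ a))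
        step ρ π a = linear-part-∘ ρ (π ∘ᴸ a)
        cancel : ∀ π a → Nonzero π → linear-part ((π ⁻¹ᴸ) ∘ᴸ (linear-part π ∘ᴸ a)) ≡ linear-part a
        cancel π a nz = trans (sym (linear-part-∘ (π ⁻¹ᴸ) _)) (trans (cong (λ x → linear-part (linear-part (π ⁻¹ᴸ) ∘ᴸ x)) (inner π a))
          (trans (linear-part-∘ (π ⁻¹ᴸ) (π ∘ᴸ a)) (linear-part-cancel π a nz)))

      p∤k : ¬ p ∣ k
      p∤k p∣k = [ odd-prime∤2 p-prime p-odd , p∤x ∘ [ id , id ]′ ∘ euclidsLemma x x p-prime ]′
                  (euclidsLemma 2 (x ℕ.* x) p-prime (subst (p ∣_) (double (x ℕ.* x)) (∣-trans p∣k k∣2xx)))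
        where
        x : ℕ
        x = h ℕ.+ h
        k∣2xx : k ∣ x ℕ.* x ℕ.+ x ℕ.* x
        k∣2xx = orbits-∣ linear-action size-linear
        double : ∀ a → a ℕ.+ a ≡ 2 ℕ.* a
        double = solve-∀
        p∣q : p ∣ q
        p∣q = subst (λ e → p ∣ p ℕ.^ e) (ℕP.m+[n∸m]≡n 1≤e) (m∣m*n (p ℕ.^ (e ℕ.∸ 1)))
        p∤x : ¬ p ∣ x
        p∤x p∣x = ℕ.nonTrivial⇒≢1 {{prime⇒nonTrivial p-prime}} (∣1⇒≡1
          (∣m+n∣m⇒∣n (subst (p ∣_) (trans q²≡1+2h (ℕP.+-comm 1 x)) (∣m⇒∣m*n q p∣q)) p∣x))

      q∣translations : q ∣ n → q ∣ t
      q∣translations q∣n = ^∣*⇒^∣ p-prime e p∤k (subst (q ∣_) |G|≡k*t q∣n)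

      q≤translations : q ∣ n → q ℕ.≤ t
      q≤translations q∣n = ∣⇒≤ {{ℕ.>-nonZero (size-pos hT (TPar-0 {U}))}} (q∣translations q∣n)

  -- Normalised unitals

  _≟²_ : DecidableEquality (Carrier × Carrier)
  _≟²_ = ≡-dec _≟_ _≟_

  0<q : 0 ℕ.< q
  0<q = ℕP.<-trans (ℕ.s≤s ℕ.z≤n) 1<q

  module WithTranslations (U : PointSet) (unital : Unital U) {n : ℕ} (hG : HasSize (GPar U) n) (q∣n : q ∣ n) where
    open OfUnital U unital public

    t : ℕ
    t = proj₁ (translations-size {U} hG)

    hT : HasSize (TPar U) t
    hT = proj₂ (translations-size {U} hG)

    q≤t : q ℕ.≤ t
    q≤t = q≤translations {U} hG hT q∣n

    parabolic : Tangent U linf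
    parabolic = let (u , v) , τ , ≢0 = size-other hT (ℕP.≤-trans 1<q q≤t) (0# , 0#) _≟²_
                in linf-tangent {u} {v} (TPar⇒inAut {U} {u} {v} τ) λ (u≡0 , v≡0) → ≢0 (cong₂ _,_ u≡0 v≡0)

    inf-count≡1 : inf-count ≡ 1 ℕ.+ q ℕ.* 0
    inf-count≡1 = trans (linf-count parabolic) (cong suc (sym (ℕP.*-zeroʳ q)))

    inf-unique : ∀ {P Q} → U (pt P) → U (pt Q) → P ≡ Q
    inf-unique {P} {Q} uP uQ = size-1-≡ (subst (HasSize (U ∘ pt)) (linf-count parabolic) size-inf) {P} {Q} uP uQ

    centre∈ : ∀ {u v} → TPar U (u , v) → ¬ (u ≡ 0# × v ≡ 0#) → ∀ P → level P u v ≡ 0# → U (pt P)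
    centre∈ {u} {v} τ ≢0 P l≡0 = centre∈U {u} {v} (TPar⇒inAut {U} {u} {v} τ) ≢0 P l≡0 {0} inf-count≡1

    outside-tangents : ∀ P → ¬ U (pt P) → HasSize (Tangents P) q
    outside-tangents P u∉ = subst (HasSize (Tangents P)) (trans (ℕP.+-identityʳ _) (ℕP.*-identityˡ q))
      (tangents-count P {k = 1} (outside P u∉) refl {ε = 0} inf-count≡1)

  module Vertical (U : PointSet) (unital : Unital U) (V∈U : U infV) {n : ℕ} (hG : HasSize (GPar U) n) (q∣n : q ∣ n) where
    open WithTranslations U unital hG q∣n public

    -- A nontrivial translation has its centre in U, and `infV` is the only point of U at infinity.
    -- So the centre is `V`, whose level is the abscissa.
    vertical : ∀ {u v} → TPar U (u , v) → u ≡ 0#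
    vertical {u} {v} τ = decidable-stable (u ≟ 0#) λ u≢0 →
      let P , l≡0 = centre u v
      in u≢0 (subst (λ P → level P u v ≡ 0#) (inf-unique {P} {V} (centre∈ {u} {v} τ (u≢0 ∘ proj₁) P l≡0) V∈U) l≡0)

    -- W is read off from the group and not from the points of U, so it is an additive group before
    -- U is normalised. It coincides with the column x = 0 only after the origin has been moved into
    -- U.
    W : Carrier → Set
    W w = TPar U (0# , w)

    W⇒inAut : ∀ {w} → W w → InAut U (translationᶜ 0# w)
    W⇒inAut {w} = TPar⇒inAut {U} {0#} {w}

    W-0 : W 0#
    W-0 = TPar-0 {U}

    W-+ : ∀ {w w′} → W w → W w′ → W (w + w′)
    W-+ {w} {w′} a b = subst (λ z → TPar U (z , w + w′)) (+-identityʳ 0#) (TPar-+ {U} {0#} {w} {0#} {w′} a b)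

    W-neg : ∀ {w} → W w → W (- w)
    W-neg {w} a = subst (λ z → TPar U (z , - w)) -0#≈0# (TPar-neg {U} {0#} {w} a)

    W-translates : ∀ {w x y} → W w → U (aff x y) → U (aff x (y + w))
    W-translates {w} {x} {y} a u = subst (λ z → U (aff z (y + w))) (+-identityʳ x) (to (W⇒inAut {w} a (aff x y)) u)

    column : ∀ x → HasSize (Fibre V x) q
    column x = secant-fibre V {k = 0} (inside V V∈U) refl {x} (¬tangent⇒secant {ℓ V x}
      (size-empty (tangents-count V {k = 0} (inside V V∈U) refl {ε = 0} inf-count≡1) {x}))

    in-column : ∀ {x y} → U (aff x y) → ∀ {w} → W w → Fibre V x (x , y + w)
    in-column u {w} a = W-translates {w} a u , refl

    along-column : ∀ (x y : Carrier) {w w′} → (x , y + w) ≡ (x , y + w′) → w ≡ w′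
    along-column x y eq = +-cancelˡ y _ _ (cong proj₂ eq)

    size-W′ : HasSize W t
    size-W′ = size-bij proj₂ (λ {z} τ → subst (λ u → TPar U (u , proj₂ z)) (vertical {proj₁ z} {proj₂ z} τ) τ)
      (λ {w} a → (0# , w) , a , refl)
      (λ {z} {z′} τ τ′ → cong₂ _,_ (trans (vertical {proj₁ z} {proj₂ z} τ) (sym (vertical {proj₁ z′} {proj₂ z′} τ′)))) hT

    t≤q : ∀ {x y} → U (aff x y) → t ℕ.≤ q
    t≤q {x} {y} u = size-≤ {P = W} {Q = Fibre V x} _≟²_ (λ w → x , y + w) (λ {w} → in-column {x} {y} u {w}) (λ _ _ → along-column x y) size-W′ (column x)

    -- The lower bound comes from the divisibility hypothesis, the upper bound from the free action
    -- on a column of q points.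
    t≡q : t ≡ q
    t≡q = let z , u , _ = size-witness (column 0#) 0<q in ℕP.≤-antisym (t≤q {proj₁ z} {proj₂ z} u) q≤t

    size-W : HasSize W q
    size-W = subst (HasSize W) t≡q size-W′

    -- The q translations act freely on the q points of the column, so by counting they reach all of
    -- them.
    column-coset : ∀ {x y y′} → U (aff x y) → U (aff x y′) → W (y′ + - y)
    column-coset {x} {y} {y′} u u′ =
      let w , a , eq = size-surj {P = W} {Q = Fibre V x} _≟²_ (λ w → x , y + w) (λ {w} → in-column {x} {y} u {w}) (λ _ _ → along-column x y) size-W (column x) {x , y′} (u′ , refl)
      in subst W (trans (sym (+-undoʳ w y)) (cong (_+ - y) (trans (+-comm w y) (cong proj₂ eq)))) a

    S0∉U : ¬ U (infSl 0#)
    S0∉U u = S≢V (inf-unique {S 0#} {V} u V∈U)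
      where
      S≢V : S 0# ≢ V
      S≢V ()

    level-S0 : ∀ x y → level (S 0#) x y ≡ y
    level-S0 x y = trans (cong (_+ y) (trans (cong (x ⋆_) -0#≈0#) (⋆-zeroʳ x))) (+-identityˡ y)

    tangency-point : ∃[ x ] ∃[ y ] (U (aff x y) × Tangents (S 0#) y)
    tangency-point =
      let s , tan = size-witness (outside-tangents (S 0#) S0∉U) 0<q
          (x , y) , u , l = size-witness (tangent-fibre (S 0#) {k = 1} (outside (S 0#) S0∉U) refl {s} tan) (ℕ.s≤s ℕ.z≤n)
      in x , y , u , subst (Tangents (S 0#)) (trans (sym l) (level-S0 x y)) tan

  InKernel⇒InFq : ∀ {W : Carrier → Set} → HasSize W q → W 0# → ∀ {l} → InKernel W l → InFq l
  InKernel⇒InFq {W} hW W0 {l} ker with l ≟ 0#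
  ... | yes refl = 0^q≡0
  ... | no l≢0 = trans (cong (l ^_) q≡1+r) (trans (cong (l *_) l^r≡1) (*-identityʳ l))
    where
    split : ∃[ a ] ∃[ r ] (HasSize (λ w → W w × w ≡ 0#) a × HasSize (λ w → W w × w ≢ 0#) r × a ℕ.+ r ≡ q)
    split = size-split (_≟ 0#) hW
    r : ℕ
    r = proj₁ (proj₂ split)
    hr : HasSize (λ w → W w × w ≢ 0#) r
    hr = proj₁ (proj₂ (proj₂ (proj₂ split)))
    q≡1+r : q ≡ suc r
    q≡1+r = sym (trans (cong (ℕ._+ r) (size-≡ (size-resp (λ { refl → W0 , refl }) proj₂ (size-singleton 0#)) (proj₁ (proj₂ (proj₂ split)))))
                       (proj₂ (proj₂ (proj₂ (proj₂ split)))))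
    l^r≡1 : l ^ r ≡ 1#
    l^r≡1 = x^|P|≡1 hr proj₂ l≢0 (λ {w} (a , w≢0) → ker w a , *-nonzero l≢0 w≢0)

  -- A nonsquare d would exchange the squares and the nonsquares of W ∖ {0}, and w ⋆ d ⋆ d = d^(q+1) w.
  stabiliser-square : ∀ {W : Carrier → Set} → HasSize W q → W 0# → ∀ {d} → d ≢ 0# → (∀ {w} → W w → W (w ⋆ d)) → IsSquare d
  stabiliser-square {W} hW W0 {d} d≢0 closed = decidable-stable (square? d) λ ¬sq →
    ¬sq (x^h≡1⇒square (trans (cong (d ^_) (cong (suc q ℕ.*_) (j≡s ¬sq))) (trans (sym (^-assoc d (suc q) s)) (power ¬sq))))
    where
    W* □W ■W : Carrier → Set
    W* w = W w × w ≢ 0#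
    □W w = W* w × IsSquare w
    ■W w = W* w × ¬ IsSquare w
    split : ∃[ a ] ∃[ r ] (HasSize (λ w → W w × w ≡ 0#) a × HasSize W* r × a ℕ.+ r ≡ q)
    split = size-split (_≟ 0#) hW
    r : ℕ
    r = proj₁ (proj₂ split)
    1+r≡q : suc r ≡ q
    1+r≡q = trans (cong (ℕ._+ r) (size-≡ (size-resp (λ { refl → W0 , refl }) proj₂ (size-singleton 0#)) (proj₁ (proj₂ (proj₂ split)))))
                  (proj₂ (proj₂ (proj₂ (proj₂ split))))
    halves : ∃[ s ] ∃[ s′ ] (HasSize □W s × HasSize ■W s′ × s ℕ.+ s′ ≡ r)
    halves = size-split square? (proj₁ (proj₂ (proj₂ (proj₂ split))))
    s s′ : ℕ
    s = proj₁ halves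
    s′ = proj₁ (proj₂ halves)
    h□ : HasSize □W s
    h□ = proj₁ (proj₂ (proj₂ halves))
    h■ : HasSize ■W s′
    h■ = proj₁ (proj₂ (proj₂ (proj₂ halves)))
    ⋆d-injective : ∀ {P : Carrier → Set} → InjectiveOn P (_⋆ d)
    ⋆d-injective _ _ = ⋆-cancelʳ d≢0
    module _ (¬sq : ¬ IsSquare d) where
      □→■ : ∀ {w} → □W w → ■W (w ⋆ d)
      □→■ {w} ((a , w≢0) , sq) = (closed a , ⋆-nonzero w≢0 d≢0) ,
        λ sq′ → ¬sq (square*⇒square (^-nonzero q w≢0) (^q-square sq) (subst IsSquare (⋆-■ w ¬sq) sq′))
      ■→□ : ∀ {w} → ■W w → □W (w ⋆ d)
      ■→□ {w} ((a , w≢0) , ¬w) = (closed a , ⋆-nonzero w≢0 d≢0) ,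
        subst IsSquare (sym (⋆-■ w ¬sq)) (nonsquare*nonsquare (¬w ∘ ^q-square⁻) ¬sq)
      s≡s′ : s ≡ s′
      s≡s′ = ℕP.≤-antisym (size-≤ {P = □W} {Q = ■W} _≟_ (_⋆ d) □→■ (⋆d-injective {□W}) h□ h■) (size-≤ {P = ■W} {Q = □W} _≟_ (_⋆ d) ■→□ (⋆d-injective {■W}) h■ h□)
      2s≡2j : s ℕ.+ s ≡ j ℕ.+ j
      2s≡2j = ℕP.suc-injective (trans (cong suc (trans (cong (s ℕ.+_) s≡s′) (proj₂ (proj₂ (proj₂ (proj₂ halves)))))) (trans 1+r≡q q≡1+2j))
      j≡s : j ≡ s
      j≡s = sym (ℕP.*-cancelˡ-≡ s j 2 (trans (cong (s ℕ.+_) (ℕP.+-identityʳ s)) (trans 2s≡2j (cong (j ℕ.+_) (sym (ℕP.+-identityʳ j))))))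
      ⋆d⋆d : ∀ w → w ⋆ d ⋆ d ≡ d ^ suc q * w
      ⋆d⋆d w = trans (⋆-■ _ ¬sq) (trans (cong (λ z → z ^ q * d) (⋆-■ w ¬sq)) (trans (cong (_* d) (trans (^-distrib-* (w ^ q) d q) (cong (_* d ^ q) (x^q²≡x w))))
        (solve 3 (λ a b c → (a ⊕ b) ⊕ c ⊜ (c ⊕ b) ⊕ a) refl w (d ^ q) d)))
        where open *-Solver
      -- Applying `_⋆ d` twice returns the squares of W without 0 to themselves, and it is
      -- multiplication by d^(q+1). Their number `s` is `j`, so the total exponent is `h`, and
      -- Euler's criterion would make `d` a square.
      power : (d ^ suc q) ^ s ≡ 1#
      power = x^|P|≡1 h□ (λ ((_ , w≢0) , _) → w≢0) (^-nonzero (suc q) d≢0) (λ {w} w∈ → subst □W (⋆d⋆d w) (■→□ (□→■ w∈)))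

  module Normalised (U : PointSet) (unital : Unital U) (V∈U : U infV) {n : ℕ} (hG : HasSize (GPar U) n) (q∣n : q ∣ n)
                    (O∈U : U (aff 0# 0#)) (tan₀ : Tangent U (sl 0# 0#)) where
    open Vertical U unital V∈U hG q∣n public

    sl0≡ℓ : ∀ s → sl 0# (- s) ≡ ℓ (S 0#) s
    sl0≡ℓ s = cong (λ z → sl z (- s)) (sym -0#≈0#)

    T : Carrier → Set
    T = Tangents (S 0#)

    size-T : HasSize T q
    size-T = outside-tangents (S 0#) S0∉U

    T-0 : T 0#
    T-0 = subst (Tangent U) (cong₂ sl (sym -0#≈0#) (sym -0#≈0#)) tan₀

    W⇒T : ∀ {w} → W w → T w
    W⇒T {w} a = subst T (trans (+-identityˡ _) (level-S0 0# w)) (tangents-shift {0#} {w} (W⇒inAut {w} a) (S 0#) {0#} T-0)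

    -- Translating the tangent y = 0 embeds W in the set of tangent levels. Both sets have q
    -- elements, so nothing is missed.
    T⇒W : ∀ {s} → T s → W s
    T⇒W {s} tan = let w , a , eq = size-surj {P = W} {Q = T} _≟_ id (λ {w} → W⇒T {w}) (λ _ _ eq → eq) size-W size-T {s} tan in subst W eq a

    W⇒U : ∀ {w} → W w → U (aff 0# w)
    W⇒U {w} a = subst (λ z → U (aff 0# z)) (+-identityˡ w) (W-translates {w} {0#} {0#} a O∈U)

    U⇒W : ∀ {w} → U (aff 0# w) → W w
    U⇒W {w} u = subst W (trans (cong (w +_) -0#≈0#) (+-identityʳ w)) (column-coset {0#} {0#} {w} O∈U u)

    aff∈ℓ₀ : ∀ x y → aff x y I ℓ (S 0#) y
    aff∈ℓ₀ x y = Inc⇒I {aff x y} {ℓ (S 0#) y} (aff∈ℓ⇐ (S 0#) (level-S0 x y))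

    tangency : ∀ {w} → W w → ∀ {P} → U P → P I ℓ (S 0#) w → P ≡ aff 0# w
    tangency {w} a {P} u i = size-1-≡ (W⇒T {w} a) {P} {aff 0# w} (u , i) (W⇒U {w} a , aff∈ℓ₀ 0# w)

    linear-inAut : ∀ {π} (g : GPar U π) → InAut U (linear π (proj₁ g))
    linear-inAut {π} g = inAut-GPar {U} {π} {linear π (proj₁ g)} g (linear-acts π (proj₁ g))

    -- The tangent y = 0 is mapped to y = v, which gives v in W. The origin is mapped to (u,v), a
    -- point of U on the tangent y = v, whose only point of U is (0,v); so u = 0.
    φ-fixes-0 : ∀ {c d u v} → GPar U (φ c d u v) → u ≡ 0# × W v
    φ-fixes-0 {c} {d} {u} {v} g = proj₁ (aff-injective (tangency {v} v∈W {aff u v} uv∈U (aff∈ℓ₀ u v))) , v∈W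
      where
      a : InAut U (linear (φ c d u v) (proj₁ g))
      a = linear-inAut {φ c d u v} g
      slope≡0 : ninv c ⋆ 0# ⋆ d ≡ 0#
      slope≡0 = trans (cong (_⋆ d) (⋆-zeroʳ _)) (⋆-zeroˡ d)
      offset : 0# ⋆ d + - (u ⋆ (ninv c ⋆ 0# ⋆ d) + v) ≡ - v
      offset = trans (cong₂ _+_ (⋆-zeroˡ d) (cong -_ (trans (cong (_+ v) (trans (cong (u ⋆_) slope≡0) (⋆-zeroʳ u))) (+-identityˡ v)))) (+-identityˡ _)
      v∈W : W v
      v∈W = T⇒W {v} (subst (Tangent U) (trans (cong₂ sl slope≡0 offset) (sl0≡ℓ v)) (onLine-image {U} (linear (φ c d u v) (proj₁ g)) a (sl 0# 0#) tan₀))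
      uv∈U : U (aff u v)
      uv∈U = subst U (cong₂ aff (trans (cong (_+ u) (⋆-zeroˡ c)) (+-identityˡ u)) (trans (cong (_+ v) (⋆-zeroˡ d)) (+-identityˡ v)))
               (to (a (aff 0# 0#)) O∈U)

    -- Such a collineation maps (0,1,0) to (1,0,0), and only the former lies in U.
    ¬γ : ∀ {c d u v} → ¬ GPar U (γ c d u v)
    ¬γ {c} {d} {u} {v} g = S0∉U (subst (λ z → U (infSl z)) slope≡0 (to (linear-inAut {γ c d u v} g infV) V∈U))
      where
      slope≡0 : - (ninv c ⋆ (- 0#) ⋆ d) ≡ 0#
      slope≡0 = trans (cong -_ (trans (cong (_⋆ d) (trans (cong (ninv c ⋆_) -0#≈0#) (⋆-zeroʳ _))) (⋆-zeroˡ d))) -0#≈0#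

    normal-form : ∀ {π} → GPar U π → ∃[ c ] ∃[ d ] ∃[ w ] (π ≡ φ c d 0# w × W w × GPar U (φ c d 0# 0#))
    normal-form {lpar γK c d u v} g = contradiction g (¬γ {c} {d} {u} {v})
    normal-form {lpar φK c d u v} g = c , d , v , cong (λ z → φ c d z v) u≡0 , v∈W ,
      subst (GPar U) (trans (shift-∘ φK c d 0# (- v) u v) (cong₂ (φ c d) (trans (+-identityʳ u) u≡0) (-‿inverseʳ v)))
        (GPar-∘ {U} {shift 0# (- v)} {φ c d u v} (W-neg {v} v∈W) g)
      where
      u≡0 : u ≡ 0#
      u≡0 = proj₁ (φ-fixes-0 {c} {d} {u} {v} g)
      v∈W : W v
      v∈W = proj₂ (φ-fixes-0 {c} {d} {u} {v} g)

    Rel⇒GPar : ∀ {c d} → Rel U c d → GPar U (φ c d 0# 0#)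
    Rel⇒GPar (_ , _ , _ , g) = g

    GPar⇒Rel : ∀ {c d} → GPar U (φ c d 0# 0#) → Rel U c d
    GPar⇒Rel {c} {d} g = c , d , refl , g

    Rel-≢0 : ∀ {c d} → Rel U c d → c ≢ 0# × d ≢ 0#
    Rel-≢0 {c} {d} r = proj₁ (Rel⇒GPar {c} {d} r)

    Rel-∘ : ∀ {c d c′ d′} → Rel U c d → Rel U c′ d′ → Rel U (c ⋆ c′) (d ⋆ d′)
    Rel-∘ {c} {d} {c′} {d′} r r′ = GPar⇒Rel {c ⋆ c′} {d ⋆ d′} (subst (GPar U)
      (cong₂ (φ (c ⋆ c′) (d ⋆ d′)) (trans (+-identityʳ _) (⋆-zeroˡ c′)) (trans (+-identityʳ _) (⋆-zeroˡ d′)))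
      -- The factors appear in reverse because `_∘ᴸ_` applies its second argument first, while
      -- parameters multiply on the right.
      (GPar-∘ {U} {φ c′ d′ 0# 0#} {φ c d 0# 0#} (Rel⇒GPar {c′} {d′} r′) (Rel⇒GPar {c} {d} r)))

    Rel-⁻¹ : ∀ {c d} → Rel U c d → Rel U (ninv c) (ninv d)
    Rel-⁻¹ {c} {d} r = GPar⇒Rel {ninv c} {ninv d} (subst (GPar U)
      (cong₂ (φ (ninv c) (ninv d)) (trans (cong -_ (⋆-zeroˡ _)) -0#≈0#) (trans (cong -_ (⋆-zeroˡ _)) -0#≈0#))
      (GPar-⁻¹ {U} {φ c d 0# 0#} (Rel⇒GPar {c} {d} r)))

    Rel-1 : Rel U 1# 1#
    Rel-1 = GPar⇒Rel {1#} {1#} (TPar-0 {U})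

    Rel-acts : ∀ {c d} → Rel U c d → ∀ {x y} → U (aff x y) → U (aff (x ⋆ c) (y ⋆ d))
    Rel-acts {c} {d} r {x} {y} u = subst U (cong₂ aff (+-identityʳ _) (+-identityʳ _)) (to (linear-inAut {φ c d 0# 0#} (Rel⇒GPar {c} {d} r) (aff x y)) u)

    Rel-W : ∀ {c d} → Rel U c d → ∀ {w} → W w → W (w ⋆ d)
    Rel-W {c} {d} r {w} a = U⇒W {w ⋆ d} (subst (λ z → U (aff z (w ⋆ d))) (⋆-zeroˡ c) (Rel-acts {c} {d} r {0#} {w} (W⇒U {w} a)))

    10∉U : ¬ U (aff 1# 0#)
    10∉U u = 1≢0 (proj₁ (aff-injective (tangency {0#} W-0 {aff 1# 0#} u (aff∈ℓ₀ 1# 0#))))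

    -- If d ≠ 1 then w ↦ w ⋆ d − w permutes W, so (x , y) ↦ (x , y ⋆ d) fixes a point of U on the line x = 1.
    Rel-1⇒1 : ∀ {d} → Rel U 1# d → d ≡ 1#
    Rel-1⇒1 {d} r = decidable-stable (d ≟ 1#) λ d≢1 → absurd d≢1 (size-witness (column 1#) 0<q)
      where
      δ : Carrier → Carrier
      δ w = w ⋆ d + - w
      δ-- : ∀ a b → δ a + - δ b ≡ δ (a + - b)
      δ-- a b = trans (cong (δ a +_) (sym (-‿+-comm _ _)))
        (trans (solve 4 (λ a b c d → (a ⊕ b) ⊕ (c ⊕ d) ⊜ (a ⊕ c) ⊕ (b ⊕ d)) refl (a ⋆ d) (- a) (- (b ⋆ d)) (- - b))
          (cong₂ _+_ (trans (cong (a ⋆ d +_) (sym (-‿⋆ b d))) (sym (⋆-distribʳ d a (- b)))) (-‿+-comm a (- b))))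
        where open +-Solver
      δ≡0⇒ : d ≢ 1# → ∀ {w} → δ w ≡ 0# → w ≡ 0#
      δ≡0⇒ d≢1 {w} eq = decidable-stable (w ≟ 0#) λ w≢0 →
        d≢1 (⋆-cancelˡ w≢0 (trans (x-y≡0⇒x≡y eq) (sym (⋆-identityʳ w))))
      δ-injective : d ≢ 1# → ∀ {a b} → δ a ≡ δ b → a ≡ b
      δ-injective d≢1 {a} {b} eq = x-y≡0⇒x≡y (δ≡0⇒ d≢1 (trans (sym (δ-- a b)) (trans (cong (_+ - δ b) eq) (-‿inverseʳ _))))
      -- Both (1,y) and (1, y ⋆ d) lie in U, so `δ y` lies in W and equals `δ w` for some w in W.
      -- Since `δ` is injective on the whole field, y = w.
      fixed : d ≢ 1# → ∀ {y} → U (aff 1# y) → W y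
      fixed d≢1 {y} u =
        let y⋆d = subst (λ z → U (aff z (y ⋆ d))) (⋆-identityʳ 1#) (Rel-acts {1#} {d} r {1#} {y} u)
            w , a , eq = size-surj {P = W} {Q = W} _≟_ δ (λ {w} a → W-+ {w ⋆ d} { - w} (Rel-W {1#} {d} r {w} a) (W-neg {w} a))
                           (λ _ _ → δ-injective d≢1) size-W size-W {δ y} (column-coset {1#} {y} {y ⋆ d} u y⋆d)
        in subst W (δ-injective d≢1 eq) a
      absurd : d ≢ 1# → ¬ ∃ (Fibre V 1#)
      -- Translating by - y, which now lies in W, moves the point to (1,0) on the line y = 0, whose
      -- only point of U is the origin.
      absurd d≢1 ((x , y) , u , x≡1) = 10∉U (subst (λ z → U (aff 1# z)) (-‿inverseʳ y) (W-translates { - y} {1#} {y} (W-neg {y} (fixed d≢1 {y} u′)) u′))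
        where
        u′ : U (aff 1# y)
        u′ = subst (λ z → U (aff z y)) x≡1 u

    -- The quotient of the two pairs is a pair with first entry 1, so `Rel-1⇒1` applies.
    Rel-functional : ∀ {c d d′} → Rel U c d → Rel U c d′ → d ≡ d′
    Rel-functional {c} {d} {d′} r r′ = ⋆-cancelʳ (ninv-nonzero (proj₂ (Rel-≢0 {c} {d′} r′)))
      (trans (Rel-1⇒1 (subst (λ z → Rel U z (d ⋆ ninv d′)) (⋆-ninvʳ (proj₁ (Rel-≢0 {c} {d} r))) (Rel-∘ {c} {d} {ninv c} {ninv d′} r (Rel-⁻¹ {c} {d′} r′))))
        (sym (⋆-ninvʳ (proj₂ (Rel-≢0 {c} {d′} r′)))))

  -- Orders of the groups G₁, C and D and of the kernel of δ

  module Orders (U : PointSet) (unital : Unital U) (V∈U : U infV) {n : ℕ} (hG : HasSize (GPar U) n) (q∣n : q ∣ n)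
                    (O∈U : U (aff 0# 0#)) (tan₀ : Tangent U (sl 0# 0#)) where
    open Normalised U unital V∈U hG q∣n O∈U tan₀ public

    -- The set `E` is the kernel of δ, and its order is the number r of the statement.
    C D E : Carrier → Set
    C c = ∃[ d ] Rel U c d
    D d = ∃[ c ] Rel U c d
    E c = Rel U c 1#

    -- The number of linear parts of G serves as the order of G₁: by `normal-form` the linear part
    -- of every element of G is itself an element of G₁.
    n₁ : ℕ
    n₁ = k {U} hG hT

    size-G1 : HasSize (G1Par U) n₁
    size-G1 = size-resp {P = K {U} hG hT} {Q = G1Par U} ⇒ ⇐ (hK {U} hG hT)
      where
      ⇒ : ∀ {π} → K {U} hG hT π → G1Par U π
      ⇒ (ρ , g , refl) = let c , d , w , eq , _ , g′ = normal-form {ρ} g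
                         in c , d , cong linear-part eq , subst (GPar U) (sym (cong linear-part eq)) g′
      ⇐ : ∀ {π} → G1Par U π → K {U} hG hT π
      ⇐ (c , d , refl , g) = φ c d 0# 0# , g , refl

    n≡q*n₁ : n ≡ q ℕ.* n₁
    n≡q*n₁ = trans (|G|≡k*t {U} hG hT) (trans (cong (n₁ ℕ.*_) t≡q) (ℕP.*-comm n₁ q))

    size-C : HasSize C n₁
    size-C = size-bij {P = G1Par U} {Q = C} LPar.c (λ { (c , d , refl , g) → d , GPar⇒Rel {c} {d} g })
      (λ {c} (d , r) → φ c d 0# 0# , r , refl)
      (λ { (c , d , refl , g) (.c , d′ , refl , g′) refl → cong (λ z → φ c z 0# 0#) (Rel-functional {c} {d} {d′} (GPar⇒Rel {c} {d} g) (GPar⇒Rel {c} {d′} g′)) })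
      size-G1

    Rel? : ∀ c d → Dec (Rel U c d)
    Rel? c d = map′ (GPar⇒Rel {c} {d}) (Rel⇒GPar {c} {d}) (GPar? {U} hG (φ c d 0# 0#))

    sizes-E : ∃[ r ] HasSize (λ c → C c × E c) r
    sizes-E = size-filter (λ c → Rel? c 1#) size-C

    r : ℕ
    r = proj₁ sizes-E

    size-E : HasSize E r
    size-E = size-resp proj₂ (λ e → (1# , e) , e) (proj₂ sizes-E)

    -- The fibre of δ over `d` is the coset of the kernel `E` through any `c₀` in it.
    size-fibre : ∀ {d} → D d → HasSize (λ c → Rel U c d) r
    size-fibre {d} (c₀ , r₀) = size-bij {P = E} {Q = λ c → Rel U c d} (_⋆ c₀)
      (λ {c} r → subst (Rel U (c ⋆ c₀)) (⋆-identityˡ d) (Rel-∘ {c} {1#} {c₀} {d} r r₀))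
      (λ {c} r → c ⋆ ninv c₀ , subst (Rel U (c ⋆ ninv c₀)) (⋆-ninvʳ (proj₂ (Rel-≢0 {c} {d} r))) (Rel-∘ {c} {d} {ninv c₀} {ninv d} r (Rel-⁻¹ {c₀} {d} r₀)) ,
                 ninv-⋆-cancelʳ c c₀≢0)
      (λ _ _ → ⋆-cancelʳ c₀≢0) size-E
      where
      c₀≢0 : c₀ ≢ 0#
      c₀≢0 = proj₁ (Rel-≢0 {c₀} {d} r₀)

    sizes-D : ∃[ m ] HasSize (Image (G1Par U) LPar.d) m
    sizes-D = size-image _≟_ LPar.d size-G1

    nD : ℕ
    nD = proj₁ sizes-D

    size-D : HasSize D nD
    size-D = size-resp {P = Image (G1Par U) LPar.d} {Q = D} (λ { (_ , (c , d , refl , g) , refl) → c , GPar⇒Rel {c} {d} g })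
      (λ {d} (c , r) → φ c d 0# 0# , r , refl) (proj₂ sizes-D)

    n₁≡r*nD : n₁ ≡ r ℕ.* nD
    n₁≡r*nD = trans (size-fibres {P = G1Par U} {Q = D} LPar.d r (λ { (c , d , refl , g) → c , GPar⇒Rel {c} {d} g }) fibre size-G1 size-D) (ℕP.*-comm nD r)
      where
      fibre : ∀ {d} → D d → HasSize (λ π → G1Par U π × LPar.d π ≡ d) r
      fibre {d} hd = size-bij (λ c → φ c d 0# 0#) (λ r → r , refl)
        (λ { ((c , d , refl , g) , refl) → c , GPar⇒Rel {c} {d} g , refl }) (λ { _ _ refl → refl }) (size-fibre {d} hd)

    module C-action = FreeAction _≟_ size-C (λ c x → x ⋆ c)
    module E-action = FreeAction _≟_ size-E (λ c x → x ⋆ c)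

    -- Right multiplication by C on the q² - 1 nonzero elements. The resulting divisibility for the
    -- order of C is one for the order of G₁, and it becomes the bound on the order of G after
    -- multiplication by q.
    C-free : C-action.IsFreeOn (_≢ 0#)
    C-free = record
      { closed = λ {c} (d , r) x≢0 → ⋆-nonzero x≢0 (proj₁ (Rel-≢0 {c} {d} r))
      ; free = λ _ _ x≢0 → ⋆-cancelˡ x≢0
      ; unit = 1# , (1# , Rel-1) , λ {x} _ → ⋆-identityʳ x
      ; inverse = λ {c} (d , r) → ninv c , (ninv d , Rel-⁻¹ {c} {d} r) , λ {x} _ → ⋆-ninv-cancelʳ x (proj₁ (Rel-≢0 {c} {d} r))
      ; compose = λ {c} {c′} (d , r) (d′ , r′) → c ⋆ c′ , (d ⋆ d′ , Rel-∘ {c} {d} {c′} {d′} r r′) , λ {x} _ → sym (⋆-assoc x c c′)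
      }

    n∣q[q²-1] : n ∣ q ℕ.* (q ℕ.* q ℕ.∸ 1)
    n∣q[q²-1] = subst₂ _∣_ (sym n≡q*n₁) (cong (λ z → q ℕ.* (z ℕ.∸ 1)) (sym q²≡1+2h)) (*-monoʳ-∣ q (C-action.orbits-∣ C-free size-F*))

    -- Since q < q², there is a secant y = const through (1,0,0), on which the kernel of δ will act.
    outside-W : ∃[ y ] ¬ W y
    outside-W = let a , b , ha , hb , eq = size-split (size-dec _≟_ size-W) size-carrier
                    y , _ , y∉ = size-witness hb (positive (trans (cong (ℕ._+ b) (size-≡ size-W (size-resp proj₂ (tt ,_) ha))) (trans eq |F|≡q²)))
                in y , y∉
      where
      positive : ∀ {b} → q ℕ.+ b ≡ q ℕ.* q → 0 ℕ.< b
      positive {zero} eq = contradiction (ℕP.*-cancelˡ-≡ 1 q q (trans (ℕP.*-identityʳ q) (trans (sym (ℕP.+-identityʳ q)) eq))) (ℕP.<⇒≢ 1<q)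
      positive {suc b} _ = ℕ.s≤s ℕ.z≤n

    -- The collineations φ(c,1,0,0) preserve every line y = const. Off W no point of U on that line
    -- has x = 0, so right multiplication by c acts freely on the q + 1 abscissas.
    E-free : ∀ {y} → ¬ W y → E-action.IsFreeOn (λ x → U (aff x y))
    E-free {y} y∉W = record
      { closed = λ {c} {x} r u → subst (λ z → U (aff (x ⋆ c) z)) (⋆-identityʳ y) (Rel-acts {c} {1#} r {x} {y} u)
      ; free = λ {_} {_} {x} _ _ u → ⋆-cancelˡ (x≢0 u)
      ; unit = 1# , Rel-1 , λ {x} _ → ⋆-identityʳ x
      ; inverse = λ {c} r → ninv c , subst (Rel U (ninv c)) ninv1≡1 (Rel-⁻¹ {c} {1#} r) , λ {x} _ → ⋆-ninv-cancelʳ x (proj₁ (Rel-≢0 {c} {1#} r))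
      ; compose = λ {c} {c′} r r′ → c ⋆ c′ , subst (Rel U (c ⋆ c′)) (⋆-identityʳ 1#) (Rel-∘ {c} {1#} {c′} {1#} r r′) , λ {x} _ → sym (⋆-assoc x c c′)
      }
      where
      x≢0 : ∀ {x} → U (aff x y) → x ≢ 0#
      x≢0 u refl = y∉W (U⇒W {y} u)
      ninv1≡1 : ninv 1# ≡ 1#
      ninv1≡1 = trans (sym (⋆-identityˡ _)) (⋆-ninvʳ 1≢0)

    row-size : ∀ {y} → ¬ W y → HasSize (λ x → U (aff x y)) (suc q)
    row-size {y} y∉W = size-bij {P = Fibre (S 0#) y} {Q = λ x → U (aff x y)} proj₁
      (λ {z} (u , l) → subst (λ w → U (aff (proj₁ z) w)) (trans (sym (level-S0 (proj₁ z) (proj₂ z))) l) u)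
      (λ {x} u → (x , y) , (u , level-S0 x y) , refl)
      (λ {z} {z′} (_ , l) (_ , l′) eq → cong₂ _,_ eq (trans (sym (level-S0 (proj₁ z) (proj₂ z))) (trans l (trans (sym l′) (level-S0 (proj₁ z′) (proj₂ z′))))))
      (secant-fibre (S 0#) {k = 1} (outside (S 0#) S0∉U) refl {y} (¬tangent⇒secant {ℓ (S 0#) y} (λ tan → y∉W (T⇒W {y} tan))))

    r∣q+1 : r ∣ suc q
    r∣q+1 = let y , y∉W = outside-W in E-action.orbits-∣ (E-free {y} y∉W) (row-size {y} y∉W)

    D-square : ∀ {d} → D d → IsSquare d
    D-square {d} (c , r) = stabiliser-square size-W W-0 (proj₂ (Rel-≢0 {c} {d} r)) (λ {w} → Rel-W {c} {d} r {w})

    -- This is where squareness enters: for a square `d` the invariance of W under `_⋆ d` is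
    -- invariance under field multiplication.
    D-kernel : ∀ {d} → D d → InKernel W d
    D-kernel {d} hd@(c , r) w a = subst W (trans (⋆-□ w (D-square {d} hd)) (*-comm w d)) (Rel-W {c} {d} r {w} a)

    C-subgroup : IsSubgroup⋆ C
    C-subgroup = (λ c (d , r) → proj₁ (Rel-≢0 {c} {d} r)) , (1# , Rel-1) ,
      (λ c c′ (d , r) (d′ , r′) → d ⋆ d′ , Rel-∘ {c} {d} {c′} {d′} r r′) ,
      (λ c (d , r) → ninv c , (ninv d , Rel-⁻¹ {c} {d} r) , ⋆-ninvʳ (proj₁ (Rel-≢0 {c} {d} r)))

    D-subgroup : IsSubgroup⋆ D
    D-subgroup = (λ d (c , r) → proj₂ (Rel-≢0 {c} {d} r)) , (1# , Rel-1) ,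
      (λ d d′ (c , r) (c′ , r′) → c ⋆ c′ , Rel-∘ {c} {d} {c′} {d′} r r′) ,
      (λ d (c , r) → ninv d , (ninv c , Rel-⁻¹ {c} {d} r) , ⋆-ninvʳ (proj₂ (Rel-≢0 {c} {d} r)))

  -- Tangents through (1,0,0), the factorisation of G, and normality of H

  module Structure (U : PointSet) (unital : Unital U) (V∈U : U infV) {n : ℕ} (hG : HasSize (GPar U) n) (q∣n : q ∣ n)
                    (O∈U : U (aff 0# 0#)) (tan₀ : Tangent U (sl 0# 0#)) where
    open Orders U unital V∈U hG q∣n O∈U tan₀ public

    InG⇒ : ∀ {α} → InG U α → ∃[ c ] ∃[ d ] ∃[ w ] (ActsAs α (φ c d 0# w) × W w × GPar U (φ c d 0# 0#))
    InG⇒ {α} (a , π , nz , acts) = let c , d , w , eq , W∋w , g = normal-form {π} (nz , α , acts , a)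
                                   in c , d , w , subst (ActsAs α) eq acts , W∋w , g

    InH⇔ : ∀ α → InH U α ⇔ (∃[ w ] (W w × ActsAs α (φ 1# 1# 0# w)))
    InH⇔ α = mk⇔ ⇒ ⇐
      where
      ⇒ : InH U α → ∃[ w ] (W w × ActsAs α (φ 1# 1# 0# w))
      ⇒ (a , u , v , acts) = v , subst (λ z → TPar U (z , v)) u≡0 τ , subst (λ z → ActsAs α (shift z v)) u≡0 acts
        where
        τ : TPar U (u , v)
        τ = shift-nonzero u v , α , acts , a
        u≡0 : u ≡ 0#
        u≡0 = vertical {u} {v} τ
      ⇐ : ∃[ w ] (W w × ActsAs α (φ 1# 1# 0# w)) → InH U α
      ⇐ (w , a , acts) = inAut-GPar {U} {shift 0# w} {α} a acts , 0# , w , acts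

    column₀ : ∀ P → (U P × P I vert 0#) ⇔ (P ≡ infV ⊎ ∃[ w ] (W w × P ≡ aff 0# w))
    column₀ P = mk⇔ (λ (u , i) → ⇒ P u (I⇒Inc {P} {vert 0#} i)) ⇐
      where
      ⇒ : ∀ P → U P → Inc P (vert 0#) → P ≡ infV ⊎ ∃[ w ] (W w × P ≡ aff 0# w)
      ⇒ (aff x y) u i = inj₂ (y , U⇒W {y} (subst (λ z → U (aff z y)) x≡0 u) , cong (λ z → aff z y) x≡0)
        where
        x≡0 : x ≡ 0#
        x≡0 = trans (sym (+-identityʳ x)) i
      ⇒ infV _ _ = inj₁ refl
      ⇐ : P ≡ infV ⊎ ∃[ w ] (W w × P ≡ aff 0# w) → U P × P I vert 0#
      ⇐ (inj₁ refl) = V∈U , Inc⇒I {infV} {vert 0#} tt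
      ⇐ (inj₂ (w , a , refl)) = W⇒U {w} a , Inc⇒I {aff 0# w} {vert 0#} (+-identityˡ 0#)

    AffineTangent : Line → Set
    AffineTangent L = L ≢ linf × infSl 0# I L × Tangent U L

    -- Vertical lines miss (1,0,0), so the affine lines through it are those parametrised by
    -- `level (S 0#)`, that is, by the ordinate.
    through-S0 : ∀ L → L ≢ linf → Inc (infSl 0#) L → ∃[ s ] L ≡ ℓ (S 0#) s
    through-S0 (sl s t) _ i = - t , cong₂ sl (x+y≡0⇒x≡-y i) (sym (-‿involutive t))
    through-S0 linf ≢linf _ = contradiction refl ≢linf

    AffineTangent⇒ : ∀ {L} → AffineTangent L → ∃[ s ] (W s × L ≡ ℓ (S 0#) s)
    AffineTangent⇒ {L} (≢linf , i , tan) = let s , eq = through-S0 L ≢linf (I⇒Inc {infSl 0#} {L} i)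
                                           in s , T⇒W {s} (subst (Tangent U) eq tan) , eq

    AffineTangent⇐ : ∀ {s} → W s → AffineTangent (ℓ (S 0#) s)
    AffineTangent⇐ {s} a = ≢linf , Inc⇒I {infSl 0#} {ℓ (S 0#) s} (pt∈ℓ (S 0#) {s}) , W⇒T {s} a
      where
      ≢linf : ℓ (S 0#) s ≢ linf
      ≢linf ()

    size-AffineTangent : HasSize AffineTangent q
    size-AffineTangent = size-bij {P = W} {Q = AffineTangent} (ℓ (S 0#)) (λ {s} → AffineTangent⇐ {s})
      (λ {L} tan → let s , a , eq = AffineTangent⇒ {L} tan in s , a , sym eq)
      (λ _ _ eq → -‿injective (sl-injective eq)) size-W
      where
      sl-injective : ∀ {s t s′ t′} → sl s t ≡ sl s′ t′ → t ≡ t′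
      sl-injective refl = refl

    tangency-points : ∀ P → (∃[ L ] (L ≢ linf × infSl 0# I L × Tangent U L × U P × P I L)) ⇔ (∃[ w ] (W w × P ≡ aff 0# w))
    tangency-points P = mk⇔ ⇒ ⇐
      where
      ⇒ : ∃[ L ] (L ≢ linf × infSl 0# I L × Tangent U L × U P × P I L) → ∃[ w ] (W w × P ≡ aff 0# w)
      ⇒ (L , ≢linf , i , tan , u , on) = let s , a , eq = AffineTangent⇒ {L} (≢linf , i , tan)
                                          in s , a , tangency {s} a {P} u (subst (P I_) eq on)
      ⇐ : ∃[ w ] (W w × P ≡ aff 0# w) → ∃[ L ] (L ≢ linf × infSl 0# I L × Tangent U L × U P × P I L)
      ⇐ (w , a , refl) = let ≢linf , i , tan = AffineTangent⇐ {w} a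
                         in ℓ (S 0#) w , ≢linf , i , tan , W⇒U {w} a , aff∈ℓ₀ 0# w

    G=HG1 : ∀ α → InG U α ⇔ (∃[ β ] ∃[ δ ] (InH U β × InG1 U δ × (∀ P → α · P ≡ β · (δ · P))))
    G=HG1 α = mk⇔ ⇒ ⇐
      where
      ⇒ : InG U α → ∃[ β ] ∃[ δ ] (InH U β × InG1 U δ × (∀ P → α · P ≡ β · (δ · P)))
      ⇒ g = let c , d , w , acts , a , g₁ = InG⇒ {α} g
                δ = linear (φ c d 0# 0#) (proj₁ g₁)
                β = translationᶜ 0# w
            in β , δ , (W⇒inAut {w} a , 0# , w , translation-acts 0# w) ,
               ((linear-inAut {φ c d 0# 0#} g₁ , φ c d 0# 0# , proj₁ g₁ , linear-acts (φ c d 0# 0#) (proj₁ g₁)) ,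
                 c , d , proj₁ (proj₁ g₁) , proj₂ (proj₁ g₁) , linear-acts (φ c d 0# 0#) (proj₁ g₁)) ,
               acts-agree α (β ∘ᶜ δ) {φ c d 0# w} acts (subst (ActsAs (β ∘ᶜ δ))
                 (trans (shift-∘ φK c d 0# w 0# 0#) (cong₂ (φ c d) (+-identityˡ 0#) (+-identityˡ w)))
                 (acts-∘ β δ (shift 0# w) (φ c d 0# 0#) (translation-acts 0# w) (linear-acts (φ c d 0# 0#) (proj₁ g₁))))
      ⇐ : ∃[ β ] ∃[ δ ] (InH U β × InG1 U δ × (∀ P → α · P ≡ β · (δ · P))) → InG U α
      ⇐ (β , δ , (b , u , v , actsβ) , ((d , _) , c₁ , d₁ , c₁≢0 , d₁≢0 , actsδ) , eq) =
        inAut-agree {U} {β ∘ᶜ δ} {α} (λ P → sym (eq P)) (inAut-∘ {U} {β} {δ} b d) ,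
        shift u v ∘ᴸ φ c₁ d₁ 0# 0# , ∘ᴸ-nonzero (shift u v) (φ c₁ d₁ 0# 0#) (shift-nonzero u v) (c₁≢0 , d₁≢0) ,
        λ x y → trans (eq (aff x y)) (acts-∘ β δ (shift u v) (φ c₁ d₁ 0# 0#) actsβ actsδ x y)

    H-normal : ∀ α β → InG U α → InH U β → ∃[ β′ ] (InH U β′ × (∀ P → α · (β · P) ≡ β′ · (α · P)))
    H-normal α β g (b , u , v , actsβ) =
      let c , d , w , acts , _ , g₁ = InG⇒ {α} g
          c≢0 , d≢0 = proj₁ g₁
          a = proj₁ g
          commute = cong₂ (λ c′ d′ → φ c′ d′ (u ⋆ c + 0#) (v ⋆ d + w)) (⋆-identityˡ c) (⋆-identityˡ d)
          -- The conjugate of `β` by `α`. The product `α β` has the same linear part as `α`, so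
          -- composing with the inverse of `α` leaves a translation.
          β′ = (α ∘ᶜ β) ∘ᶜ (α ⁻¹ᶜ)
      in β′ , (inAut-∘ {U} {α ∘ᶜ β} {α ⁻¹ᶜ} (inAut-∘ {U} {α} {β} a b) (inAut-⁻¹ {U} {α} a) ,
               -- The translation vector is left in the form supplied by `∘-⁻¹-shift`.
               - 0# + (u ⋆ c + 0#) , - w + (v ⋆ d + w) ,
               subst (ActsAs β′) (trans (cong (_∘ᴸ (φ c d 0# w ⁻¹ᴸ)) commute) (∘-⁻¹-shift {φK} {c} {d} {u ⋆ c + 0#} {v ⋆ d + w} {0#} {w} c≢0 d≢0))
                 (acts-∘ (α ∘ᶜ β) (α ⁻¹ᶜ) (φ c d 0# w ∘ᴸ shift u v) (φ c d 0# w ⁻¹ᴸ)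
                   (acts-∘ α β (φ c d 0# w) (shift u v) acts actsβ) (acts-⁻¹ α (φ c d 0# w) (c≢0 , d≢0) acts))) ,
         λ P → cong (λ Q → α · (β · Q)) (sym (Inverse.strictlyInverseʳ (Collineation.pt α) P))


  -- Moving a given unital into normal position

  record Normalisable (U : PointSet) : Set where
    field
      unital : Unital U
      V∈U : U infV
      {order} : ℕ
      hG : HasSize (GPar U) order
      q∣n : q ∣ order

  record IsNormalised (U : PointSet) : Set where
    field
      normalisable : Normalisable U
      O∈U : U (aff 0# 0#)
      tan₀ : Tangent U (sl 0# 0#)
    open Normalisable normalisable public

  -- The translation takes the contact point (x,y) of an affine tangent through (1,0,0) to the
  -- origin, so that tangent becomes y = 0. It fixes `infV`, and conjugation by it preserves the
  -- order of the group.
  origin-to-tangency : ∀ {U} → Normalisable U → ∃[ σ ] IsNormalised (move σ U)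
  origin-to-tangency {U} N = let x , y , u , tan = tangency-point in move-to {x} {y} u tan
    where
    open Vertical U (Normalisable.unital N) (Normalisable.V∈U N) (Normalisable.hG N) (Normalisable.q∣n N)
    move-to : ∀ {x y} → U (aff x y) → Tangents (S 0#) y → ∃[ σ ] IsNormalised (move σ U)
    move-to {x} {y} u tan = σ , record
      { normalisable = record
        { unital = move-unital {U} σ (Normalisable.unital N)
        ; V∈U = Normalisable.V∈U N
        ; hG = move-GPar {U} σ {shift (- x) (- y)} (shift-nonzero (- x) (- y)) (translation-acts (- x) (- y)) (Normalisable.hG N)
        ; q∣n = Normalisable.q∣n N
        }
      ; O∈U = subst U (cong₂ aff (sym (0--≡ x)) (sym (0--≡ y))) u
      ; tan₀ = move-line {U} σ (sl 0# 0#) (subst (Tangent U) (sym line) tan)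
      }
      where
      σ : Collineation
      σ = translationᶜ (- x) (- y)
      0--≡ : ∀ z → 0# + - - z ≡ z
      0--≡ z = trans (+-identityˡ _) (-‿involutive z)
      line : sl 0# (0# + - ((- - x) ⋆ 0# + - - y)) ≡ ℓ (S 0#) y
      line = cong₂ sl (sym -0#≈0#) (trans (+-identityˡ _) (cong -_ (trans (cong₂ _+_ (⋆-zeroʳ _) (-‿involutive y)) (+-identityˡ y))))

  abstract
    normalising : ∀ U′ → Unital U′ → U′ infV ⊎ U′ (infSl 0#) → ∃[ n ] (HasSize (GPar U′) n × q ∣ n) → ∃[ σ ] IsNormalised (move σ U′)
    normalising U′ unital (inj₁ V∈U) (n , hG , q∣n) =
      origin-to-tangency {U′} record { unital = unital ; V∈U = V∈U ; hG = hG ; q∣n = q∣n }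
    normalising U′ unital (inj₂ S0∈U) (n , hG , q∣n) =
      let σ , N = origin-to-tangency {move swap U′} record
            -- The swap sends `infV` to `infSl 0#` by computation, so the hypothesis on (1,0,0) is
            -- literally the membership of `infV` in the swapped unital.
            { unital = move-unital {U′} swap unital ; V∈U = S0∈U
            ; hG = move-GPar {U′} swap {γ 1# 1# 0# 0#} (1≢0 , 1≢0) swap-acts hG ; q∣n = q∣n }
      in σ ∘ᶜ swap , N
      where
      swap : Collineation
      swap = collineation swapping
      swap-acts : ActsAs swap (γ 1# 1# 0# 0#)
      swap-acts x y = cong₂ aff (sym (trans (+-identityʳ _) (⋆-identityʳ y))) (sym (trans (+-identityʳ _) (⋆-identityʳ x)))

  theorem : Theorem5p2
  theorem U′ unital′ inf∈ hyp =
    -- `move` takes preimages under the inverse of `σ`, so `U` is the image in the sense of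
    -- `ImageOf` by definition.
    U , (σ , λ P → mk⇔ id id) , unital , parabolic , V∈U ,
      (W , (W-0 , (λ x y → W-+ {x} {y}) , (λ x → W-neg {x})) , size-W , InH⇔ , (λ l → InKernel⇒InFq size-W W-0 {l}) ,
        column₀ , size-AffineTangent , tangency-points , D-subgroup ,
        λ d hd → D-kernel {d} hd , InKernel⇒InFq size-W W-0 {d} (D-kernel {d} hd)) ,
      G=HG1 , (order , hG , q∣n , n∣q[q²-1]) , H-normal , (order , n₁ , hG , size-G1 , n≡q*n₁) , (n₁ , size-G1 , size-C) ,
      C-subgroup , (λ c d d′ → Rel-functional {c} {d} {d′}) , (λ c c′ d d′ → Rel-∘ {c} {d} {c′} {d′}) ,
      (n₁ , nD , r , size-C , size-D , n₁≡r*nD , r∣q+1 , λ d → size-fibre {d})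
    where
    σ : Collineation
    σ = proj₁ (normalising U′ unital′ inf∈ hyp)
    U : PointSet
    U = move σ U′
    open IsNormalised (proj₂ (normalising U′ unital′ inf∈ hyp)) using (unital; V∈U; order; hG; q∣n; O∈U; tan₀)
    open Structure U unital V∈U hG q∣n O∈U tan₀ using (parabolic; W; W-0; W-+; W-neg; size-W; InH⇔; column₀; size-AffineTangent;
      tangency-points; D-subgroup; D-kernel; G=HG1; n∣q[q²-1]; H-normal; n₁; size-G1; n≡q*n₁; size-C; C-subgroup; Rel-functional;
      Rel-∘; nD; r; size-D; n₁≡r*nD; r∣q+1; size-fibre)

open import Data.Nat using (ℕ; _*_; _^_; _≤_)

theorem5p2 : (p e : ℕ) → Prime p → p % 2 ≡ 1 → 1 ≤ e →
    (F : FiniteField) → FiniteField.size F ≡ (p ^ e) * (p ^ e) →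
    NP.Theorem5p2 F (p ^ e)
theorem5p2 = NearfieldPlane.theorem
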